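{- Fix $\varepsilon>0$ and $\gamma\in(0,1)$, and let $d_N=(1-\gamma)\sqrt{\frac{\log N}{2\log\log N}}$. For an abelian group $G$ of order $N$, an integer $d$ with $2\leqslant d\leqslant d_N$, and $p\leqslant \sqrt[d]{\frac{d!(1-\varepsilon)}{2^d}\cdot\frac{\log N}{N^{d-1}}}$, let $\Gamma\in\mathcal{G}(G,p)$. Then with high probability the diameter of $\Gamma$ is greater than $d$; that is, $\Pr(\operatorname{diam}(\Gamma)\leqslant d)\to 0$ as $N\to\infty$, uniformly over all abelian groups $G$ of order $N$, all such $d$ and all such $p$.
   Context: For a group $G$ and a subset $S\subseteq G$, the (undirected) Cayley graph $\Gamma(G;S)$ has vertex set $G$ and an edge between $g\neq h$ iff $g^{ -1}h\in S$ or $h^{ -1}g\in S$ (loops and multiple edges ignored). The model $\mathcal{G}(G,p)$ is the probability space of Cayley graphs $\Gamma(G;S)$ where each element of $G$ is put in $S$ independently with probability $p$. The diameter of a disconnected graph is infinite. "With high probability" means the error probability tends to $0$ as $N\to\infty$, uniformly over the class of groups under consideration. -}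

module Defs where

open import Algebra.Bundles using (AbelianGroup)
open import Data.Fin.Base using (Fin)
import Data.Fin.Properties as Fin
open import Data.Fin.Subset using (Subset; inside; outside; _∈_)
open import Data.Fin.Subset.Properties using (_∈?_)
import Data.Integer.Base as ℤ
open import Data.List.Base as List using (List; filter; foldr)
open import Data.Nat.Base as ℕ using (ℕ; zero; suc; _!)
import Data.Nat.Properties as ℕ
open import Data.Product.Base using (∃; ∃₂; _×_; _,_; proj₁; proj₂)
open import Data.Rational.Base as ℚ using (ℚ; 0ℚ; 1ℚ; ½)
import Data.Rational.Properties as ℚ
open import Data.Rational.Solver using (module +-*-Solver)
open import Data.Sum.Base as Sum using (_⊎_)
open import Data.Vec.Base using ([]; _∷_)
open import Function.Bundles using (Inverse)
open import Level using (Level; _⊔_)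
open import Relation.Binary.Bundles using (Setoid)
open import Relation.Binary.Core using (Rel)
import Relation.Binary.Definitions as B
open import Relation.Binary.PropositionalEquality
  using (_≡_; refl; sym; trans; cong; cong₂; subst; setoid; module ≡-Reasoning)
open import Relation.Nullary.Decidable as Dec using (Dec; ¬?; _×-dec_; _⊎-dec_)
open import Relation.Nullary.Negation using (¬_)
open import Relation.Unary using (Pred; Decidable)

-- The equality of reals is _≃ᵣ_, not propositional equality of sequences.
Cauchy : (ℕ → ℚ) → Set
Cauchy x = ∀ (η : ℚ) → 0ℚ ℚ.< η →
  ∃ λ M → ∀ m n → M ℕ.≤ m → M ℕ.≤ n → ℚ.∣ x m ℚ.- x n ∣ ℚ.< η

record ℝ : Set where
  constructor mkℝ
  field
    seq    : ℕ → ℚ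
    cauchy : Cauchy seq

open ℝ public

infix  4 _≃ᵣ_ _<ᵣ_ _≤ᵣ_
infixl 6 _+ᵣ_ _-ᵣ_
infixl 7 _*ᵣ_
infix  8 -ᵣ_
infixr 8 _^ᵣ_

_≃ᵣ_ : ℝ → ℝ → Set
x ≃ᵣ y = ∀ (η : ℚ) → 0ℚ ℚ.< η →
  ∃ λ M → ∀ n → M ℕ.≤ n → ℚ.∣ seq x n ℚ.- seq y n ∣ ℚ.< η

_<ᵣ_ : ℝ → ℝ → Set
x <ᵣ y = ∃ λ (η : ℚ) → 0ℚ ℚ.< η ×
  ∃ λ M → ∀ n → M ℕ.≤ n → seq x n ℚ.+ η ℚ.< seq y n

_≤ᵣ_ : ℝ → ℝ → Set
x ≤ᵣ y = ∀ (η : ℚ) → 0ℚ ℚ.< η →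
  ∃ λ M → ∀ n → M ℕ.≤ n → seq x n ℚ.< seq y n ℚ.+ η

private
  open +-*-Solver using (solve; _:+_; _:*_; _:-_; _:=_)

  half>0 : ∀ {η} → 0ℚ ℚ.< η → 0ℚ ℚ.< ½ ℚ.* η
  half>0 {η} η>0 = ℚ.positive⁻¹ (½ ℚ.* η) {{ℚ.pos*pos⇒pos ½ η {{ℚ.positive η>0}}}}

  halves : ∀ η → ½ ℚ.* η ℚ.+ ½ ℚ.* η ≡ η
  halves η = trans (sym (ℚ.*-distribʳ-+ η ½ ½)) (ℚ.*-identityˡ η)

  ∣-∣<-resp : ∀ {a b η} → a ≡ b → ℚ.∣ b ∣ ℚ.< η → ℚ.∣ a ∣ ℚ.< η
  ∣-∣<-resp {η = η} a≡b = subst (λ t → ℚ.∣ t ∣ ℚ.< η) (sym a≡b)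

  ∣+∣<half+half : ∀ {η} a b → ℚ.∣ a ∣ ℚ.< ½ ℚ.* η → ℚ.∣ b ∣ ℚ.< ½ ℚ.* η →
                  ℚ.∣ a ℚ.+ b ∣ ℚ.< η
  ∣+∣<half+half {η} a b a< b< = subst (ℚ.∣ a ℚ.+ b ∣ ℚ.<_) (halves η)
    (ℚ.≤-<-trans (ℚ.∣p+q∣≤∣p∣+∣q∣ a b) (ℚ.+-mono-< a< b<))

  const-cauchy : ∀ q → Cauchy (λ _ → q)
  const-cauchy q η η>0 =
    0 , λ _ _ _ _ → subst (λ t → ℚ.∣ t ∣ ℚ.< η) (sym (ℚ.+-inverseʳ q)) η>0

  abstract
    neg-cauchy : ∀ x → Cauchy x → Cauchy (λ n → ℚ.- x n)
    neg-cauchy x cx η η>0 with cx η η>0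
    ... | M , h = M , λ m n m≥ n≥ →
      subst (ℚ._< η)
        (trans (sym (ℚ.∣-p∣≡∣p∣ (x m ℚ.- x n))) (cong ℚ.∣_∣ (ℚ.neg-distrib-+ (x m) (ℚ.- x n))))
        (h m n m≥ n≥)

    +-cauchy : ∀ x y → Cauchy x → Cauchy y → Cauchy (λ n → x n ℚ.+ y n)
    +-cauchy x y cx cy η η>0
      with cx (½ ℚ.* η) (half>0 η>0) | cy (½ ℚ.* η) (half>0 η>0)
    ... | M₁ , h₁ | M₂ , h₂ = M₁ ℕ.⊔ M₂ , λ m n m≥ n≥ →
      ∣-∣<-resp
        (solve 4 (λ a b c d → (a :+ b) :- (c :+ d) := (a :- c) :+ (b :- d)) refl
          (x m) (y m) (x n) (y n))
        (∣+∣<half+half (x m ℚ.- x n) (y m ℚ.- y n)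
          (h₁ m n (ℕ.m⊔n≤o⇒m≤o M₁ M₂ m≥) (ℕ.m⊔n≤o⇒m≤o M₁ M₂ n≥))
          (h₂ m n (ℕ.m⊔n≤o⇒n≤o M₁ M₂ m≥) (ℕ.m⊔n≤o⇒n≤o M₁ M₂ n≥)))

  bounded : ∀ x → Cauchy x →
    ∃ λ B → 0ℚ ℚ.< B × ∃ λ M → ∀ n → M ℕ.≤ n → ℚ.∣ x n ∣ ℚ.≤ B
  bounded x cx with cx 1ℚ (ℚ.positive⁻¹ 1ℚ)
  ... | M , h = ℚ.∣ x M ∣ ℚ.+ 1ℚ , pos , M , bnd
    where
    pos : 0ℚ ℚ.< ℚ.∣ x M ∣ ℚ.+ 1ℚ
    pos = ℚ.+-mono-≤-< (ℚ.0≤∣p∣ (x M)) (ℚ.positive⁻¹ 1ℚ)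
    bnd : ∀ n → M ℕ.≤ n → ℚ.∣ x n ∣ ℚ.≤ ℚ.∣ x M ∣ ℚ.+ 1ℚ
    bnd n n≥ = subst (λ t → ℚ.∣ t ∣ ℚ.≤ ℚ.∣ x M ∣ ℚ.+ 1ℚ)
      (solve 2 (λ a b → b :+ (a :- b) := a) refl (x n) (x M))
      (ℚ.≤-trans (ℚ.∣p+q∣≤∣p∣+∣q∣ (x M) (x n ℚ.- x M))
        (ℚ.+-monoʳ-≤ ℚ.∣ x M ∣ (ℚ.<⇒≤ (h n M n≥ ℕ.≤-refl))))

  scale : ∀ (B : ℚ) (B>0 : 0ℚ ℚ.< B) (η : ℚ) → 0ℚ ℚ.< η →
          ∃ λ ζ → 0ℚ ℚ.< ζ × (∀ a b → ℚ.∣ a ∣ ℚ.≤ B → ℚ.∣ b ∣ ℚ.< ζ → ℚ.∣ a ℚ.* b ∣ ℚ.< η)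
  scale B B>0 η η>0 = ζ , ζ>0 , bnd
    where
    instance
      B⁺ = ℚ.positive B>0
      B≢0 = ℚ.pos⇒nonZero B
    ζ = ℚ.1/ B ℚ.* η
    ζ>0 = ℚ.positive⁻¹ ζ {{ℚ.pos*pos⇒pos (ℚ.1/ B) {{ℚ.1/pos⇒pos B}} η {{ℚ.positive η>0}}}}
    Bζ≡η : B ℚ.* ζ ≡ η
    Bζ≡η = trans (sym (ℚ.*-assoc B (ℚ.1/ B) η))
             (trans (cong (ℚ._* η) (ℚ.*-inverseʳ B)) (ℚ.*-identityˡ η))
    bnd : ∀ a b → ℚ.∣ a ∣ ℚ.≤ B → ℚ.∣ b ∣ ℚ.< ζ → ℚ.∣ a ℚ.* b ∣ ℚ.< η
    bnd a b a≤ b< = subst (ℚ._< η) (sym (ℚ.∣p*q∣≡∣p∣*∣q∣ a b))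
      (ℚ.≤-<-trans (ℚ.*-monoʳ-≤-nonNeg ℚ.∣ b ∣ {{ℚ.∣-∣-nonNeg b}} a≤)
        (subst (B ℚ.* ℚ.∣ b ∣ ℚ.<_) Bζ≡η (ℚ.*-monoʳ-<-pos B b<)))

  abstract
    *-cauchy : ∀ x y → Cauchy x → Cauchy y → Cauchy (λ n → x n ℚ.* y n)
    *-cauchy x y cx cy η η>0 =
      let A , A>0 , M₁ , bx = bounded x cx
          B , B>0 , M₂ , by = bounded y cy
          ζ₁ , ζ₁>0 , s₁    = scale A A>0 (½ ℚ.* η) (half>0 η>0)
          ζ₂ , ζ₂>0 , s₂    = scale B B>0 (½ ℚ.* η) (half>0 η>0)
          M₃ , hy           = cy ζ₁ ζ₁>0
          M₄ , hx           = cx ζ₂ ζ₂>0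
          L                 = M₁ ℕ.⊔ M₂
          R                 = M₃ ℕ.⊔ M₄
      in L ℕ.⊔ R , λ m n m≥ n≥ →
        let mL = ℕ.m⊔n≤o⇒m≤o L R m≥
            mR = ℕ.m⊔n≤o⇒n≤o L R m≥
            nL = ℕ.m⊔n≤o⇒m≤o L R n≥
            nR = ℕ.m⊔n≤o⇒n≤o L R n≥
        in ∣-∣<-resp {η = η} (split (x m) (y m) (x n) (y n))
          (∣+∣<half+half {η} (x m ℚ.* (y m ℚ.- y n)) (y n ℚ.* (x m ℚ.- x n))
            (s₁ (x m) (y m ℚ.- y n) (bx m (ℕ.m⊔n≤o⇒m≤o M₁ M₂ mL))
              (hy m n (ℕ.m⊔n≤o⇒m≤o M₃ M₄ mR) (ℕ.m⊔n≤o⇒m≤o M₃ M₄ nR)))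
            (s₂ (y n) (x m ℚ.- x n) (by n (ℕ.m⊔n≤o⇒n≤o M₁ M₂ nL))
              (hx m n (ℕ.m⊔n≤o⇒n≤o M₃ M₄ mR) (ℕ.m⊔n≤o⇒n≤o M₃ M₄ nR))))
      where
      split : ∀ a b c d → a ℚ.* b ℚ.- c ℚ.* d ≡ a ℚ.* (b ℚ.- d) ℚ.+ d ℚ.* (a ℚ.- c)
      split = solve 4 (λ a b c d → (a :* b) :- (c :* d) := a :* (b :- d) :+ d :* (a :- c)) refl

fromℚ : ℚ → ℝ
fromℚ q = mkℝ (λ _ → q) (const-cauchy q)

fromℕ : ℕ → ℝ
fromℕ n = fromℚ (ℤ.+ n ℚ./ 1)

0ᵣ 1ᵣ : ℝ
0ᵣ = fromℕ 0
1ᵣ = fromℕ 1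

_+ᵣ_ : ℝ → ℝ → ℝ
x +ᵣ y = mkℝ (λ n → seq x n ℚ.+ seq y n) (+-cauchy (seq x) (seq y) (cauchy x) (cauchy y))

-ᵣ_ : ℝ → ℝ
-ᵣ x = mkℝ (λ n → ℚ.- seq x n) (neg-cauchy (seq x) (cauchy x))

_-ᵣ_ : ℝ → ℝ → ℝ
x -ᵣ y = x +ᵣ (-ᵣ y)

_*ᵣ_ : ℝ → ℝ → ℝ
x *ᵣ y = mkℝ (λ n → seq x n ℚ.* seq y n) (*-cauchy (seq x) (seq y) (cauchy x) (cauchy y))

_^ᵣ_ : ℝ → ℕ → ℝ
x ^ᵣ zero  = 1ᵣ
x ^ᵣ suc n = x *ᵣ x ^ᵣ n

-- The reciprocal of a real with an eventual rational lower bound κ > 0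
-- is taken termwise after truncating the terms below at κ, which leaves
-- all but finitely many of them unchanged.
module _ (x : ℝ) (x>0 : 0ᵣ <ᵣ x) where
  private
    κ : ℚ
    κ = proj₁ x>0

    κ>0 : 0ℚ ℚ.< κ
    κ>0 = proj₁ (proj₂ x>0)

    t : ℕ → ℚ
    t n = κ ℚ.⊔ seq x n

    instance
      κ⁺ : ℚ.Positive κ
      κ⁺ = ℚ.positive κ>0
      κ≢0 : ℚ.NonZero κ
      κ≢0 = ℚ.pos⇒nonZero κ
      t⁺ : ∀ {n} → ℚ.Positive (t n)
      t⁺ {n} = ℚ.positive (ℚ.<-≤-trans κ>0 (ℚ.p≤p⊔q κ (seq x n)))
      t≢0 : ∀ {n} → ℚ.NonZero (t n)
      t≢0 {n} = ℚ.pos⇒nonZero (t n)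

    inv : ℕ → ℚ
    inv n = ℚ.1/ t n

    inv⁺ : ∀ n → ℚ.Positive (inv n)
    inv⁺ n = ℚ.1/pos⇒pos (t n)

    M₀ : ℕ
    M₀ = proj₁ (proj₂ (proj₂ x>0))

    t≡x : ∀ n → M₀ ℕ.≤ n → t n ≡ seq x n
    t≡x n n≥ = ℚ.p≤q⇒p⊔q≡q (ℚ.<⇒≤
      (subst (ℚ._< seq x n) (ℚ.+-identityˡ κ) (proj₂ (proj₂ (proj₂ x>0)) n n≥)))

    inv≤ : ∀ n → inv n ℚ.≤ ℚ.1/ κ
    inv≤ n = begin
      inv n                          ≡⟨ ℚ.*-identityˡ (inv n) ⟨
      1ℚ ℚ.* inv n                   ≡⟨ cong (ℚ._* inv n) (ℚ.*-inverseˡ κ) ⟨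
      ℚ.1/ κ ℚ.* κ ℚ.* inv n         ≡⟨ ℚ.*-assoc (ℚ.1/ κ) κ (inv n) ⟩
      ℚ.1/ κ ℚ.* (κ ℚ.* inv n)       ≤⟨ ℚ.*-monoˡ-≤-nonNeg (ℚ.1/ κ) {{ℚ.pos⇒nonNeg (ℚ.1/ κ) {{ℚ.1/pos⇒pos κ}}}}
                                          (ℚ.*-monoʳ-≤-nonNeg (inv n) {{ℚ.pos⇒nonNeg (inv n) {{inv⁺ n}}}}
                                            (ℚ.p≤p⊔q κ (seq x n))) ⟩
      ℚ.1/ κ ℚ.* (t n ℚ.* inv n)     ≡⟨ cong (ℚ.1/ κ ℚ.*_) (ℚ.*-inverseʳ (t n)) ⟩
      ℚ.1/ κ ℚ.* 1ℚ                  ≡⟨ ℚ.*-identityʳ (ℚ.1/ κ) ⟩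
      ℚ.1/ κ                         ∎
      where open ℚ.≤-Reasoning

    ∣inv∣≤ : ∀ n → ℚ.∣ inv n ∣ ℚ.≤ ℚ.1/ κ
    ∣inv∣≤ n = subst (ℚ._≤ ℚ.1/ κ)
      (sym (ℚ.0≤p⇒∣p∣≡p (ℚ.<⇒≤ (ℚ.positive⁻¹ (inv n) {{inv⁺ n}})))) (inv≤ n)

    diff : ∀ m n → inv m ℚ.- inv n ≡ inv m ℚ.* (inv n ℚ.* (t n ℚ.- t m))
    diff m n = begin
      inv m ℚ.- inv n
        ≡⟨ cong₂ ℚ._-_ (ℚ.*-identityʳ (inv m)) (ℚ.*-identityʳ (inv n)) ⟨
      inv m ℚ.* 1ℚ ℚ.- inv n ℚ.* 1ℚ
        ≡⟨ cong₂ (λ a b → inv m ℚ.* a ℚ.- inv n ℚ.* b) (ℚ.*-inverseˡ (t n)) (ℚ.*-inverseˡ (t m)) ⟨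
      inv m ℚ.* (inv n ℚ.* t n) ℚ.- inv n ℚ.* (inv m ℚ.* t m)
        ≡⟨ solve 4 (λ a b c d → a :* (b :* c) :- b :* (a :* d) := a :* (b :* (c :- d))) refl
             (inv m) (inv n) (t n) (t m) ⟩
      inv m ℚ.* (inv n ℚ.* (t n ℚ.- t m)) ∎
      where open ≡-Reasoning

    abstract
      inv-cauchy : Cauchy inv
      inv-cauchy η η>0 =
        let 1/κ>0          = ℚ.positive⁻¹ (ℚ.1/ κ) {{ℚ.1/pos⇒pos κ}}
            ζ₁ , ζ₁>0 , s₁ = scale (ℚ.1/ κ) 1/κ>0 η η>0
            ζ₂ , ζ₂>0 , s₂ = scale (ℚ.1/ κ) 1/κ>0 ζ₁ ζ₁>0
            M , h          = cauchy x ζ₂ ζ₂>0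
        in M₀ ℕ.⊔ M , λ m n m≥ n≥ →
          ∣-∣<-resp {η = η} (diff m n)
            (s₁ (inv m) (inv n ℚ.* (t n ℚ.- t m)) (∣inv∣≤ m)
              (s₂ (inv n) (t n ℚ.- t m) (∣inv∣≤ n)
                (∣-∣<-resp {η = ζ₂}
                  (cong₂ ℚ._-_ (t≡x n (ℕ.m⊔n≤o⇒m≤o M₀ M n≥)) (t≡x m (ℕ.m⊔n≤o⇒m≤o M₀ M m≥)))
                  (h n m (ℕ.m⊔n≤o⇒n≤o M₀ M n≥) (ℕ.m⊔n≤o⇒n≤o M₀ M m≥)))))

  recip : ℝ
  recip = mkℝ inv inv-cauchy

_÷ᵣ_[_] : (x y : ℝ) → 0ᵣ <ᵣ y → ℝ
x ÷ᵣ y [ y>0 ] = x *ᵣ recip y y>0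

sumᵣ : List ℝ → ℝ
sumᵣ = foldr _+ᵣ_ 0ᵣ

_⟶_ : (ℕ → ℝ) → ℝ → Set
a ⟶ x = ∀ (η : ℝ) → 0ᵣ <ᵣ η →
  ∃ λ K → ∀ k → K ℕ.≤ k → (a k <ᵣ x +ᵣ η) × (x <ᵣ a k +ᵣ η)

expPartialSum : ℝ → ℕ → ℝ
expPartialSum y zero    = 0ᵣ
expPartialSum y (suc k) =
  expPartialSum y k +ᵣ y ^ᵣ k *ᵣ fromℚ (ℚ._/_ (ℤ.+ 1) (k !) {{k ℕ.!≢0}})

-- Logarithms and roots are given by their graphs, which are single-valued up to _≃ᵣ_.

-- x = exp y, i.e. x = Σ_k y^k / k!
_IsExpOf_ : ℝ → ℝ → Set
x IsExpOf y = expPartialSum y ⟶ x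

_IsLogOf_ : ℝ → ℝ → Set
y IsLogOf x = x IsExpOf y

_IsRoot_Of_ : ℝ → ℕ → ℝ → Set
r IsRoot n Of x = 0ᵣ ≤ᵣ r × r ^ᵣ n ≃ᵣ x

-- D = (1 - γ) √(log N / (2 log log N)); there is no such D unless log log N > 0.
record IsDegreeBound (γ : ℝ) (N : ℕ) (D : ℝ) : Set where
  field
    logN loglogN root : ℝ
    isLogN    : logN IsLogOf fromℕ N
    isLogLogN : loglogN IsLogOf logN
    2loglogN>0 : 0ᵣ <ᵣ fromℕ 2 *ᵣ loglogN
    isRoot    : root IsRoot 2 Of (logN ÷ᵣ (fromℕ 2 *ᵣ loglogN) [ 2loglogN>0 ])
    isBound   : D ≃ᵣ (1ᵣ -ᵣ γ) *ᵣ root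

-- P is the d-th root of (d! (1 - ε) / 2^d) · (log N / N^(d-1)).
record IsProbabilityBound (ε : ℝ) (N : ℕ) .{{_ : ℕ.NonZero N}} (d : ℕ) (P : ℝ) : Set where
  field
    logN   : ℝ
    isLogN : logN IsLogOf fromℕ N
    isRoot : P IsRoot d Of
      ((fromℕ (d !) *ᵣ (1ᵣ -ᵣ ε)) *ᵣ fromℚ (ℚ._/_ (ℤ.+ 1) (2 ℕ.^ d) {{ℕ.m^n≢0 2 d}}) *ᵣ
       (logN *ᵣ fromℚ (ℚ._/_ (ℤ.+ 1) (N ℕ.^ (d ℕ.∸ 1)) {{ℕ.m^n≢0 N (d ℕ.∸ 1)}})))

module Graph {a ℓ e : Level} (V : Setoid a ℓ) (_~_ : Rel (Setoid.Carrier V) e) where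
  open Setoid V using (Carrier; _≈_)

  data Walk : ℕ → Carrier → Carrier → Set (a ⊔ ℓ ⊔ e) where
    stop : ∀ {u v} → u ≈ v → Walk 0 u v
    step : ∀ {k u v w} → u ~ v → Walk k v w → Walk (suc k) u w

  IsDistance : Carrier → Carrier → ℕ → Set (a ⊔ ℓ ⊔ e)
  IsDistance u v k = Walk k u v × (∀ {j} → j ℕ.< k → ¬ Walk j u v)

  -- The diameter is finite and equal to D; no D qualifies if the graph is disconnected.
  IsDiameter : ℕ → Set (a ⊔ ℓ ⊔ e)
  IsDiameter D =
    (∀ u v → ∃ λ k → k ℕ.≤ D × IsDistance u v k) × (∃₂ λ u v → IsDistance u v D)

  DiameterAtMost : ℕ → Set (a ⊔ ℓ ⊔ e)
  DiameterAtMost d = ∃ λ D → D ℕ.≤ d × IsDiameter D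

record AbelianGroupOfOrder (c ℓ : Level) (N : ℕ) : Set (Level.suc (c ⊔ ℓ)) where
  field
    group       : AbelianGroup c ℓ
    enumeration : Inverse (AbelianGroup.setoid group) (setoid (Fin N))

  open AbelianGroup group public
    using (Carrier; _≈_; _∙_; _⁻¹; ∙-cong; ⁻¹-cong)
    renaming (setoid to carrierSetoid; refl to ≈-refl; sym to ≈-sym; trans to ≈-trans)
  open Inverse enumeration public
    using () renaming (to to index; from to element)

-- Subsets of G are represented by the sets of indices of their elements.
module Cayley {c ℓ : Level} {N : ℕ} (G : AbelianGroupOfOrder c ℓ N) where
  open AbelianGroupOfOrder G

  _∈ᴳ_ : Carrier → Subset N → Set
  g ∈ᴳ S = index g ∈ S

  Adjacent : Subset N → Rel Carrier ℓ
  Adjacent S g h = ¬ (g ≈ h) × (((g ⁻¹ ∙ h) ∈ᴳ S) ⊎ ((h ⁻¹ ∙ g) ∈ᴳ S))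

  module Γ (S : Subset N) = Graph carrierSetoid (Adjacent S)

  private
    index-cong : ∀ {g h} → g ≈ h → index g ≡ index h
    index-cong = Inverse.to-cong enumeration

    element-index : ∀ g → element (index g) ≈ g
    element-index g = Inverse.strictlyInverseʳ enumeration g

    _≟_ : B.Decidable _≈_
    g ≟ h = Dec.map′
      (λ eq → ≈-trans (≈-sym (element-index g))
                (≈-trans (Inverse.from-cong enumeration eq) (element-index h)))
      index-cong
      (index g Fin.≟ index h)

    all? : ∀ {p} {P : Pred Carrier p} → (∀ {g h} → g ≈ h → P g → P h) →
           Decidable P → Dec (∀ g → P g)
    all? resp P? = Dec.map′
      (λ f g → resp (element-index g) (f (index g)))
      (λ f i → f (element i))
      (Fin.all? λ i → P? (element i))

    any? : ∀ {p} {P : Pred Carrier p} → (∀ {g h} → g ≈ h → P g → P h) →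
           Decidable P → Dec (∃ P)
    any? resp P? = Dec.map′
      (λ (i , p) → element i , p)
      (λ (g , p) → index g , resp (≈-sym (element-index g)) p)
      (Fin.any? λ i → P? (element i))

    module _ (S : Subset N) where
      open Γ S

      adjacent-resp : ∀ {g g′ h h′} → g ≈ g′ → h ≈ h′ → Adjacent S g h → Adjacent S g′ h′
      adjacent-resp p q (g≉h , e) =
        (λ r → g≉h (≈-trans p (≈-trans r (≈-sym q)))) ,
        Sum.map (subst (_∈ S) (index-cong (∙-cong (⁻¹-cong p) q)))
                (subst (_∈ S) (index-cong (∙-cong (⁻¹-cong q) p))) e

      walk-resp : ∀ {k g g′ h h′} → g ≈ g′ → h ≈ h′ → Walk k g h → Walk k g′ h′
      walk-resp p q (stop r)   = stop (≈-trans (≈-sym p) (≈-trans r q))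
      walk-resp p q (step e w) = step (adjacent-resp p ≈-refl e) (walk-resp ≈-refl q w)

      distance-resp : ∀ {k g g′ h h′} → g ≈ g′ → h ≈ h′ → IsDistance g h k → IsDistance g′ h′ k
      distance-resp p q (w , min) =
        walk-resp p q w , λ j<k w′ → min j<k (walk-resp (≈-sym p) (≈-sym q) w′)

      adjacent? : B.Decidable (Adjacent S)
      adjacent? g h = ¬? (g ≟ h) ×-dec
        ((index (g ⁻¹ ∙ h) ∈? S) ⊎-dec (index (h ⁻¹ ∙ g) ∈? S))

      walk? : ∀ k g h → Dec (Walk k g h)
      walk? zero    g h = Dec.map′ stop (λ { (stop r) → r }) (g ≟ h)
      walk? (suc k) g h = Dec.map′
        (λ { (_ , e , w) → step e w })
        (λ { (step e w) → _ , e , w })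
        (any? (λ { p (e , w) → adjacent-resp ≈-refl p e , walk-resp p ≈-refl w })
              (λ v → adjacent? g v ×-dec walk? k v h))

      distance? : ∀ g h k → Dec (IsDistance g h k)
      distance? g h k = walk? k g h ×-dec ℕ.allUpTo? (λ j → ¬? (walk? j g h)) k

      upTo? : ∀ {p} {P : Pred ℕ p} → Decidable P → ∀ n → Dec (∃ λ k → k ℕ.≤ n × P k)
      upTo? P? n = Dec.map′
        (λ { (k , k<1+n , p) → k , ℕ.s≤s⁻¹ k<1+n , p })
        (λ { (k , k≤n , p) → k , ℕ.s≤s k≤n , p })
        (ℕ.anyUpTo? P? (suc n))

      diameter? : Decidable IsDiameter
      diameter? D =
        all? (λ p f h → shift p ≈-refl (f h))
          (λ g → all? (λ q → shift ≈-refl q) (λ h → upTo? (distance? g h) D))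
        ×-dec
        any? (λ { p (h , δ) → h , distance-resp p ≈-refl δ })
          (λ g → any? (λ q → distance-resp ≈-refl q) (λ h → distance? g h D))
        where
        shift : ∀ {g g′ h h′} → g ≈ g′ → h ≈ h′ →
                (∃ λ k → k ℕ.≤ D × IsDistance g h k) → ∃ λ k → k ℕ.≤ D × IsDistance g′ h′ k
        shift p q (k , k≤D , δ) = k , k≤D , distance-resp p q δ

  DiameterAtMost : ℕ → Pred (Subset N) (c ⊔ ℓ)
  DiameterAtMost d S = Γ.DiameterAtMost S d

  diameterAtMost? : ∀ d → Decidable (DiameterAtMost d)
  diameterAtMost? d S = upTo? S (diameter? S) d

subsets : ∀ n → List (Subset n)
subsets zero    = List.[ [] ]
subsets (suc n) = List.map (inside ∷_) (subsets n) List.++ List.map (outside ∷_) (subsets n)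

-- The probability of drawing exactly S when each element is included
-- independently with probability p.
weight : ∀ {n} → ℝ → Subset n → ℝ
weight p []            = 1ᵣ
weight p (inside  ∷ S) = p *ᵣ weight p S
weight p (outside ∷ S) = (1ᵣ -ᵣ p) *ᵣ weight p S

Pr : ∀ {n ℓ} {E : Pred (Subset n) ℓ} → ℝ → Decidable E → ℝ
Pr {n} p E? = sumᵣ (List.map (weight p) (filter E? (subsets n)))

Pr[diam≤_] : ℕ → ∀ {c ℓ N} → AbelianGroupOfOrder c ℓ N → ℝ → ℝ
Pr[diam≤ d ] G p = Pr p (Cayley.diameterAtMost? G d)

{-# OPTIONS --safe #-}
module Submission where

-- Call a word in the letters s, s⁻¹ (s ∈ G) reduced if its letters belong to distinct s, and say that
-- g is missed if no reduced word of length d with letters from S has product g.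
--
-- Let L be close to log N and x = p^d. On average over g there are at most (1 - ε) L / x sets that
-- support a reduced word of length d with product g; so by Markov's inequality a positive proportion
-- of all g have n ≤ (1 - ε/2) L / x such sets. By Harris' inequality such a g is missed with
-- probability at least (1 - x)^n ≥ N^(-1 + 1/k), where k depends only on ε.
--
-- The events that g and that h are missed are almost uncorrelated: their covariance is at most the
-- probability of their conjunction times the sum of |A ∩ B| p^|A ∪ B| over the supports A, B of reduced
-- words with products g, h. The pairs with A ∩ B ≠ ∅ and B ⊄ A contribute little, because one letter
-- of the second word comes from A and another one is determined by h; the pairs with B ⊆ A contribute
-- little after summation over h. By Chebyshev's inequality the number of missed elements is close to
-- its mean, which exceeds every fixed multiple of L^(d+2).
--
-- If the diameter is at most d, each missed g is the product of a word of length at most d that is not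
-- reduced or is shorter than d. For most g such a word exists only with small probability, and by
-- Harris' inequality this remains true conditionally on g being missed.
--
-- The bound d ≤ d_N is used only to the extent that L^(2d²) ≤ N and 5d ≤ L.

open import Defs
open import Algebra.Bundles using (AbelianGroup; CommutativeRing; CommutativeSemiring)
import Algebra.Properties.CommutativeSemiring.Exp as Exp
import Algebra.Properties.Semiring.Mult as Mult
import Data.Bool.Base as Bool
open import Data.Bool.Base using (Bool; if_then_else_)
open import Data.Empty using (⊥)
open import Data.Fin.Base as Fin using (Fin; zero; suc)
import Data.Fin.Properties as Fin
open import Data.Fin.Subset as Subset using (Subset; inside; outside; _∈_; _∉_)
open import Data.Fin.Subset.Properties using (_∈?_; ∣⊥∣≡0; ∉⊥; ∣p∩q∣≤∣q∣; ∪-identityʳ; x∈p∪q⁺; x∈p∪q⁻)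
import Data.Integer.Base as ℤ
import Data.Integer.Properties as ℤ
open import Data.List.Base as List using (List; []; _∷_; _++_; length; filter; allFin)
open import Data.List.Membership.Propositional using () renaming (_∈_ to _∈ˡ_)
open import Data.List.Membership.Propositional.Properties as Mem using (∈-allFin)
open import Data.List.Properties using (length-++; length-map; length-tabulate; map-tabulate)
open import Data.List.Relation.Binary.Permutation.Propositional as Perm using (_↭_; prep; swap; ↭-refl; ↭-sym; ↭-trans)
open import Data.List.Relation.Binary.Permutation.Propositional.Properties using (All-resp-↭)
import Data.List.Relation.Unary.All as All
open All using ([]; _∷_)
import Data.List.Relation.Unary.Any as Any
open import Data.List.Relation.Unary.Unique.Propositional using (Unique; []; _∷_)
open import Data.List.Relation.Unary.Unique.Propositional.Properties using (allFin⁺)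
open import Data.Maybe.Base using (Maybe; just; nothing)
open import Data.Nat.Base as ℕ using (ℕ; zero; suc; _!)
import Data.Nat.DivMod as ℕ
import Data.Nat.Properties as ℕ
open import Data.Product.Base using (∃; ∃₂; _×_; _,_; proj₁; proj₂)
open import Data.Rational.Base hiding (*≡*; pos; neg)
import Data.Rational.Unnormalised.Base as ℚᵘ
open ℚᵘ using (mkℚᵘ; *≡*)
import Data.Rational.Unnormalised.Properties as ℚᵘ
import Data.Rational.Properties as ℚ
open import Data.Sum.Base using (_⊎_; inj₁; inj₂; [_,_]′)
open import Data.Unit.Base using (⊤; tt)
open import Data.Vec.Base as Vec using (Vec; []; _∷_; here; there)
open import Function.Base using (_∘_; id)
open import Function.Bundles using (Inverse)
open import Level using (Level; 0ℓ)
open import Relation.Binary.PropositionalEquality using (_≡_; _≢_; refl; sym; trans; cong; cong₂; subst; subst₂; module ≡-Reasoning)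
open import Relation.Nullary.Decidable using (Dec; yes; no; does; _×-dec_)
open import Relation.Nullary.Negation using (¬_; contradiction)
open import Relation.Unary using (Pred; Decidable)
open import Tactic.RingSolver using (solve-∀)
open import Tactic.RingSolver.Core.AlmostCommutativeRing using (AlmostCommutativeRing; fromCommutativeRing)
import Relation.Binary.Reasoning.Setoid as SetoidReasoning

-- The probability of being missed is only known to exceed `1/N` by a small power of `N`, so the
-- second moment tolerates relative errors only. Hence the covariance bound carries the joint
-- probability as a factor: summed over pairs, the error from pairs with `B ⊄ A` is a small multiple
-- of the second moment itself and can be absorbed.
--
-- Word counts are products over positions, where a letter weighs 1 if its element is already
-- present and `p` otherwise. `W` bounds the total weight in one position; it is of order max(`p N`,
-- `L^(d+6)`), and `W^d` is at most `N L^(d+1)`. A letter determined by the product of the word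
-- contributes `2p`, at most `W/N`, and so cancels `N`; a letter confined to a set of size `d`
-- contributes at most `L` and so gains `L^(d+5)`, enough for all losses in `L`.
--
-- Reals are Cauchy sequences, but the combinatorics runs over the rationals. There `exp L ≤ N`
-- means that every partial sum at `L` is at most `N`. The probability is a polynomial in `p`, so
-- `p` may be replaced by nearby rationals that satisfy the hypotheses exactly.

ℚ-commutativeSemiring : CommutativeSemiring 0ℓ 0ℓ
ℚ-commutativeSemiring = CommutativeRing.commutativeSemiring ℚ.+-*-commutativeRing

open Exp ℚ-commutativeSemiring using (_^_; ^-homo-*; ^-assocʳ; ^-distrib-*)
open Mult (CommutativeSemiring.semiring ℚ-commutativeSemiring)
  using (×-homo-+; ×1-homo-*) renaming (_×_ to _·_)

ℚ-ring : AlmostCommutativeRing 0ℓ 0ℓ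
ℚ-ring = fromCommutativeRing ℚ.+-*-commutativeRing isZero?
  where
  isZero? : ∀ x → Maybe (0ℚ ≡ x)
  isZero? x with 0ℚ ℚ.≟ x
  ... | yes p = just p
  ... | no  _ = nothing

-- Inequalities and powers of rationals

module _ where
  open ℚ.≤-Reasoning

  0≤1 : 0ℚ ≤ 1ℚ
  0≤1 = ℚ.nonNegative⁻¹ 1ℚ

  0<1 : 0ℚ < 1ℚ
  0<1 = ℚ.positive⁻¹ 1ℚ

  *-monoˡ : ∀ {c a b} → 0ℚ ≤ c → a ≤ b → c * a ≤ c * b
  *-monoˡ {c} c≥0 = ℚ.*-monoˡ-≤-nonNeg c {{nonNegative c≥0}}

  *-monoʳ : ∀ {c a b} → 0ℚ ≤ c → a ≤ b → a * c ≤ b * c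
  *-monoʳ {c} c≥0 = ℚ.*-monoʳ-≤-nonNeg c {{nonNegative c≥0}}

  *-mono : ∀ {a b c d} → 0ℚ ≤ b → 0ℚ ≤ c → a ≤ b → c ≤ d → a * c ≤ b * d
  *-mono b≥0 c≥0 a≤b c≤d = ℚ.≤-trans (*-monoʳ c≥0 a≤b) (*-monoˡ b≥0 c≤d)

  0≤* : ∀ {a b} → 0ℚ ≤ a → 0ℚ ≤ b → 0ℚ ≤ a * b
  0≤* {a} {b} a≥0 b≥0 = subst (_≤ a * b) (ℚ.*-zeroʳ a) (*-monoˡ a≥0 b≥0)

  0≤+ : ∀ {a b} → 0ℚ ≤ a → 0ℚ ≤ b → 0ℚ ≤ a + b
  0≤+ = ℚ.+-mono-≤

  0<* : ∀ {a b} → 0ℚ < a → 0ℚ < b → 0ℚ < a * b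
  0<* {a} {b} a>0 b>0 =
    ℚ.positive⁻¹ (a * b) {{ℚ.pos*pos⇒pos a {{positive a>0}} b {{positive b>0}}}}

  *-cancelˡ : ∀ {c a b} → 0ℚ < c → c * a ≤ c * b → a ≤ b
  *-cancelˡ {c} c>0 = ℚ.*-cancelˡ-≤-pos c {{positive c>0}}

  a-b+b : ∀ a b → a - b + b ≡ a
  a-b+b = solve-∀ ℚ-ring

  drop-0 : ∀ a b → 0ℚ * a + b ≡ b
  drop-0 = solve-∀ ℚ-ring

  0≤-⇒≤ : ∀ {a b} → 0ℚ ≤ b - a → a ≤ b
  0≤-⇒≤ {a} {b} h = subst₂ _≤_ (ℚ.+-identityˡ a) (a-b+b b a) (ℚ.+-monoˡ-≤ a h)

  ≤⇒0≤- : ∀ {a b} → a ≤ b → 0ℚ ≤ b - a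
  ≤⇒0≤- {a} {b} h = subst (_≤ b - a) (ℚ.+-inverseʳ a) (ℚ.+-monoˡ-≤ (- a) h)

  -- The standard way to finish nonlinear estimates here: the ring solver rewrites the difference of
  -- the two sides as a combination of quantities already known to be nonnegative.
  ≤-byDiff : ∀ {a b c} → b - a ≡ c → 0ℚ ≤ c → a ≤ b
  ≤-byDiff eq h = 0≤-⇒≤ (subst (0ℚ ≤_) (sym eq) h)

  ≤+nonneg : ∀ {a b} → 0ℚ ≤ b → a ≤ a + b
  ≤+nonneg {a} {b} h = subst (_≤ a + b) (ℚ.+-identityʳ a) (ℚ.+-monoʳ-≤ a h)

  nonneg+≤ : ∀ {a b} → 0ℚ ≤ b → a ≤ b + a
  nonneg+≤ {a} {b} h = subst (_≤ b + a) (ℚ.+-identityˡ a) (ℚ.+-monoˡ-≤ a h)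

  -nonneg≤ : ∀ {a b} → 0ℚ ≤ b → a - b ≤ a
  -nonneg≤ {a} {b} h = ≤-byDiff (identity a b) h
    where
    identity : ∀ a b → a - (a - b) ≡ b
    identity = solve-∀ ℚ-ring

  ≤*1≤ : ∀ {a b} → 0ℚ ≤ a → 1ℚ ≤ b → a ≤ a * b
  ≤*1≤ {a} {b} a≥0 b≥1 = subst (_≤ a * b) (ℚ.*-identityʳ a) (*-monoˡ a≥0 b≥1)

  *≤1≤ : ∀ {a b} → 0ℚ ≤ a → b ≤ 1ℚ → a * b ≤ a
  *≤1≤ {a} {b} a≥0 b≤1 = subst (a * b ≤_) (ℚ.*-identityʳ a) (*-monoˡ a≥0 b≤1)

  0≤x² : ∀ x → 0ℚ ≤ x * x
  0≤x² x with ℚ.≤-total 0ℚ x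
  ... | inj₁ h = 0≤* h h
  ... | inj₂ h = subst (0ℚ ≤_) (identity x) (0≤* (ℚ.neg-antimono-≤ h) (ℚ.neg-antimono-≤ h))
    where
    identity : ∀ x → (- x) * (- x) ≡ x * x
    identity = solve-∀ ℚ-ring

  0≤^ : ∀ {a} n → 0ℚ ≤ a → 0ℚ ≤ a ^ n
  0≤^ zero    h = 0≤1
  0≤^ (suc n) h = 0≤* h (0≤^ n h)

  0<^ : ∀ {a} n → 0ℚ < a → 0ℚ < a ^ n
  0<^ zero    h = 0<1
  0<^ (suc n) h = 0<* h (0<^ n h)

  1^ : ∀ n → 1ℚ ^ n ≡ 1ℚ
  1^ zero    = refl
  1^ (suc n) = trans (ℚ.*-identityˡ (1ℚ ^ n)) (1^ n)

  ^-mono : ∀ {a b} n → 0ℚ ≤ a → a ≤ b → a ^ n ≤ b ^ n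
  ^-mono zero    _ _ = ℚ.≤-refl
  ^-mono (suc n) h l = *-mono (ℚ.≤-trans h l) (0≤^ n h) l (^-mono n h l)

  1≤^ : ∀ {a} n → 1ℚ ≤ a → 1ℚ ≤ a ^ n
  1≤^ {a} n h = subst (_≤ a ^ n) (1^ n) (^-mono n 0≤1 h)

  ^≤1 : ∀ {a} n → 0ℚ ≤ a → a ≤ 1ℚ → a ^ n ≤ 1ℚ
  ^≤1 {a} n h l = subst (a ^ n ≤_) (1^ n) (^-mono n h l)

  ^-monoʳ : ∀ {a m n} → 1ℚ ≤ a → m ℕ.≤ n → a ^ m ≤ a ^ n
  ^-monoʳ {a} {m} {n} h m≤n = subst (λ k → a ^ m ≤ a ^ k) (ℕ.m+[n∸m]≡n m≤n) (begin
    a ^ m                   ≤⟨ ≤*1≤ (0≤^ m (ℚ.≤-trans 0≤1 h)) (1≤^ (n ℕ.∸ m) h) ⟩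
    a ^ m * a ^ (n ℕ.∸ m)   ≡⟨ ^-homo-* a m (n ℕ.∸ m) ⟨
    a ^ (m ℕ.+ (n ℕ.∸ m))   ∎)

  ^-mono-< : ∀ {a b} n → 0ℚ ≤ a → a < b → a ^ suc n < b ^ suc n
  ^-mono-< {a} {b} zero    h l = subst₂ _<_ (sym (ℚ.*-identityʳ a)) (sym (ℚ.*-identityʳ b)) l
  ^-mono-< {a} {b} (suc n) h l = begin-strict
    a * a ^ suc n   ≤⟨ *-monoˡ h (^-mono (suc n) h (ℚ.<⇒≤ l)) ⟩
    a * b ^ suc n   <⟨ ℚ.*-monoˡ-<-pos (b ^ suc n) {{positive (0<^ (suc n) (ℚ.≤-<-trans h l))}} l ⟩
    b * b ^ suc n   ∎

  ^-cancel-≤ : ∀ {a b} n → 0ℚ ≤ b → a ^ suc n ≤ b ^ suc n → a ≤ b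
  ^-cancel-≤ {a} {b} n h l with a ℚ.≤? b
  ... | yes a≤b = a≤b
  ... | no  a≰b = contradiction (ℚ.<-≤-trans (^-mono-< n h (ℚ.≰⇒> a≰b)) l) (ℚ.<-irrefl refl)

-- The embedding of the natural numbers into the rationals

ι : ℕ → ℚ
ι n = n · 1ℚ

module _ where
  ι-+ : ∀ m n → ι (m ℕ.+ n) ≡ ι m + ι n
  ι-+ = ×-homo-+ 1ℚ

  ι-* : ∀ m n → ι (m ℕ.* n) ≡ ι m * ι n
  ι-* = ×1-homo-*

  ι-^ : ∀ m n → ι (m ℕ.^ n) ≡ ι m ^ n
  ι-^ m zero    = ℚ.+-identityʳ 1ℚ
  ι-^ m (suc n) = trans (ι-* m (m ℕ.^ n)) (cong (ι m *_) (ι-^ m n))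

  0≤ι : ∀ n → 0ℚ ≤ ι n
  0≤ι zero    = ℚ.≤-refl
  0≤ι (suc n) = 0≤+ 0≤1 (0≤ι n)

  ι-mono : ∀ {m n} → m ℕ.≤ n → ι m ≤ ι n
  ι-mono {n = n} ℕ.z≤n = 0≤ι n
  ι-mono (ℕ.s≤s h) = ℚ.+-monoʳ-≤ 1ℚ (ι-mono h)

  1≤ι : ∀ n → 1ℚ ≤ ι (suc n)
  1≤ι n = ≤+nonneg {1ℚ} (0≤ι n)

  0<ι : ∀ n → 0ℚ < ι (suc n)
  0<ι n = ℚ.<-≤-trans 0<1 (1≤ι n)

  /1≡ι : ∀ n → ℤ.+ n / 1 ≡ ι n
  /1≡ι zero    = refl
  /1≡ι (suc n) = ℚ.toℚᵘ-injective (begin-equality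
    toℚᵘ (ℤ.+ suc n / 1)               ≃⟨ ℚ.toℚᵘ-fromℚᵘ (mkℚᵘ (ℤ.+ suc n) 0) ⟩
    mkℚᵘ (ℤ.+ suc n) 0                 ≃⟨ *≡* (cong (λ z → (ℤ.+ 1 ℤ.+ z) ℤ.* ℤ.+ 1) (sym (ℤ.*-identityʳ (ℤ.+ n)))) ⟩
    ℚᵘ.1ℚᵘ ℚᵘ.+ mkℚᵘ (ℤ.+ n) 0         ≃⟨ ℚᵘ.+-congʳ ℚᵘ.1ℚᵘ (ℚ.toℚᵘ-fromℚᵘ (mkℚᵘ (ℤ.+ n) 0)) ⟨
    ℚᵘ.1ℚᵘ ℚᵘ.+ toℚᵘ (ℤ.+ n / 1)       ≡⟨ cong (λ q → ℚᵘ.1ℚᵘ ℚᵘ.+ toℚᵘ q) (/1≡ι n) ⟩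
    ℚᵘ.1ℚᵘ ℚᵘ.+ toℚᵘ (ι n)             ≃⟨ ℚ.toℚᵘ-homo-+ 1ℚ (ι n) ⟨
    toℚᵘ (1ℚ + ι n)                    ∎)
    where open ℚᵘ.≤-Reasoning

  ι*1/ : ∀ k .{{_ : ℕ.NonZero k}} → ι k * (ℤ.+ 1 / k) ≡ 1ℚ
  ι*1/ (suc k) = ℚ.toℚᵘ-injective (begin-equality
    toℚᵘ (ι (suc k) * (ℤ.+ 1 / suc k))            ≡⟨ cong (λ q → toℚᵘ (q * (ℤ.+ 1 / suc k))) (/1≡ι (suc k)) ⟨
    toℚᵘ ((ℤ.+ suc k / 1) * (ℤ.+ 1 / suc k))      ≃⟨ ℚ.toℚᵘ-homo-* (ℤ.+ suc k / 1) (ℤ.+ 1 / suc k) ⟩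
    toℚᵘ (ℤ.+ suc k / 1) ℚᵘ.* toℚᵘ (ℤ.+ 1 / suc k)
      ≃⟨ ℚᵘ.*-cong (ℚ.toℚᵘ-fromℚᵘ (mkℚᵘ (ℤ.+ suc k) 0)) (ℚ.toℚᵘ-fromℚᵘ (mkℚᵘ (ℤ.+ 1) k)) ⟩
    mkℚᵘ (ℤ.+ suc k) 0 ℚᵘ.* mkℚᵘ (ℤ.+ 1) k        ≃⟨ *≡* (cong (λ j → ℤ.+ suc j) (identity k)) ⟩
    ℚᵘ.1ℚᵘ                                        ∎)
    where
    open ℚᵘ.≤-Reasoning
    identity : ∀ k → k ℕ.* 1 ℕ.* 1 ≡ k ℕ.+ 0 ℕ.+ 0
    identity k = trans (trans (ℕ.*-identityʳ (k ℕ.* 1)) (ℕ.*-identityʳ k))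
                       (sym (trans (ℕ.+-identityʳ (k ℕ.+ 0)) (ℕ.+-identityʳ k)))

-- Finite sums over lists

∑ : ∀ {a} {A : Set a} → List A → (A → ℚ) → ℚ
∑ []       f = 0ℚ
∑ (x ∷ xs) f = f x + ∑ xs f

𝟙 : ∀ {a} {P : Set a} → Dec P → ℚ
𝟙 P? = if does P? then 1ℚ else 0ℚ

module _ {a} {P : Set a} where
  0≤𝟙 : (P? : Dec P) → 0ℚ ≤ 𝟙 P?
  0≤𝟙 (yes _) = 0≤1
  0≤𝟙 (no  _) = ℚ.≤-refl

  𝟙≤1 : (P? : Dec P) → 𝟙 P? ≤ 1ℚ
  𝟙≤1 (yes _) = ℚ.≤-refl
  𝟙≤1 (no  _) = 0≤1

  𝟙-yes : (P? : Dec P) → P → 𝟙 P? ≡ 1ℚ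
  𝟙-yes (yes _) _ = refl
  𝟙-yes (no ¬p) p = contradiction p ¬p

  𝟙-no : (P? : Dec P) → ¬ P → 𝟙 P? ≡ 0ℚ
  𝟙-no (yes p) ¬p = contradiction p ¬p
  𝟙-no (no _)  _  = refl

  𝟙*-mono : (P? : Dec P) → ∀ {x y} → (P → x ≤ y) → 𝟙 P? * x ≤ 𝟙 P? * y
  𝟙*-mono (yes p) h = *-monoˡ 0≤1 (h p)
  𝟙*-mono (no _) {x} {y} h = ℚ.≤-reflexive (trans (ℚ.*-zeroˡ x) (sym (ℚ.*-zeroˡ y)))

𝟙-mono : ∀ {a b} {P : Set a} {Q : Set b} (P? : Dec P) (Q? : Dec Q) → (P → Q) → 𝟙 P? ≤ 𝟙 Q?
𝟙-mono (yes p) Q? h = ℚ.≤-reflexive (sym (𝟙-yes Q? (h p)))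
𝟙-mono (no _)  Q? h = 0≤𝟙 Q?

𝟙-cong : ∀ {a b} {P : Set a} {Q : Set b} (P? : Dec P) (Q? : Dec Q) → (P → Q) → (Q → P) → 𝟙 P? ≡ 𝟙 Q?
𝟙-cong P? Q? f g = ℚ.≤-antisym (𝟙-mono P? Q? f) (𝟙-mono Q? P? g)

module _ {a} {A : Set a} where
  private
    interchange : ∀ a b c d → (a + b) + (c + d) ≡ (a + c) + (b + d)
    interchange = solve-∀ ℚ-ring

  ∑-cong : (xs : List A) {f g : A → ℚ} → (∀ x → f x ≡ g x) → ∑ xs f ≡ ∑ xs g
  ∑-cong []       h = refl
  ∑-cong (x ∷ xs) h = cong₂ _+_ (h x) (∑-cong xs h)

  ∑-mono-∈ : (xs : List A) {f g : A → ℚ} → (∀ x → x ∈ˡ xs → f x ≤ g x) → ∑ xs f ≤ ∑ xs g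
  ∑-mono-∈ []       h = ℚ.≤-refl
  ∑-mono-∈ (x ∷ xs) h = ℚ.+-mono-≤ (h x (Any.here refl)) (∑-mono-∈ xs (λ y y∈ → h y (Any.there y∈)))

  ∑-mono : (xs : List A) {f g : A → ℚ} → (∀ x → f x ≤ g x) → ∑ xs f ≤ ∑ xs g
  ∑-mono xs h = ∑-mono-∈ xs (λ x _ → h x)

  0≤∑ : (xs : List A) {f : A → ℚ} → (∀ x → 0ℚ ≤ f x) → 0ℚ ≤ ∑ xs f
  0≤∑ []       h = ℚ.≤-refl
  0≤∑ (x ∷ xs) h = 0≤+ (h x) (0≤∑ xs h)

  ∑-+ : (xs : List A) (f g : A → ℚ) → ∑ xs (λ x → f x + g x) ≡ ∑ xs f + ∑ xs g
  ∑-+ []       f g = refl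
  ∑-+ (x ∷ xs) f g = trans (cong (f x + g x +_) (∑-+ xs f g)) (interchange (f x) (g x) (∑ xs f) (∑ xs g))

  ∑-*ˡ : (xs : List A) (c : ℚ) (f : A → ℚ) → ∑ xs (λ x → c * f x) ≡ c * ∑ xs f
  ∑-*ˡ []       c f = sym (ℚ.*-zeroʳ c)
  ∑-*ˡ (x ∷ xs) c f = trans (cong (c * f x +_) (∑-*ˡ xs c f)) (sym (ℚ.*-distribˡ-+ c (f x) (∑ xs f)))

  ∑-*ʳ : (xs : List A) (c : ℚ) (f : A → ℚ) → ∑ xs (λ x → f x * c) ≡ ∑ xs f * c
  ∑-*ʳ xs c f = trans (∑-cong xs (λ x → ℚ.*-comm (f x) c)) (trans (∑-*ˡ xs c f) (ℚ.*-comm c (∑ xs f)))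

  ∑-const : (xs : List A) (c : ℚ) → ∑ xs (λ _ → c) ≡ ι (length xs) * c
  ∑-const []       c = sym (ℚ.*-zeroˡ c)
  ∑-const (x ∷ xs) c = trans (cong (c +_) (∑-const xs c)) (identity c (ι (length xs)))
    where
    identity : ∀ c l → c + l * c ≡ (1ℚ + l) * c
    identity = solve-∀ ℚ-ring

  ∑-++ : (xs ys : List A) (f : A → ℚ) → ∑ (xs ++ ys) f ≡ ∑ xs f + ∑ ys f
  ∑-++ []       ys f = sym (ℚ.+-identityˡ (∑ ys f))
  ∑-++ (x ∷ xs) ys f = trans (cong (f x +_) (∑-++ xs ys f)) (sym (ℚ.+-assoc (f x) (∑ xs f) (∑ ys f)))

  ∑-filter : ∀ {p} {P : Pred A p} (P? : Decidable P) (xs : List A) (f : A → ℚ) →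
             ∑ (filter P? xs) f ≡ ∑ xs (λ x → 𝟙 (P? x) * f x)
  ∑-filter P? []       f = refl
  ∑-filter P? (x ∷ xs) f with P? x
  ... | yes _ = cong₂ _+_ (sym (ℚ.*-identityˡ (f x))) (∑-filter P? xs f)
  ... | no  _ = trans (∑-filter P? xs f) (sym (drop-0 (f x) (∑ xs (λ x → 𝟙 (P? x) * f x))))

  ∑-unique : ∀ {p} {P : Pred A p} (P? : Decidable P) {xs : List A} → Unique xs →
             (∀ {x y} → P x → P y → x ≡ y) → ∑ xs (λ x → 𝟙 (P? x)) ≤ 1ℚ
  ∑-unique P? []             _ = 0≤1
  ∑-unique {P = P} P? {x ∷ xs} (x∉ ∷ xs!) P-unique with P? x
  ... | no _  = subst (_≤ 1ℚ) (sym (ℚ.+-identityˡ (∑ xs (λ y → 𝟙 (P? y))))) (∑-unique P? xs! P-unique)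
  ... | yes p = ℚ.≤-reflexive (trans (cong (1ℚ +_) (vanish x∉)) (ℚ.+-identityʳ 1ℚ))
    where
    vanish : ∀ {ys} → All.All (x ≢_) ys → ∑ ys (λ y → 𝟙 (P? y)) ≡ 0ℚ
    vanish []                   = refl
    vanish {y ∷ ys} (x≢y ∷ x∉ys) =
      cong₂ _+_ (𝟙-no (P? y) (λ q → x≢y (P-unique p q))) (vanish x∉ys)

module _ {a b} {A : Set a} {B : Set b} where
  ∑-map : (g : A → B) (xs : List A) (f : B → ℚ) → ∑ (List.map g xs) f ≡ ∑ xs (f ∘ g)
  ∑-map g []       f = refl
  ∑-map g (x ∷ xs) f = cong (f (g x) +_) (∑-map g xs f)

  ∑-swap : (xs : List A) (ys : List B) (f : A → B → ℚ) →
           ∑ xs (λ x → ∑ ys (f x)) ≡ ∑ ys (λ y → ∑ xs (λ x → f x y))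
  ∑-swap []       ys f = sym (trans (∑-const ys 0ℚ) (ℚ.*-zeroʳ (ι (length ys))))
  ∑-swap (x ∷ xs) ys f = trans (cong (∑ ys (f x) +_) (∑-swap xs ys f))
                           (sym (∑-+ ys (f x) (λ y → ∑ xs (λ x → f x y))))

  ∑-product : (xs : List A) (ys : List B) (f : A → ℚ) (g : B → ℚ) →
              ∑ xs f * ∑ ys g ≡ ∑ xs (λ x → ∑ ys (λ y → f x * g y))
  ∑-product xs ys f g = trans (sym (∑-*ʳ xs (∑ ys g) f)) (∑-cong xs (λ x → sym (∑-*ˡ ys (f x) g)))

-- Independent random subsets

contains : ∀ {n} → Subset n → Subset n → ℚ
contains []            []            = 1ℚ
contains (outside ∷ A) (_ ∷ S)       = contains A S
contains (inside ∷ A)  (inside ∷ S)  = contains A S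
contains (inside ∷ A)  (outside ∷ S) = 0ℚ

-- The indicator that `S` contains no member of `F`. Being a product of decreasing factors, it is
-- accessible to Harris' inequality one member at a time.
avoids : ∀ {n} → List (Subset n) → Subset n → ℚ
avoids []      S = 1ℚ
avoids (A ∷ F) S = (1ℚ - contains A S) * avoids F S

-- Monotonicity coordinate by coordinate, in the shape that induction on the number of coordinates
-- consumes.
Decreasing : ∀ {n} → (Subset n → ℚ) → Set
Decreasing {zero}  f = ⊤
Decreasing {suc n} f =
  Decreasing (f ∘ (inside ∷_)) × Decreasing (f ∘ (outside ∷_)) ×
  (∀ S → f (inside ∷ S) ≤ f (outside ∷ S))

0≤contains : ∀ {n} (A S : Subset n) → 0ℚ ≤ contains A S
0≤contains []            []            = 0≤1
0≤contains (outside ∷ A) (_ ∷ S)       = 0≤contains A S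
0≤contains (inside ∷ A)  (inside ∷ S)  = 0≤contains A S
0≤contains (inside ∷ A)  (outside ∷ S) = ℚ.≤-refl

contains≤1 : ∀ {n} (A S : Subset n) → contains A S ≤ 1ℚ
contains≤1 []            []            = ℚ.≤-refl
contains≤1 (outside ∷ A) (_ ∷ S)       = contains≤1 A S
contains≤1 (inside ∷ A)  (inside ∷ S)  = contains≤1 A S
contains≤1 (inside ∷ A)  (outside ∷ S) = 0≤1

0≤avoids : ∀ {n} (F : List (Subset n)) S → 0ℚ ≤ avoids F S
0≤avoids []      S = 0≤1
0≤avoids (A ∷ F) S = 0≤* (≤⇒0≤- (contains≤1 A S)) (0≤avoids F S)

decreasing-* : ∀ {n} {f g : Subset n → ℚ} → (∀ S → 0ℚ ≤ f S) → (∀ S → 0ℚ ≤ g S) →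
               Decreasing f → Decreasing g → Decreasing (λ S → f S * g S)
decreasing-* {zero}  _   _   _                   _                   = tt
decreasing-* {suc n} f≥0 g≥0 (df₁ , df₀ , f₁≤f₀) (dg₁ , dg₀ , g₁≤g₀) =
  decreasing-* (f≥0 ∘ (inside ∷_)) (g≥0 ∘ (inside ∷_)) df₁ dg₁ ,
  decreasing-* (f≥0 ∘ (outside ∷_)) (g≥0 ∘ (outside ∷_)) df₀ dg₀ ,
  λ S → *-mono (f≥0 (outside ∷ S)) (g≥0 (inside ∷ S)) (f₁≤f₀ S) (g₁≤g₀ S)

decreasing-const : ∀ {n} c → Decreasing {n} (λ _ → c)
decreasing-const {zero}  c = tt
decreasing-const {suc n} c = decreasing-const {n} c , decreasing-const {n} c , λ _ → ℚ.≤-refl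

decreasing-omits : ∀ {n} (A : Subset n) → Decreasing (λ S → 1ℚ - contains A S)
decreasing-omits []            = tt
decreasing-omits (outside ∷ A) = decreasing-omits A , decreasing-omits A , λ _ → ℚ.≤-refl
decreasing-omits (inside ∷ A)  = decreasing-omits A , decreasing-const 1ℚ , λ S → -nonneg≤ (0≤contains A S)

decreasing-avoids : ∀ {n} (F : List (Subset n)) → Decreasing (avoids F)
decreasing-avoids []      = decreasing-const 1ℚ
decreasing-avoids (A ∷ F) = decreasing-*
  (λ S → ≤⇒0≤- (contains≤1 A S)) (0≤avoids F) (decreasing-omits A) (decreasing-avoids F)

-- What is left of a family once the first coordinate is revealed. If it is present, every member
-- just loses it (`tails`); if it is absent, the members containing it can no longer occur and drop
-- out (`outsideTails`).
tails : ∀ {n} → List (Subset (suc n)) → List (Subset n)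
tails = List.map Vec.tail

isInside isOutside : ∀ {n} → Subset (suc n) → ℚ
isInside  A = if Vec.head A then 1ℚ else 0ℚ
isOutside A = if Vec.head A then 0ℚ else 1ℚ

outsideTails : ∀ {n} → List (Subset (suc n)) → List (Subset n)
outsideTails []                  = []
outsideTails ((inside ∷ A) ∷ F)  = outsideTails F
outsideTails ((outside ∷ A) ∷ F) = A ∷ outsideTails F

avoids-inside : ∀ {n} (F : List (Subset (suc n))) S → avoids F (inside ∷ S) ≡ avoids (tails F) S
avoids-inside []                  S = refl
avoids-inside ((inside ∷ A) ∷ F)  S = cong ((1ℚ - contains A S) *_) (avoids-inside F S)
avoids-inside ((outside ∷ A) ∷ F) S = cong ((1ℚ - contains A S) *_) (avoids-inside F S)

avoids-outside : ∀ {n} (F : List (Subset (suc n))) S → avoids F (outside ∷ S) ≡ avoids (outsideTails F) S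
avoids-outside []                  S = refl
avoids-outside ((inside ∷ A) ∷ F)  S = trans (ℚ.*-identityˡ (avoids F (outside ∷ S))) (avoids-outside F S)
avoids-outside ((outside ∷ A) ∷ F) S = cong ((1ℚ - contains A S) *_) (avoids-outside F S)

avoids-antitone : ∀ {n} (F : List (Subset (suc n))) S → avoids (tails F) S ≤ avoids (outsideTails F) S
avoids-antitone F S = subst₂ _≤_ (avoids-inside F S) (avoids-outside F S)
  (proj₂ (proj₂ (decreasing-avoids F)) S)

∑-outsideTails : ∀ {n} (F : List (Subset (suc n))) (f : Subset n → ℚ) →
                 ∑ (outsideTails F) f ≡ ∑ F (λ A → isOutside A * f (Vec.tail A))
∑-outsideTails []                  f = refl
∑-outsideTails ((inside ∷ A) ∷ F)  f =
  trans (∑-outsideTails F f) (sym (drop-0 (f A) (∑ F (λ A → isOutside A * f (Vec.tail A)))))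
∑-outsideTails ((outside ∷ A) ∷ F) f = cong₂ _+_ (sym (ℚ.*-identityˡ (f A))) (∑-outsideTails F f)

-- A union bound: the first coordinate matters only if some member containing it has all its other
-- elements in `S`, while no member without that coordinate lies in `S`.
pivot-bound : ∀ {n} (F : List (Subset (suc n))) S →
  avoids (outsideTails F) S - avoids (tails F) S ≤
  ∑ F (λ A → isInside A * (avoids (outsideTails F) S * contains (Vec.tail A) S))
pivot-bound [] S = ℚ.≤-refl
pivot-bound ((inside ∷ A) ∷ F) S = ℚ.≤-trans
  (≤-byDiff (identity f₀ f₁ i) (0≤* (0≤contains A S) (≤⇒0≤- (avoids-antitone F S))))
  (ℚ.+-mono-≤ (ℚ.≤-reflexive (sym (ℚ.*-identityˡ (f₀ * i)))) (pivot-bound F S))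
  where
  f₀ = avoids (outsideTails F) S
  f₁ = avoids (tails F) S
  i = contains A S
  identity : ∀ f₀ f₁ i → f₀ * i + (f₀ - f₁) - (f₀ - (1ℚ - i) * f₁) ≡ i * (f₀ - f₁)
  identity = solve-∀ ℚ-ring
pivot-bound ((outside ∷ A) ∷ F) S = begin
  (1ℚ - i) * f₀ - (1ℚ - i) * f₁   ≡⟨ identity₁ f₀ f₁ i ⟩
  (1ℚ - i) * (f₀ - f₁)            ≤⟨ *-monoˡ (≤⇒0≤- (contains≤1 A S)) (pivot-bound F S) ⟩
  (1ℚ - i) * ∑ F (λ A → isInside A * (f₀ * contains (Vec.tail A) S))
    ≡⟨ ∑-*ˡ F (1ℚ - i) _ ⟨
  ∑ F (λ A → (1ℚ - i) * (isInside A * (f₀ * contains (Vec.tail A) S)))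
    ≡⟨ ∑-cong F (λ A → identity₂ (1ℚ - i) (isInside A) f₀ (contains (Vec.tail A) S)) ⟩
  ∑ F (λ A → isInside A * ((1ℚ - i) * f₀ * contains (Vec.tail A) S))
    ≡⟨ drop-0 ((1ℚ - i) * f₀ * i) (∑ F (λ A → isInside A * ((1ℚ - i) * f₀ * contains (Vec.tail A) S))) ⟨
  0ℚ * ((1ℚ - i) * f₀ * i) + ∑ F (λ A → isInside A * ((1ℚ - i) * f₀ * contains (Vec.tail A) S)) ∎
  where
  open ℚ.≤-Reasoning
  f₀ = avoids (outsideTails F) S
  f₁ = avoids (tails F) S
  i = contains A S
  identity₁ : ∀ f₀ f₁ i → (1ℚ - i) * f₀ - (1ℚ - i) * f₁ ≡ (1ℚ - i) * (f₀ - f₁)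
  identity₁ = solve-∀ ℚ-ring
  identity₂ : ∀ a b c d → a * (b * (c * d)) ≡ b * (a * c * d)
  identity₂ = solve-∀ ℚ-ring

-- Expectation and Harris' inequality

module Expectation (p : ℚ) (0≤p : 0ℚ ≤ p) (p≤1 : p ≤ 1ℚ) where
  open ℚ.≤-Reasoning

  q : ℚ
  q = 1ℚ - p

  0≤q : 0ℚ ≤ q
  0≤q = ≤⇒0≤- p≤1

  E : ∀ {n} → (Subset n → ℚ) → ℚ
  E {zero}  f = f []
  E {suc n} f = p * E (f ∘ (inside ∷_)) + q * E (f ∘ (outside ∷_))

  E-cong : ∀ {n} {f g : Subset n → ℚ} → (∀ S → f S ≡ g S) → E f ≡ E g
  E-cong {zero}  h = h []
  E-cong {suc n} h = cong₂ (λ a b → p * a + q * b) (E-cong (h ∘ (inside ∷_))) (E-cong (h ∘ (outside ∷_)))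

  E-mono : ∀ {n} {f g : Subset n → ℚ} → (∀ S → f S ≤ g S) → E f ≤ E g
  E-mono {zero}  h = h []
  E-mono {suc n} h = ℚ.+-mono-≤
    (*-monoˡ 0≤p (E-mono (h ∘ (inside ∷_)))) (*-monoˡ 0≤q (E-mono (h ∘ (outside ∷_))))

  private
    weighted-+ : ∀ a b c d e f → a * (b + c) + d * (e + f) ≡ (a * b + d * e) + (a * c + d * f)
    weighted-+ = solve-∀ ℚ-ring

    weighted-* : ∀ c p a q b → p * (c * a) + q * (c * b) ≡ c * (p * a + q * b)
    weighted-* = solve-∀ ℚ-ring

    weighted-const : ∀ p c → p * c + (1ℚ - p) * c ≡ c
    weighted-const = solve-∀ ℚ-ring

  E-+ : ∀ {n} (f g : Subset n → ℚ) → E (λ S → f S + g S) ≡ E f + E g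
  E-+ {zero}  f g = refl
  E-+ {suc n} f g = trans
    (cong₂ (λ a b → p * a + q * b) (E-+ (f ∘ (inside ∷_)) (g ∘ (inside ∷_)))
                                   (E-+ (f ∘ (outside ∷_)) (g ∘ (outside ∷_))))
    (weighted-+ p (E (f ∘ (inside ∷_))) (E (g ∘ (inside ∷_))) q (E (f ∘ (outside ∷_))) (E (g ∘ (outside ∷_))))

  E-*ˡ : ∀ {n} c (f : Subset n → ℚ) → E (λ S → c * f S) ≡ c * E f
  E-*ˡ {zero}  c f = refl
  E-*ˡ {suc n} c f = trans
    (cong₂ (λ a b → p * a + q * b) (E-*ˡ c (f ∘ (inside ∷_))) (E-*ˡ c (f ∘ (outside ∷_))))
    (weighted-* c p (E (f ∘ (inside ∷_))) q (E (f ∘ (outside ∷_))))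

  E-const : ∀ {n} c → E {n} (λ _ → c) ≡ c
  E-const {zero}  c = refl
  E-const {suc n} c = trans (cong₂ (λ a b → p * a + q * b) (E-const {n} c) (E-const {n} c)) (weighted-const p c)

  E-∑ : ∀ {a n} {A : Set a} (xs : List A) (f : A → Subset n → ℚ) →
        E (λ S → ∑ xs (λ x → f x S)) ≡ ∑ xs (λ x → E (f x))
  E-∑ {n = n} [] f = E-const {n} 0ℚ
  E-∑ (x ∷ xs) f = trans (E-+ (f x) (λ S → ∑ xs (λ x → f x S))) (cong (E (f x) +_) (E-∑ xs f))

  0≤E : ∀ {n} {f : Subset n → ℚ} → (∀ S → 0ℚ ≤ f S) → 0ℚ ≤ E f
  0≤E {n} {f} h = subst (_≤ E f) (E-const {n} 0ℚ) (E-mono h)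

  -- Given the first coordinate, both functions are still decreasing, so the induction hypothesis
  -- applies to each half. What remains is Chebyshev's inequality on two points: the defect is `p q`
  -- times the product of the two drops.
  harris : ∀ {n} {f g : Subset n → ℚ} → Decreasing f → Decreasing g → E f * E g ≤ E (λ S → f S * g S)
  harris {zero}  _                   _                   = ℚ.≤-refl
  harris {suc n} {f} {g} (df₁ , df₀ , f₁≤f₀) (dg₁ , dg₀ , g₁≤g₀) = begin
    (p * a₁ + q * a₀) * (p * b₁ + q * b₀)
      ≤⟨ ≤-byDiff (identity p a₁ a₀ b₁ b₀)
           (0≤* (0≤* 0≤p 0≤q) (0≤* (≤⇒0≤- (E-mono f₁≤f₀)) (≤⇒0≤- (E-mono g₁≤g₀)))) ⟩
    p * (a₁ * b₁) + q * (a₀ * b₀)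
      ≤⟨ ℚ.+-mono-≤ (*-monoˡ 0≤p (harris df₁ dg₁)) (*-monoˡ 0≤q (harris df₀ dg₀)) ⟩
    E (λ S → f S * g S) ∎
    where
    a₁ = E (f ∘ (inside ∷_))
    a₀ = E (f ∘ (outside ∷_))
    b₁ = E (g ∘ (inside ∷_))
    b₀ = E (g ∘ (outside ∷_))
    identity : ∀ p a₁ a₀ b₁ b₀ →
      p * (a₁ * b₁) + (1ℚ - p) * (a₀ * b₀) - (p * a₁ + (1ℚ - p) * a₀) * (p * b₁ + (1ℚ - p) * b₀) ≡
      p * (1ℚ - p) * ((a₀ - a₁) * (b₀ - b₁))
    identity = solve-∀ ℚ-ring

  E-contains : ∀ {n} (A : Subset n) → E (contains A) ≡ p ^ Subset.∣ A ∣
  E-contains []            = refl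
  E-contains (outside ∷ A) =
    trans (weighted-const p (E (contains A))) (E-contains A)
  E-contains {suc n} (inside ∷ A)  = trans
    (cong₂ (λ a b → p * a + q * b) (E-contains A) (E-const {n} 0ℚ)) (identity p (p ^ Subset.∣ A ∣))
    where
    identity : ∀ p x → p * x + (1ℚ - p) * 0ℚ ≡ p * x
    identity = solve-∀ ℚ-ring

  E-omits : ∀ {n} (A : Subset n) → E (λ S → 1ℚ - contains A S) ≡ 1ℚ - p ^ Subset.∣ A ∣
  E-omits {n} A = begin-equality
    E (λ S → 1ℚ - contains A S)             ≡⟨ E-cong (λ S → identity (contains A S)) ⟩
    E (λ S → 1ℚ + (- 1ℚ) * contains A S)    ≡⟨ E-+ (λ _ → 1ℚ) (λ S → (- 1ℚ) * contains A S) ⟩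
    E {n} (λ _ → 1ℚ) + E (λ S → (- 1ℚ) * contains A S)
      ≡⟨ cong₂ _+_ (E-const {n} 1ℚ) (trans (E-*ˡ (- 1ℚ) (contains A)) (cong ((- 1ℚ) *_) (E-contains A))) ⟩
    1ℚ + (- 1ℚ) * p ^ Subset.∣ A ∣          ≡⟨ identity (p ^ Subset.∣ A ∣) ⟨
    1ℚ - p ^ Subset.∣ A ∣                   ∎
    where
    identity : ∀ x → 1ℚ - x ≡ 1ℚ + (- 1ℚ) * x
    identity = solve-∀ ℚ-ring

  -- Containing `A` is an increasing event, so this is Harris' inequality for `f` and the
  -- complementary indicator, with the sign reversed.
  harris-contains : ∀ {n} {f : Subset n → ℚ} → Decreasing f → (A : Subset n) →
                    E (λ S → f S * contains A S) ≤ E f * p ^ Subset.∣ A ∣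
  harris-contains {n} {f} df A = ≤-byDiff identity (≤⇒0≤- (harris df (decreasing-omits A)))
    where
    split : ∀ a b → a * (1ℚ - b) ≡ a + (- 1ℚ) * (a * b)
    split = solve-∀ ℚ-ring
    rearrange : ∀ a b c → a * b - c ≡ (a + (- 1ℚ) * c) - a * (1ℚ - b)
    rearrange = solve-∀ ℚ-ring
    x = p ^ Subset.∣ A ∣
    identity : E f * x - E (λ S → f S * contains A S) ≡
               E (λ S → f S * (1ℚ - contains A S)) - E f * E (λ S → 1ℚ - contains A S)
    identity = begin-equality
      E f * x - E (λ S → f S * contains A S)
        ≡⟨ rearrange (E f) x _ ⟩
      (E f + (- 1ℚ) * E (λ S → f S * contains A S)) - E f * (1ℚ - x)
        ≡⟨ cong₂ (λ a b → (E f + a) - E f * b) (sym (E-*ˡ (- 1ℚ) (λ S → f S * contains A S))) (sym (E-omits A)) ⟩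
      (E f + E (λ S → (- 1ℚ) * (f S * contains A S))) - E f * E (λ S → 1ℚ - contains A S)
        ≡⟨ cong (_- E f * E (λ S → 1ℚ - contains A S)) (E-+ f (λ S → (- 1ℚ) * (f S * contains A S))) ⟨
      E (λ S → f S + (- 1ℚ) * (f S * contains A S)) - E f * E (λ S → 1ℚ - contains A S)
        ≡⟨ cong (_- E f * E (λ S → 1ℚ - contains A S)) (E-cong (λ S → split (f S) (contains A S))) ⟨
      E (λ S → f S * (1ℚ - contains A S)) - E f * E (λ S → 1ℚ - contains A S) ∎

  avoids-lower : ∀ {n} k (F : List (Subset n)) → (∀ A → A ∈ˡ F → Subset.∣ A ∣ ≡ k) →
                 (1ℚ - p ^ k) ^ length F ≤ E (avoids F)
  avoids-lower {n} k [] _ = ℚ.≤-reflexive (sym (E-const {n} 1ℚ))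
  avoids-lower {n} k (A ∷ F) h = begin
    (1ℚ - p ^ k) * (1ℚ - p ^ k) ^ length F
      ≤⟨ *-monoˡ (≤⇒0≤- (^≤1 k 0≤p p≤1)) (avoids-lower k F (λ B B∈ → h B (Any.there B∈))) ⟩
    (1ℚ - p ^ k) * E (avoids F)
      ≡⟨ cong (λ j → (1ℚ - p ^ j) * E (avoids F)) (h A (Any.here refl)) ⟨
    (1ℚ - p ^ Subset.∣ A ∣) * E (avoids F)
      ≡⟨ cong (_* E (avoids F)) (E-omits A) ⟨
    E (λ S → 1ℚ - contains A S) * E (avoids F)
      ≤⟨ harris (decreasing-omits A) (decreasing-avoids F) ⟩
    E (avoids (A ∷ F)) ∎

-- The covariance of two avoidance events

∣p∪q∣≤∣p∣+∣q∣ : ∀ {n} (A B : Subset n) → Subset.∣ A Subset.∪ B ∣ ℕ.≤ Subset.∣ A ∣ ℕ.+ Subset.∣ B ∣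
∣p∪q∣≤∣p∣+∣q∣ []            []            = ℕ.z≤n
∣p∪q∣≤∣p∣+∣q∣ (inside ∷ A)  (inside ∷ B)  =
  ℕ.s≤s (ℕ.≤-trans (∣p∪q∣≤∣p∣+∣q∣ A B) (ℕ.+-monoʳ-≤ Subset.∣ A ∣ (ℕ.n≤1+n Subset.∣ B ∣)))
∣p∪q∣≤∣p∣+∣q∣ (inside ∷ A)  (outside ∷ B) = ℕ.s≤s (∣p∪q∣≤∣p∣+∣q∣ A B)
∣p∪q∣≤∣p∣+∣q∣ (outside ∷ A) (inside ∷ B)  =
  ℕ.≤-trans (ℕ.s≤s (∣p∪q∣≤∣p∣+∣q∣ A B)) (ℕ.≤-reflexive (sym (ℕ.+-suc Subset.∣ A ∣ Subset.∣ B ∣)))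
∣p∪q∣≤∣p∣+∣q∣ (outside ∷ A) (outside ∷ B) = ∣p∪q∣≤∣p∣+∣q∣ A B

^-antitone : ∀ {a m n} → 0ℚ ≤ a → a ≤ 1ℚ → m ℕ.≤ n → a ^ n ≤ a ^ m
^-antitone {a} {m} {n} h l m≤n = subst (λ k → a ^ k ≤ a ^ m) (ℕ.m+[n∸m]≡n m≤n)
  (subst (_≤ a ^ m) (sym (^-homo-* a m (n ℕ.∸ m))) (*≤1≤ (0≤^ m h) (^≤1 (n ℕ.∸ m) h l)))

module Covariance (p : ℚ) (0≤p : 0ℚ ≤ p) (p≤1 : p ≤ 1ℚ) where
  open Expectation p 0≤p p≤1
  open ℚ.≤-Reasoning

  -- The intersection enters through its size because every common coordinate can be pivotal for
  -- both events and contributes once to the covariance.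
  κ : ∀ {n} → Subset n → Subset n → ℚ
  κ A B = ι Subset.∣ A Subset.∩ B ∣ * p ^ Subset.∣ A Subset.∪ B ∣

  0≤κ : ∀ {n} (A B : Subset n) → 0ℚ ≤ κ A B
  0≤κ A B = 0≤* (0≤ι Subset.∣ A Subset.∩ B ∣) (0≤^ Subset.∣ A Subset.∪ B ∣ 0≤p)

  Θ : ∀ {n} → List (Subset n) → List (Subset n) → ℚ
  Θ F H = ∑ F (λ A → ∑ H (κ A))

  private
    tailMass : ∀ {n} → Subset (suc n) → ℚ
    tailMass A = isInside A * p ^ Subset.∣ Vec.tail A ∣

    -- The induction step for a single pair of sets; `a₁` and `a₀` are the joint probabilities given
    -- the first coordinate. If both sets contain that coordinate, `κ` gains one unit of `p U`,
    -- which pays for the product of influences because `q a₀ ≤ m` and `X Y ≤ U`. In the other cases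
    -- the influence term vanishes.
    pair : ∀ {n} {a₁ a₀} → 0ℚ ≤ a₁ → a₁ ≤ a₀ → (A B : Subset (suc n)) →
      p * a₁ * κ (Vec.tail A) (Vec.tail B)
        + q * a₀ * (isOutside A * (isOutside B * κ (Vec.tail A) (Vec.tail B)))
        + p * q * a₀ * (tailMass A * tailMass B)
      ≤ (p * a₁ + q * a₀) * κ A B
    pair {a₁ = a₁} {a₀} 0≤a₁ a₁≤a₀ (x ∷ A) (y ∷ B) = go x y
      where
      c = ι Subset.∣ A Subset.∩ B ∣
      U = p ^ Subset.∣ A Subset.∪ B ∣
      X = p ^ Subset.∣ A ∣
      Y = p ^ Subset.∣ B ∣
      m = p * a₁ + q * a₀
      0≤cU : 0ℚ ≤ c * U
      0≤cU = 0≤κ A B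
      XY≤U : X * Y ≤ U
      XY≤U = subst (_≤ U) (^-homo-* p Subset.∣ A ∣ Subset.∣ B ∣)
        (^-antitone 0≤p p≤1 (∣p∪q∣≤∣p∣+∣q∣ A B))
      a₁≤m : a₁ ≤ m
      a₁≤m = ≤-byDiff (identity p a₁ a₀) (0≤* 0≤q (≤⇒0≤- a₁≤a₀))
        where
        identity : ∀ p a₁ a₀ → p * a₁ + (1ℚ - p) * a₀ - a₁ ≡ (1ℚ - p) * (a₀ - a₁)
        identity = solve-∀ ℚ-ring
      qa₀≤m : q * a₀ ≤ m
      qa₀≤m = nonneg+≤ (0≤* 0≤p 0≤a₁)
      0≤m : 0ℚ ≤ m
      0≤m = ℚ.≤-trans 0≤a₁ a₁≤m
      go : ∀ x y →
        p * a₁ * κ A B + q * a₀ * (isOutside (x ∷ A) * (isOutside (y ∷ B) * κ A B))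
          + p * q * a₀ * (tailMass (x ∷ A) * tailMass (y ∷ B)) ≤ m * κ (x ∷ A) (y ∷ B)
      go inside inside = begin
        p * a₁ * (c * U) + q * a₀ * (0ℚ * (0ℚ * (c * U))) + p * q * a₀ * ((1ℚ * X) * (1ℚ * Y))
          ≡⟨ identity₁ p a₁ (c * U) (q * a₀) q a₀ X Y ⟩
        p * (a₁ * (c * U) + q * a₀ * (X * Y))
          ≤⟨ *-monoˡ 0≤p (ℚ.+-mono-≤ (*-monoʳ 0≤cU a₁≤m)
               (*-mono 0≤m (0≤* (0≤^ Subset.∣ A ∣ 0≤p) (0≤^ Subset.∣ B ∣ 0≤p)) qa₀≤m XY≤U)) ⟩
        p * (m * (c * U) + m * U)
          ≡⟨ identity₂ p m c U ⟩
        m * ((1ℚ + c) * (p * U)) ∎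
        where
        identity₁ : ∀ p a k b q a₀ X Y →
          p * a * k + b * (0ℚ * (0ℚ * k)) + p * q * a₀ * ((1ℚ * X) * (1ℚ * Y)) ≡ p * (a * k + q * a₀ * (X * Y))
        identity₁ = solve-∀ ℚ-ring
        identity₂ : ∀ p m c U → p * (m * (c * U) + m * U) ≡ m * ((1ℚ + c) * (p * U))
        identity₂ = solve-∀ ℚ-ring
      go inside outside = begin
        p * a₁ * (c * U) + q * a₀ * (0ℚ * (1ℚ * (c * U))) + p * q * a₀ * ((1ℚ * X) * (0ℚ * Y))
          ≡⟨ identity₁ p a₁ (c * U) (q * a₀) (p * q * a₀) X Y ⟩
        p * (a₁ * (c * U))
          ≤⟨ *-monoˡ 0≤p (*-monoʳ 0≤cU a₁≤m) ⟩
        p * (m * (c * U))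
          ≡⟨ identity₂ p m c U ⟩
        m * (c * (p * U)) ∎
        where
        identity₁ : ∀ p a k b r X Y →
          p * a * k + b * (0ℚ * (1ℚ * k)) + r * ((1ℚ * X) * (0ℚ * Y)) ≡ p * (a * k)
        identity₁ = solve-∀ ℚ-ring
        identity₂ : ∀ p m c U → p * (m * (c * U)) ≡ m * (c * (p * U))
        identity₂ = solve-∀ ℚ-ring
      go outside inside = begin
        p * a₁ * (c * U) + q * a₀ * (1ℚ * (0ℚ * (c * U))) + p * q * a₀ * ((0ℚ * X) * (1ℚ * Y))
          ≡⟨ identity₁ p a₁ (c * U) (q * a₀) (p * q * a₀) X Y ⟩
        p * (a₁ * (c * U))
          ≤⟨ *-monoˡ 0≤p (*-monoʳ 0≤cU a₁≤m) ⟩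
        p * (m * (c * U))
          ≡⟨ identity₂ p m c U ⟩
        m * (c * (p * U)) ∎
        where
        identity₁ : ∀ p a k b r X Y →
          p * a * k + b * (1ℚ * (0ℚ * k)) + r * ((0ℚ * X) * (1ℚ * Y)) ≡ p * (a * k)
        identity₁ = solve-∀ ℚ-ring
        identity₂ : ∀ p m c U → p * (m * (c * U)) ≡ m * (c * (p * U))
        identity₂ = solve-∀ ℚ-ring
      go outside outside = ℚ.≤-reflexive (identity p a₁ (c * U) (q * a₀) (p * q * a₀) X Y)
        where
        identity : ∀ p a k b r X Y →
          p * a * k + b * (1ℚ * (1ℚ * k)) + r * ((0ℚ * X) * (0ℚ * Y)) ≡ (p * a + b) * k
        identity = solve-∀ ℚ-ring

  -- Expectation of `pivot-bound`. By Harris' inequality, avoiding the remaining family makes the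
  -- presence of a given set only less likely, so the probability of avoidance comes out as a
  -- factor.
  pivot-mass : ∀ {n} (F : List (Subset (suc n))) →
    E (avoids (outsideTails F)) - E (avoids (tails F)) ≤ E (avoids (outsideTails F)) * ∑ F tailMass
  pivot-mass F = begin
    E f₀ - E f₁
      ≡⟨ identity₁ (E f₀) (E f₁) ⟩
    E f₀ + (- 1ℚ) * E f₁
      ≡⟨ cong (E f₀ +_) (E-*ˡ (- 1ℚ) f₁) ⟨
    E f₀ + E (λ S → (- 1ℚ) * f₁ S)
      ≡⟨ E-+ f₀ (λ S → (- 1ℚ) * f₁ S) ⟨
    E (λ S → f₀ S + (- 1ℚ) * f₁ S)
      ≡⟨ E-cong (λ S → identity₁ (f₀ S) (f₁ S)) ⟨
    E (λ S → f₀ S - f₁ S)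
      ≤⟨ E-mono (pivot-bound F) ⟩
    E (λ S → ∑ F (λ A → isInside A * (f₀ S * contains (Vec.tail A) S)))
      ≡⟨ E-∑ F (λ A S → isInside A * (f₀ S * contains (Vec.tail A) S)) ⟩
    ∑ F (λ A → E (λ S → isInside A * (f₀ S * contains (Vec.tail A) S)))
      ≡⟨ ∑-cong F (λ A → E-*ˡ (isInside A) (λ S → f₀ S * contains (Vec.tail A) S)) ⟩
    ∑ F (λ A → isInside A * E (λ S → f₀ S * contains (Vec.tail A) S))
      ≤⟨ ∑-mono F (λ A → *-monoˡ (0≤isInside A) (harris-contains (decreasing-avoids (outsideTails F)) (Vec.tail A))) ⟩
    ∑ F (λ A → isInside A * (E f₀ * p ^ Subset.∣ Vec.tail A ∣))
      ≡⟨ ∑-cong F (λ A → identity₂ (isInside A) (E f₀) (p ^ Subset.∣ Vec.tail A ∣)) ⟩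
    ∑ F (λ A → E f₀ * tailMass A)
      ≡⟨ ∑-*ˡ F (E f₀) tailMass ⟩
    E f₀ * ∑ F tailMass ∎
    where
    f₀ = avoids (outsideTails F)
    f₁ = avoids (tails F)
    identity₁ : ∀ a b → a - b ≡ a + (- 1ℚ) * b
    identity₁ = solve-∀ ℚ-ring
    identity₂ : ∀ a b c → a * (b * c) ≡ b * (a * c)
    identity₂ = solve-∀ ℚ-ring
    0≤isInside : ∀ {n} (A : Subset (suc n)) → 0ℚ ≤ isInside A
    0≤isInside (inside ∷ A)  = 0≤1
    0≤isInside (outside ∷ A) = ℚ.≤-refl

  -- Conditioning on the first coordinate, the covariance picks up p q times a product of two
  -- influences, each of which Harris' inequality bounds by the mass of the members containing
  -- that coordinate.
  covariance : ∀ {n} (F H : List (Subset n)) →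
    E (λ S → avoids F S * avoids H S) ≤
    E (avoids F) * E (avoids H) + E (λ S → avoids F S * avoids H S) * Θ F H
  covariance {zero} F H = ≤+nonneg (0≤* (0≤* (0≤avoids F []) (0≤avoids H []))
    (0≤∑ F (λ A → 0≤∑ H (0≤κ A))))
  covariance {suc n} F H = begin
    E (λ S → avoids F S * avoids H S)
      ≡⟨ split₂ ⟩
    m
      ≤⟨ ≤-byDiff (identity p a₁₁ a₀₀ f₁ f₀ g₁ g₀ θ₁ θ₀ (∑ F tailMass) (∑ H tailMass))
           (0≤+ (0≤+ (0≤* 0≤p (≤⇒0≤- (IH (tails F) (tails H))))
                     (0≤* 0≤q (≤⇒0≤- (IH (outsideTails F) (outsideTails H)))))
                (0≤* (0≤* 0≤p 0≤q) (≤⇒0≤- pivots))) ⟩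
    (p * f₁ + q * f₀) * (p * g₁ + q * g₀) + (p * a₁₁ * θ₁ + q * a₀₀ * θ₀ + p * q * a₀₀ * (∑ F tailMass * ∑ H tailMass))
      ≤⟨ ℚ.+-monoʳ-≤ ((p * f₁ + q * f₀) * (p * g₁ + q * g₀)) sums ⟩
    (p * f₁ + q * f₀) * (p * g₁ + q * g₀) + m * Θ F H
      ≡⟨ cong₂ _+_ (cong₂ _*_ (split F) (split H)) (cong (_* Θ F H) split₂) ⟨
    E (avoids F) * E (avoids H) + E (λ S → avoids F S * avoids H S) * Θ F H ∎
    where
    IH = covariance {n}
    f₁ = E (avoids (tails F))
    f₀ = E (avoids (outsideTails F))
    g₁ = E (avoids (tails H))
    g₀ = E (avoids (outsideTails H))
    a₁₁ = E (λ S → avoids (tails F) S * avoids (tails H) S)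
    a₀₀ = E (λ S → avoids (outsideTails F) S * avoids (outsideTails H) S)
    m = p * a₁₁ + q * a₀₀
    θ₁ = Θ (tails F) (tails H)
    θ₀ = Θ (outsideTails F) (outsideTails H)
    split : ∀ F → E (avoids F) ≡ p * E (avoids (tails F)) + q * E (avoids (outsideTails F))
    split F = cong₂ (λ a b → p * a + q * b) (E-cong (avoids-inside F)) (E-cong (avoids-outside F))
    split₂ : E (λ S → avoids F S * avoids H S) ≡ m
    split₂ = cong₂ (λ a b → p * a + q * b)
      (E-cong (λ S → cong₂ _*_ (avoids-inside F S) (avoids-inside H S)))
      (E-cong (λ S → cong₂ _*_ (avoids-outside F S) (avoids-outside H S)))
    -- Harris' inequality in the other direction: the product `f₀ g₀` of separate probabilities is
    -- at most the joint one. This is what makes the error term relative.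
    pivots : (f₀ - f₁) * (g₀ - g₁) ≤ a₀₀ * (∑ F tailMass * ∑ H tailMass)
    pivots = begin
      (f₀ - f₁) * (g₀ - g₁)
        ≤⟨ *-mono (ℚ.≤-trans (≤⇒0≤- (E-mono (avoids-antitone F))) (pivot-mass F))
             (≤⇒0≤- (E-mono (avoids-antitone H))) (pivot-mass F) (pivot-mass H) ⟩
      (f₀ * ∑ F tailMass) * (g₀ * ∑ H tailMass)
        ≡⟨ rearrange f₀ (∑ F tailMass) g₀ (∑ H tailMass) ⟩
      (f₀ * g₀) * (∑ F tailMass * ∑ H tailMass)
        ≤⟨ *-monoʳ (0≤* (0≤tailMass F) (0≤tailMass H))
             (harris (decreasing-avoids (outsideTails F)) (decreasing-avoids (outsideTails H))) ⟩
      a₀₀ * (∑ F tailMass * ∑ H tailMass) ∎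
      where
      rearrange : ∀ a b c d → (a * b) * (c * d) ≡ (a * c) * (b * d)
      rearrange = solve-∀ ℚ-ring
      0≤tailMass : ∀ F → 0ℚ ≤ ∑ F tailMass
      0≤tailMass F = 0≤∑ F λ
        { (inside ∷ A)  → 0≤* 0≤1 (0≤^ Subset.∣ A ∣ 0≤p)
        ; (outside ∷ A) → ℚ.≤-reflexive (sym (ℚ.*-zeroˡ (p ^ Subset.∣ A ∣))) }
    sums : p * a₁₁ * θ₁ + q * a₀₀ * θ₀ + p * q * a₀₀ * (∑ F tailMass * ∑ H tailMass) ≤ m * Θ F H
    sums = begin
      p * a₁₁ * θ₁ + q * a₀₀ * θ₀ + p * q * a₀₀ * (∑ F tailMass * ∑ H tailMass)
        ≡⟨ cong₂ _+_ (cong₂ (λ a b → p * a₁₁ * a + q * a₀₀ * b) θ₁≡ θ₀≡)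
             (cong (p * q * a₀₀ *_) (∑-product F H tailMass tailMass)) ⟩
      p * a₁₁ * ∑∑ k₁ + q * a₀₀ * ∑∑ k₀ + p * q * a₀₀ * ∑∑ k₂
        ≡⟨ cong₂ _+_ (cong₂ _+_ (∑∑-* (p * a₁₁) k₁) (∑∑-* (q * a₀₀) k₀)) (∑∑-* (p * q * a₀₀) k₂) ⟨
      ∑∑ (λ A B → p * a₁₁ * k₁ A B) + ∑∑ (λ A B → q * a₀₀ * k₀ A B) + ∑∑ (λ A B → p * q * a₀₀ * k₂ A B)
        ≡⟨ cong (_+ ∑∑ (λ A B → p * q * a₀₀ * k₂ A B))
             (∑∑-+ (λ A B → p * a₁₁ * k₁ A B) (λ A B → q * a₀₀ * k₀ A B)) ⟨
      ∑∑ (λ A B → p * a₁₁ * k₁ A B + q * a₀₀ * k₀ A B) + ∑∑ (λ A B → p * q * a₀₀ * k₂ A B)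
        ≡⟨ ∑∑-+ (λ A B → p * a₁₁ * k₁ A B + q * a₀₀ * k₀ A B) (λ A B → p * q * a₀₀ * k₂ A B) ⟨
      ∑∑ (λ A B → p * a₁₁ * k₁ A B + q * a₀₀ * k₀ A B + p * q * a₀₀ * k₂ A B)
        ≤⟨ ∑-mono F (λ A → ∑-mono H (λ B → pair 0≤a₁₁ a₁₁≤a₀₀ A B)) ⟩
      ∑∑ (λ A B → m * κ A B)
        ≡⟨ ∑∑-* m κ ⟩
      m * Θ F H ∎
      where
      ∑∑ : (Subset (suc n) → Subset (suc n) → ℚ) → ℚ
      ∑∑ k = ∑ F (λ A → ∑ H (k A))
      ∑∑-* : ∀ c k → ∑∑ (λ A B → c * k A B) ≡ c * ∑∑ k
      ∑∑-* c k = trans (∑-cong F (λ A → ∑-*ˡ H c (k A))) (∑-*ˡ F c (λ A → ∑ H (k A)))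
      ∑∑-+ : ∀ k l → ∑∑ (λ A B → k A B + l A B) ≡ ∑∑ k + ∑∑ l
      ∑∑-+ k l = trans (∑-cong F (λ A → ∑-+ H (k A) (l A))) (∑-+ F (λ A → ∑ H (k A)) (λ A → ∑ H (l A)))
      k₁ k₀ k₂ : Subset (suc n) → Subset (suc n) → ℚ
      k₁ A B = κ (Vec.tail A) (Vec.tail B)
      k₀ A B = isOutside A * (isOutside B * κ (Vec.tail A) (Vec.tail B))
      k₂ A B = tailMass A * tailMass B
      θ₁≡ : θ₁ ≡ ∑∑ k₁
      θ₁≡ = trans (∑-map Vec.tail F (λ A → ∑ (tails H) (κ A)))
                  (∑-cong F (λ A → ∑-map Vec.tail H (κ (Vec.tail A))))
      θ₀≡ : θ₀ ≡ ∑∑ k₀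
      θ₀≡ = trans (∑-outsideTails F (λ A → ∑ (outsideTails H) (κ A)))
        (∑-cong F (λ A → trans (cong (isOutside A *_) (∑-outsideTails H (κ (Vec.tail A))))
          (sym (∑-*ˡ H (isOutside A) (λ B → isOutside B * κ (Vec.tail A) (Vec.tail B))))))
      0≤a₁₁ : 0ℚ ≤ a₁₁
      0≤a₁₁ = 0≤E (λ S → 0≤* (0≤avoids (tails F) S) (0≤avoids (tails H) S))
      a₁₁≤a₀₀ : a₁₁ ≤ a₀₀
      a₁₁≤a₀₀ = E-mono (λ S → *-mono (0≤avoids (outsideTails F) S) (0≤avoids (tails H) S)
        (avoids-antitone F S) (avoids-antitone H S))
    identity : ∀ p a b f₁ f₀ g₁ g₀ θ₁ θ₀ s t →
      (p * f₁ + (1ℚ - p) * f₀) * (p * g₁ + (1ℚ - p) * g₀)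
        + (p * a * θ₁ + (1ℚ - p) * b * θ₀ + p * (1ℚ - p) * b * (s * t)) - (p * a + (1ℚ - p) * b) ≡
      p * (f₁ * g₁ + a * θ₁ - a) + (1ℚ - p) * (f₀ * g₀ + b * θ₀ - b)
        + p * (1ℚ - p) * (b * (s * t) - (f₀ - f₁) * (g₀ - g₁))
    identity = solve-∀ ℚ-ring

-- Signed words

-- skip stands for the neutral element, so that all words of length at most d can be padded to length d.
data Letter (N : ℕ) : Set where
  skip    : Letter N
  pos neg : Fin N → Letter N

Word : ℕ → Set
Word N = List (Letter N)

private variable
  N : ℕ

insert : Fin N → Subset N → Subset N
insert i A = A Vec.[ i ]≔ inside

include : Letter N → Subset N → Subset N
include skip    A = A
include (pos i) A = insert i A
include (neg i) A = insert i A

support : Word N → Subset N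
support []      = Subset.⊥
support (l ∷ w) = include l (support w)

-- Adjoining an old letter does not enlarge the set.
Old : Subset N → Letter N → Set
Old A skip    = ⊤
Old A (pos i) = i ∈ A
Old A (neg i) = i ∈ A

old? : (A : Subset N) (l : Letter N) → Dec (Old A l)
old? A skip    = yes tt
old? A (pos i) = i ∈? A
old? A (neg i) = i ∈? A

module _ where
  ∣insert∣-∈ : ∀ {i : Fin N} {A} → i ∈ A → Subset.∣ insert i A ∣ ≡ Subset.∣ A ∣
  ∣insert∣-∈ here                            = refl
  ∣insert∣-∈ {A = inside ∷ A}  (there i∈A) = cong suc (∣insert∣-∈ i∈A)
  ∣insert∣-∈ {A = outside ∷ A} (there i∈A) = ∣insert∣-∈ i∈A

  ∣insert∣-∉ : ∀ {i : Fin N} {A} → i ∉ A → Subset.∣ insert i A ∣ ≡ suc Subset.∣ A ∣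
  ∣insert∣-∉ {i = zero}  {inside ∷ A}  i∉A = contradiction here i∉A
  ∣insert∣-∉ {i = zero}  {outside ∷ A} i∉A = refl
  ∣insert∣-∉ {i = suc i} {inside ∷ A}  i∉A = cong suc (∣insert∣-∉ (i∉A ∘ there))
  ∣insert∣-∉ {i = suc i} {outside ∷ A} i∉A = ∣insert∣-∉ (i∉A ∘ there)

  ∈-insert : ∀ (i : Fin N) A → i ∈ insert i A
  ∈-insert zero    (x ∷ A) = here
  ∈-insert (suc i) (x ∷ A) = there (∈-insert i A)

  ∈-insert⁺ : ∀ {i j : Fin N} {A} → j ∈ A → j ∈ insert i A
  ∈-insert⁺ {i = zero}  here        = here
  ∈-insert⁺ {i = zero}  (there j∈A) = there j∈A
  ∈-insert⁺ {i = suc i} here        = here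
  ∈-insert⁺ {i = suc i} (there j∈A) = there (∈-insert⁺ j∈A)

  ∈-insert⁻ : ∀ {i j : Fin N} {A} → j ∈ insert i A → j ≡ i ⊎ j ∈ A
  ∈-insert⁻ {i = zero}  {A = x ∷ A} here        = inj₁ refl
  ∈-insert⁻ {i = zero}  {A = x ∷ A} (there j∈A) = inj₂ (there j∈A)
  ∈-insert⁻ {i = suc i} {A = x ∷ A} here        = inj₂ here
  ∈-insert⁻ {i = suc i} {A = x ∷ A} (there j∈A) with ∈-insert⁻ j∈A
  ... | inj₁ refl = inj₁ refl
  ... | inj₂ j∈   = inj₂ (there j∈)

  ∪-insert : ∀ (A : Subset N) i B → A Subset.∪ insert i B ≡ insert i (A Subset.∪ B)
  ∪-insert (inside ∷ A)  zero    (y ∷ B) = refl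
  ∪-insert (outside ∷ A) zero    (y ∷ B) = refl
  ∪-insert (x ∷ A)       (suc i) (y ∷ B) = cong ((x Bool.∨ y) ∷_) (∪-insert A i B)

  ∣∩insert∣≤ : ∀ (A : Subset N) i B →
    ι Subset.∣ A Subset.∩ insert i B ∣ ≤ 𝟙 (i ∈? A) + ι Subset.∣ A Subset.∩ B ∣
  ∣∩insert∣≤ (inside ∷ A)  zero    (inside ∷ B)  = nonneg+≤ 0≤1
  ∣∩insert∣≤ (inside ∷ A)  zero    (outside ∷ B) = ℚ.≤-refl
  ∣∩insert∣≤ (outside ∷ A) zero    (y ∷ B)       = ℚ.≤-reflexive (sym (ℚ.+-identityˡ (ι Subset.∣ A Subset.∩ B ∣)))
  ∣∩insert∣≤ (inside ∷ A)  (suc i) (inside ∷ B)  = ℚ.≤-trans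
    (ℚ.+-monoʳ-≤ 1ℚ (∣∩insert∣≤ A i B))
    (ℚ.≤-reflexive (trans (identity (𝟙 (i ∈? A)) (ι Subset.∣ A Subset.∩ B ∣))
                          (cong (_+ (1ℚ + ι Subset.∣ A Subset.∩ B ∣)) (shift A i))))
    where
    identity : ∀ a b → 1ℚ + (a + b) ≡ a + (1ℚ + b)
    identity = solve-∀ ℚ-ring
    shift : ∀ (A : Subset N) i → 𝟙 (i ∈? A) ≡ 𝟙 (suc i ∈? (inside ∷ A))
    shift A i = 𝟙-cong (i ∈? A) (suc i ∈? (inside ∷ A)) there (λ { (there h) → h })
  ∣∩insert∣≤ (inside ∷ A)  (suc i) (outside ∷ B) = ℚ.≤-trans (∣∩insert∣≤ A i B)
    (ℚ.+-monoˡ-≤ (ι Subset.∣ A Subset.∩ B ∣) (𝟙-mono (i ∈? A) (suc i ∈? (inside ∷ A)) there))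
  ∣∩insert∣≤ (outside ∷ A) (suc i) (y ∷ B)       = ℚ.≤-trans (∣∩insert∣≤ A i B)
    (ℚ.+-monoˡ-≤ (ι Subset.∣ A Subset.∩ B ∣) (𝟙-mono (i ∈? A) (suc i ∈? (outside ∷ A)) there))

  contains-⊥ : ∀ (S : Subset N) → contains Subset.⊥ S ≡ 1ℚ
  contains-⊥ []      = refl
  contains-⊥ (_ ∷ S) = contains-⊥ S

  contains-insert : ∀ {i : Fin N} {S} → i ∈ S → ∀ B → contains B S ≡ 1ℚ → contains (insert i B) S ≡ 1ℚ
  contains-insert here        (inside ∷ B)  h = h
  contains-insert here        (outside ∷ B) h = h
  contains-insert {S = inside ∷ S}  (there i∈S) (inside ∷ B)  h = contains-insert i∈S B h
  contains-insert {S = outside ∷ S} (there i∈S) (inside ∷ B)  ()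
  contains-insert {S = s ∷ S} (there i∈S) (outside ∷ B) h = contains-insert i∈S B h

  contains-support : ∀ {S : Subset N} {w} → All.All (Old S) w → contains (support w) S ≡ 1ℚ
  contains-support {S = S} []              = contains-⊥ S
  contains-support {w = skip ∷ w}  (_ ∷ h) = contains-support h
  contains-support {w = pos i ∷ w} (l ∷ h) = contains-insert l (support w) (contains-support h)
  contains-support {w = neg i ∷ w} (l ∷ h) = contains-insert l (support w) (contains-support h)

  ∣include∣≤ : ∀ (l : Letter N) A → Subset.∣ include l A ∣ ℕ.≤ suc Subset.∣ A ∣
  ∣include∣≤ skip A = ℕ.n≤1+n Subset.∣ A ∣
  ∣include∣≤ (pos i) A with i ∈? A
  ... | yes h = ℕ.≤-trans (ℕ.≤-reflexive (∣insert∣-∈ h)) (ℕ.n≤1+n Subset.∣ A ∣)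
  ... | no  h = ℕ.≤-reflexive (∣insert∣-∉ h)
  ∣include∣≤ (neg i) A = ∣include∣≤ (pos i) A

  ∣support∣≤ : ∀ (w : Word N) → Subset.∣ support w ∣ ℕ.≤ length w
  ∣support∣≤ {N} []  = ℕ.≤-reflexive (∣⊥∣≡0 N)
  ∣support∣≤ (l ∷ w) = ℕ.≤-trans (∣include∣≤ l (support w)) (ℕ.s≤s (∣support∣≤ w))

data Reduced {N : ℕ} : Word N → Set where
  []  : Reduced []
  pos : ∀ {i w} → i ∉ support w → Reduced w → Reduced (pos i ∷ w)
  neg : ∀ {i w} → i ∉ support w → Reduced w → Reduced (neg i ∷ w)

-- Since `skip` is old relative to every set, a padded word also counts as repeating. Counting the
-- positions instead of testing for one makes the quantity additive, so that it can be summed letter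
-- by letter.
repeats : Word N → ℚ
repeats []      = 0ℚ
repeats (l ∷ w) = 𝟙 (old? (support w) l) + repeats w

0≤repeats : ∀ (w : Word N) → 0ℚ ≤ repeats w
0≤repeats []      = ℚ.≤-refl
0≤repeats (l ∷ w) = 0≤+ (0≤𝟙 (old? (support w) l)) (0≤repeats w)

reduced⊎repeats : ∀ (w : Word N) → Reduced w ⊎ 1ℚ ≤ repeats w
reduced⊎repeats []         = inj₁ []
reduced⊎repeats (skip ∷ w) = inj₂ (≤+nonneg (0≤repeats w))
reduced⊎repeats (pos i ∷ w) with reduced⊎repeats w
... | inj₂ h = inj₂ (ℚ.≤-trans h (nonneg+≤ (0≤𝟙 (i ∈? support w))))
... | inj₁ h with i ∈? support w
...   | yes _ = inj₂ (≤+nonneg (0≤repeats w))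
...   | no  n = inj₁ (pos n h)
reduced⊎repeats (neg i ∷ w) with reduced⊎repeats w
... | inj₂ h = inj₂ (ℚ.≤-trans h (nonneg+≤ (0≤𝟙 (i ∈? support w))))
... | inj₁ h with i ∈? support w
...   | yes _ = inj₂ (≤+nonneg (0≤repeats w))
...   | no  n = inj₁ (neg n h)

∣support∣-reduced : ∀ {w : Word N} → Reduced w → Subset.∣ support w ∣ ≡ length w
∣support∣-reduced {N} []  = ∣⊥∣≡0 N
∣support∣-reduced (pos n r) = trans (∣insert∣-∉ n) (cong suc (∣support∣-reduced r))
∣support∣-reduced (neg n r) = trans (∣insert∣-∉ n) (cong suc (∣support∣-reduced r))

letters : List (Fin N) → List (Letter N)
letters xs = skip ∷ List.map pos xs ++ List.map neg xs

words : List (Fin N) → ℕ → List (Word N)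
words xs zero    = [] ∷ []
words xs (suc k) = List.concatMap (λ l → List.map (l ∷_) (words xs k)) (letters xs)

-- When the entries of `xs` are distinct, every signed `k`-set is listed once, its letters in the
-- order of `xs`. In an abelian group this order does not affect the product, so one representative
-- suffices.
signedSets : List (Fin N) → ℕ → List (Word N)
signedSets xs       zero    = [] ∷ []
signedSets []       (suc k) = []
signedSets (x ∷ xs) (suc k) =
  List.map (pos x ∷_) (signedSets xs k) ++ List.map (neg x ∷_) (signedSets xs k) ++ signedSets xs (suc k)

module _ (xs : List (Fin N)) where
  ∑-letters : ∀ f → ∑ (letters xs) f ≡ f skip + (∑ xs (f ∘ pos) + ∑ xs (f ∘ neg))
  ∑-letters f = cong (f skip +_) (trans (∑-++ (List.map pos xs) (List.map neg xs) f)
    (cong₂ _+_ (∑-map pos xs f) (∑-map neg xs f)))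

  ∑-words : ∀ k f → ∑ (words xs (suc k)) f ≡ ∑ (letters xs) (λ l → ∑ (words xs k) (f ∘ (l ∷_)))
  ∑-words k f = go (letters xs)
    where
    go : ∀ ls → ∑ (List.concatMap (λ l → List.map (l ∷_) (words xs k)) ls) f ≡
                ∑ ls (λ l → ∑ (words xs k) (f ∘ (l ∷_)))
    go []       = refl
    go (l ∷ ls) = trans
      (∑-++ (List.map (l ∷_) (words xs k)) (List.concatMap (λ l → List.map (l ∷_) (words xs k)) ls) f)
      (cong₂ _+_ (∑-map (l ∷_) (words xs k) f) (go ls))

  words-length : ∀ k {w} → w ∈ˡ words xs k → length w ≡ k
  words-length zero    (Any.here refl) = refl
  words-length (suc k) w∈ with Any.satisfied (Mem.∈-concatMap⁻ (λ l → List.map (l ∷_) (words xs k)) {xs = letters xs} w∈)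
  ... | l , w∈l with Mem.∈-map⁻ (l ∷_) w∈l
  ...   | v , v∈ , refl = cong suc (words-length k v∈)

  ∈-words⁺ : ∀ {w} → All.All (_∈ˡ letters xs) w → w ∈ˡ words xs (length w)
  ∈-words⁺ []                 = Any.here refl
  ∈-words⁺ {w = l ∷ w} (h ∷ hs) =
    Mem.∈-concatMap⁺ (λ l → List.map (l ∷_) (words xs (length w))) (Any.map (λ { refl → Mem.∈-map⁺ (l ∷_) (∈-words⁺ hs) }) h)

∑-signedSets : ∀ (x : Fin N) xs k f →
  ∑ (signedSets (x ∷ xs) (suc k)) f ≡
  ∑ (signedSets xs k) (f ∘ (pos x ∷_)) + (∑ (signedSets xs k) (f ∘ (neg x ∷_)) + ∑ (signedSets xs (suc k)) f)
∑-signedSets x xs k f = trans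
  (∑-++ (List.map (pos x ∷_) (signedSets xs k)) (List.map (neg x ∷_) (signedSets xs k) ++ signedSets xs (suc k)) f)
  (cong₂ _+_ (∑-map (pos x ∷_) (signedSets xs k) f)
    (trans (∑-++ (List.map (neg x ∷_) (signedSets xs k)) (signedSets xs (suc k)) f)
           (cong (_+ ∑ (signedSets xs (suc k)) f) (∑-map (neg x ∷_) (signedSets xs k) f))))

∑-words-mono : ∀ (x : Fin N) xs k {f} → (∀ w → 0ℚ ≤ f w) → ∑ (words xs k) f ≤ ∑ (words (x ∷ xs) k) f
∑-words-mono x xs zero    {f} f≥0 = ℚ.≤-refl
∑-words-mono x xs (suc k) {f} f≥0 = begin
  ∑ (words xs (suc k)) f
    ≡⟨ trans (∑-words xs k f) (∑-letters xs g) ⟩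
  g skip + (∑ xs (g ∘ pos) + ∑ xs (g ∘ neg))
    ≤⟨ ℚ.+-mono-≤ (le skip) (ℚ.+-mono-≤
         (ℚ.≤-trans (∑-mono xs (le ∘ pos)) (nonneg+≤ (0≤h (pos x))))
         (ℚ.≤-trans (∑-mono xs (le ∘ neg)) (nonneg+≤ (0≤h (neg x))))) ⟩
  h skip + (∑ (x ∷ xs) (h ∘ pos) + ∑ (x ∷ xs) (h ∘ neg))
    ≡⟨ trans (∑-words (x ∷ xs) k f) (∑-letters (x ∷ xs) h) ⟨
  ∑ (words (x ∷ xs) (suc k)) f ∎
  where
  open ℚ.≤-Reasoning
  g h : Letter _ → ℚ
  g l = ∑ (words xs k) (f ∘ (l ∷_))
  h l = ∑ (words (x ∷ xs) k) (f ∘ (l ∷_))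
  le : ∀ l → g l ≤ h l
  le l = ∑-words-mono x xs k (f≥0 ∘ (l ∷_))
  0≤h : ∀ l → 0ℚ ≤ h l
  0≤h l = 0≤∑ (words (x ∷ xs) k) (f≥0 ∘ (l ∷_))

-- Passing to all words costs little in error terms and turns the sums into products over positions.
-- The main term, where the factor `k !` matters, never takes this route.
signedSets≤words : ∀ (xs : List (Fin N)) k {f} → (∀ w → 0ℚ ≤ f w) → ∑ (signedSets xs k) f ≤ ∑ (words xs k) f
signedSets≤words xs       zero    f≥0 = ℚ.≤-refl
signedSets≤words []       (suc k) f≥0 = 0≤∑ (words [] (suc k)) f≥0
signedSets≤words (x ∷ xs) (suc k) {f} f≥0 = begin
  ∑ (signedSets (x ∷ xs) (suc k)) f
    ≡⟨ ∑-signedSets x xs k f ⟩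
  ∑ (signedSets xs k) (f ∘ (pos x ∷_)) + (∑ (signedSets xs k) (f ∘ (neg x ∷_)) + ∑ (signedSets xs (suc k)) f)
    ≤⟨ ℚ.+-mono-≤ (head pos) (ℚ.+-mono-≤ (head neg) rest) ⟩
  h (pos x) + (h (neg x) + (h skip + (∑ xs (h ∘ pos) + ∑ xs (h ∘ neg))))
    ≡⟨ identity (h (pos x)) (h (neg x)) (h skip) (∑ xs (h ∘ pos)) (∑ xs (h ∘ neg)) ⟩
  h skip + (∑ (x ∷ xs) (h ∘ pos) + ∑ (x ∷ xs) (h ∘ neg))
    ≡⟨ trans (∑-words (x ∷ xs) k f) (∑-letters (x ∷ xs) h) ⟨
  ∑ (words (x ∷ xs) (suc k)) f ∎
  where
  open ℚ.≤-Reasoning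
  h : Letter _ → ℚ
  h l = ∑ (words (x ∷ xs) k) (f ∘ (l ∷_))
  head : (s : Fin _ → Letter _) → ∑ (signedSets xs k) (f ∘ (s x ∷_)) ≤ h (s x)
  head s = ℚ.≤-trans (signedSets≤words xs k (f≥0 ∘ (s x ∷_))) (∑-words-mono x xs k (f≥0 ∘ (s x ∷_)))
  rest : ∑ (signedSets xs (suc k)) f ≤ h skip + (∑ xs (h ∘ pos) + ∑ xs (h ∘ neg))
  rest = begin
    ∑ (signedSets xs (suc k)) f  ≤⟨ signedSets≤words xs (suc k) f≥0 ⟩
    ∑ (words xs (suc k)) f       ≡⟨ ∑-words xs k f ⟩
    ∑ (letters xs) (λ l → ∑ (words xs k) (f ∘ (l ∷_)))
      ≤⟨ ∑-mono (letters xs) (λ l → ∑-words-mono x xs k (f≥0 ∘ (l ∷_))) ⟩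
    ∑ (letters xs) h             ≡⟨ ∑-letters xs h ⟩
    h skip + (∑ xs (h ∘ pos) + ∑ xs (h ∘ neg)) ∎
  identity : ∀ a b c d e → a + (b + (c + (d + e))) ≡ c + ((a + d) + (b + e))
  identity = solve-∀ ℚ-ring

-- The factor k! reflects that each k-element set underlies k! words.
signedSets-count : ∀ (xs : List (Fin N)) k →
  ι (k !) * ι (length (signedSets xs k)) ≤ (ι 2 * ι (length xs)) ^ k
signedSets-count xs       zero    = ℚ.≤-refl
signedSets-count []       (suc k) = ℚ.≤-reflexive
  (trans (ℚ.*-zeroʳ (ι (suc k !))) (sym (trans (cong (_* (ι 2 * 0ℚ) ^ k) (ℚ.*-zeroʳ (ι 2))) (ℚ.*-zeroˡ ((ι 2 * 0ℚ) ^ k)))))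
signedSets-count (x ∷ xs) (suc k) = begin
  ι (suc k !) * ι (length (signedSets (x ∷ xs) (suc k)))
    ≡⟨ cong₂ _*_ (ι-* (suc k) (k !)) count ⟩
  (ι (suc k) * ι (k !)) * (a + (a + b))
    ≡⟨ identity₁ (ι (suc k)) (ι (k !)) a b ⟩
  ι 2 * (ι (suc k) * (ι (k !) * a)) + (ι (suc k) * ι (k !)) * b
    ≤⟨ ℚ.+-mono-≤
         (*-monoˡ (0≤ι 2) (*-monoˡ (0≤ι (suc k)) (signedSets-count xs k)))
         (subst (λ z → z * b ≤ m ^ suc k) (ι-* (suc k) (k !)) (signedSets-count xs (suc k))) ⟩
  ι 2 * (ι (suc k) * m ^ k) + m ^ suc k
    ≤⟨ bernoulli k ⟩
  (ι 2 + m) ^ suc k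
    ≡⟨ cong (_^ suc k) (identity₂ (ι 2) (ι (length xs))) ⟩
  (ι 2 * (1ℚ + ι (length xs))) ^ suc k ∎
  where
  open ℚ.≤-Reasoning
  m = ι 2 * ι (length xs)
  a = ι (length (signedSets xs k))
  b = ι (length (signedSets xs (suc k)))
  0≤m : 0ℚ ≤ m
  0≤m = 0≤* (0≤ι 2) (0≤ι (length xs))
  size : ∀ (f : Letter _) → ι (length (List.map (f ∷_) (signedSets xs k))) ≡ a
  size f = cong ι (length-map (f ∷_) (signedSets xs k))
  count : ι (length (signedSets (x ∷ xs) (suc k))) ≡ a + (a + b)
  count = trans (cong ι (length-++ (List.map (pos x ∷_) (signedSets xs k))))
    (trans (ι-+ (length (List.map (pos x ∷_) (signedSets xs k)))
                (length (List.map (neg x ∷_) (signedSets xs k) ++ signedSets xs (suc k))))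
      (cong₂ _+_ (size (pos x)) (trans (cong ι (length-++ (List.map (neg x ∷_) (signedSets xs k))))
        (trans (ι-+ (length (List.map (neg x ∷_) (signedSets xs k))) (length (signedSets xs (suc k))))
          (cong (_+ b) (size (neg x)))))))
  identity₁ : ∀ s f a b → (s * f) * (a + (a + b)) ≡ (1ℚ + (1ℚ + 0ℚ)) * (s * (f * a)) + (s * f) * b
  identity₁ = solve-∀ ℚ-ring
  identity₂ : ∀ t l → t + t * l ≡ t * (1ℚ + l)
  identity₂ = solve-∀ ℚ-ring
  bernoulli : ∀ k → ι 2 * (ι (suc k) * m ^ k) + m ^ suc k ≤ (ι 2 + m) ^ suc k
  bernoulli zero    = ℚ.≤-reflexive (identity (ι 2) m)
    where
    identity : ∀ t m → t * ((1ℚ + 0ℚ) * 1ℚ) + m * 1ℚ ≡ (t + m) * 1ℚ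
    identity = solve-∀ ℚ-ring
  bernoulli (suc k) = ℚ.≤-trans
    (≤-byDiff (identity (ι 2) m (ι k) (m ^ k))
      (0≤* (0≤* (0≤ι 2) (0≤ι 2)) (0≤* (0≤ι (suc k)) (0≤^ k 0≤m))))
    (*-monoˡ (0≤+ (0≤ι 2) 0≤m) (bernoulli k))
    where
    identity : ∀ t m κ M →
      (t + m) * (t * ((1ℚ + κ) * M) + m * M) - (t * ((1ℚ + (1ℚ + κ)) * (m * M)) + m * (m * M)) ≡
      t * t * ((1ℚ + κ) * M)
    identity = solve-∀ ℚ-ring

-- Every reduced word is a rearrangement of a listed signed set

index∈ : Letter N → Fin N → Set
index∈ skip    x = ⊥
index∈ (pos i) x = i ≡ x
index∈ (neg i) x = i ≡ x

Fresh : Fin N → Word N → Set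
Fresh x = All.All (λ l → ¬ index∈ l x)

fresh⇒∉ : ∀ {x : Fin N} {w} → Fresh x w → x ∉ support w
fresh⇒∉ {w = []}        []      x∈ = ∉⊥ x∈
fresh⇒∉ {w = skip ∷ w}  (_ ∷ f) x∈ = fresh⇒∉ f x∈
fresh⇒∉ {w = pos i ∷ w} (n ∷ f) x∈ with ∈-insert⁻ x∈
... | inj₁ refl = n refl
... | inj₂ h    = fresh⇒∉ f h
fresh⇒∉ {w = neg i ∷ w} (n ∷ f) x∈ with ∈-insert⁻ x∈
... | inj₁ refl = n refl
... | inj₂ h    = fresh⇒∉ f h

∉⇒fresh : ∀ {x : Fin N} w → x ∉ support w → Fresh x w
∉⇒fresh []          _ = []
∉⇒fresh (skip ∷ w)  n = (λ ()) ∷ ∉⇒fresh w n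
∉⇒fresh (pos i ∷ w) n = (λ { refl → n (∈-insert i (support w)) }) ∷ ∉⇒fresh w (n ∘ ∈-insert⁺)
∉⇒fresh (neg i ∷ w) n = (λ { refl → n (∈-insert i (support w)) }) ∷ ∉⇒fresh w (n ∘ ∈-insert⁺)

Signed : Fin N → Letter N → Set
Signed x l = l ≡ pos x ⊎ l ≡ neg x

module _ {y : Fin N} {ys : List (Fin N)} where
  signedSets-skip : ∀ k {v} → v ∈ˡ signedSets ys k → v ∈ˡ signedSets (y ∷ ys) k
  signedSets-skip zero    v∈ = v∈
  signedSets-skip (suc k) v∈ = Mem.∈-++⁺ʳ (List.map (pos y ∷_) (signedSets ys k))
    (Mem.∈-++⁺ʳ (List.map (neg y ∷_) (signedSets ys k)) v∈)

  signedSets-take : ∀ k {l v} → Signed y l → v ∈ˡ signedSets ys k → l ∷ v ∈ˡ signedSets (y ∷ ys) (suc k)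
  signedSets-take k (inj₁ refl) v∈ = Mem.∈-++⁺ˡ (Mem.∈-map⁺ (pos y ∷_) v∈)
  signedSets-take k (inj₂ refl) v∈ = Mem.∈-++⁺ʳ (List.map (pos y ∷_) (signedSets ys k))
    (Mem.∈-++⁺ˡ (Mem.∈-map⁺ (neg y ∷_) v∈))

  signedSets⁻ : ∀ k {v} → v ∈ˡ signedSets (y ∷ ys) k → v ∈ˡ signedSets ys k ⊎
    ∃ λ j → ∃₂ λ l u → k ≡ suc j × v ≡ l ∷ u × Signed y l × u ∈ˡ signedSets ys j
  signedSets⁻ zero    v∈ = inj₁ v∈
  signedSets⁻ (suc k) v∈ with Mem.∈-++⁻ (List.map (pos y ∷_) (signedSets ys k)) v∈
  ... | inj₁ h =
    let u , u∈ , eq = Mem.∈-map⁻ (pos y ∷_) h in inj₂ (k , pos y , u , refl , eq , inj₁ refl , u∈)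
  ... | inj₂ h with Mem.∈-++⁻ (List.map (neg y ∷_) (signedSets ys k)) h
  ...   | inj₂ h′ = inj₁ h′
  ...   | inj₁ h′ =
    let u , u∈ , eq = Mem.∈-map⁻ (neg y ∷_) h′ in inj₂ (k , neg y , u , refl , eq , inj₂ refl , u∈)

signedSets-length : ∀ (xs : List (Fin N)) k {w} → w ∈ˡ signedSets xs k → length w ≡ k
signedSets-length []       zero (Any.here refl) = refl
signedSets-length (x ∷ xs) k    w∈ with signedSets⁻ k w∈
... | inj₁ h                                   = signedSets-length xs k h
... | inj₂ (j , l , u , refl , refl , _ , u∈) = cong suc (signedSets-length xs j u∈)

signedSets-fresh : ∀ {x : Fin N} xs k → All.All (x ≢_) xs → ∀ {w} → w ∈ˡ signedSets xs k → Fresh x w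
signedSets-fresh []       zero []        (Any.here refl) = []
signedSets-fresh (y ∷ xs) k    (x≢y ∷ n) w∈ with signedSets⁻ k w∈
... | inj₁ h                                            = signedSets-fresh xs k n h
... | inj₂ (j , _ , u , refl , refl , inj₁ refl , u∈) = (x≢y ∘ sym) ∷ signedSets-fresh xs j n u∈
... | inj₂ (j , _ , u , refl , refl , inj₂ refl , u∈) = (x≢y ∘ sym) ∷ signedSets-fresh xs j n u∈

signedSets-reduced : ∀ {xs : List (Fin N)} k → Unique xs → ∀ {w} → w ∈ˡ signedSets xs k → Reduced w
signedSets-reduced {xs = []}     zero []      (Any.here refl) = []
signedSets-reduced {xs = x ∷ xs} k    (n ∷ u) w∈ with signedSets⁻ k w∈
... | inj₁ h = signedSets-reduced k u h
... | inj₂ (j , _ , v , refl , refl , inj₁ refl , v∈) =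
  pos (fresh⇒∉ (signedSets-fresh xs j n v∈)) (signedSets-reduced j u v∈)
... | inj₂ (j , _ , v , refl , refl , inj₂ refl , v∈) =
  neg (fresh⇒∉ (signedSets-fresh xs j n v∈)) (signedSets-reduced j u v∈)

-- One step of insertion sort, with the order prescribed by `xs`. Freshness of `x` excludes the case
-- in which its place is already taken.
signedSets-insert : ∀ {x : Fin N} {xs} k → x ∈ˡ xs → ∀ {l} → Signed x l →
  ∀ {v} → v ∈ˡ signedSets xs k → Fresh x v → ∃ λ v′ → v′ ∈ˡ signedSets xs (suc k) × v′ ↭ l ∷ v
signedSets-insert k (Any.here refl) {l} s {v} v∈ f with signedSets⁻ k v∈
... | inj₁ h = l ∷ v , signedSets-take k s h , ↭-refl
... | inj₂ (j , _ , u , refl , refl , inj₁ refl , u∈) = contradiction refl (All.head f)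
... | inj₂ (j , _ , u , refl , refl , inj₂ refl , u∈) = contradiction refl (All.head f)
signedSets-insert {xs = _ ∷ ys} k (Any.there x∈) {l} s v∈ f with signedSets⁻ k v∈
... | inj₁ h =
  let v′ , v′∈ , p = signedSets-insert k x∈ s h f in v′ , signedSets-skip (suc k) v′∈ , p
... | inj₂ (j , t , u , refl , refl , s′ , u∈) =
  let u′ , u′∈ , p = signedSets-insert j x∈ s u∈ (All.tail f)
  in t ∷ u′ , signedSets-take {ys = ys} (suc j) s′ u′∈ , ↭-trans (prep t p) (swap t l ↭-refl)

signedSets-complete : ∀ {w : Word N} → Reduced w → ∃ λ v → v ∈ˡ signedSets (allFin N) (length w) × v ↭ w
signedSets-complete {N} []  = [] , Any.here refl , ↭-refl
signedSets-complete {w = pos x ∷ w} (pos n r) with signedSets-complete r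
... | v , v∈ , p with signedSets-insert (length w) (∈-allFin x) (inj₁ refl) v∈ (All-resp-↭ (↭-sym p) (∉⇒fresh w n))
...   | v′ , v′∈ , p′ = v′ , v′∈ , ↭-trans p′ (prep (pos x) p)
signedSets-complete {w = neg x ∷ w} (neg n r) with signedSets-complete r
... | v , v∈ , p with signedSets-insert (length w) (∈-allFin x) (inj₂ refl) v∈ (All-resp-↭ (↭-sym p) (∉⇒fresh w n))
...   | v′ , v′∈ , p′ = v′ , v′∈ , ↭-trans p′ (prep (neg x) p)

-- Weighted sums over words

∑-tabulate : ∀ {a} {A : Set a} {n} (g : Fin n → A) (f : A → ℚ) → ∑ (List.tabulate g) f ≡ ∑ (allFin n) (f ∘ g)
∑-tabulate {n = n} g f = trans (cong (λ xs → ∑ xs f) (sym (map-tabulate {n = n} id g))) (∑-map g (allFin n) f)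

∑-∈ : ∀ {n} (A : Subset n) → ∑ (allFin n) (λ i → 𝟙 (i ∈? A)) ≡ ι Subset.∣ A ∣
∑-∈ []            = refl
∑-∈ {suc n} (x ∷ A) = trans (cong (𝟙 (zero ∈? (x ∷ A)) +_) tail) (head x)
  where
  tail : ∑ (List.tabulate suc) (λ i → 𝟙 (i ∈? (x ∷ A))) ≡ ι Subset.∣ A ∣
  tail = trans (∑-tabulate suc (λ i → 𝟙 (i ∈? (x ∷ A))))
    (trans (∑-cong (allFin n) (λ i → 𝟙-cong (suc i ∈? (x ∷ A)) (i ∈? A) (λ { (there h) → h }) there)) (∑-∈ A))
  head : ∀ x → 𝟙 (zero ∈? (x ∷ A)) + ι Subset.∣ A ∣ ≡ ι Subset.∣ x ∷ A ∣
  head inside  = refl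
  head outside = ℚ.+-identityˡ (ι Subset.∣ A ∣)

length-allFin : ∀ n → length (allFin n) ≡ n
length-allFin n = length-tabulate id

0≤1+2ι : ∀ n → 0ℚ ≤ 1ℚ + ι 2 * ι n
0≤1+2ι n = 0≤+ 0≤1 (0≤* (0≤ι 2) (0≤ι n))

module LetterWeights (p : ℚ) (0≤p : 0ℚ ≤ p) (p≤1 : p ≤ 1ℚ) {N : ℕ} where
  open ℚ.≤-Reasoning

  alphabet : List (Letter N)
  alphabet = letters (allFin N)

  -- `weight′ A l` is the factor by which including `l` changes `p` to the power of the size of `A`.
  old new weight′ : Subset N → Letter N → ℚ
  old A l     = 𝟙 (old? A l)
  new A l     = 1ℚ - old A l
  weight′ A l = old A l + p * new A l

  data Bit (a : ℚ) : Set where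
    zeroBit : a ≡ 0ℚ → Bit a
    oneBit  : a ≡ 1ℚ → Bit a

  old-bit : ∀ A l → Bit (old A l)
  old-bit A l with old? A l
  ... | yes _ = oneBit refl
  ... | no  _ = zeroBit refl

  0≤old : ∀ A l → 0ℚ ≤ old A l
  0≤old A l = 0≤𝟙 (old? A l)

  0≤new : ∀ A l → 0ℚ ≤ new A l
  0≤new A l = ≤⇒0≤- (𝟙≤1 (old? A l))

  new≤1 : ∀ A l → new A l ≤ 1ℚ
  new≤1 A l = -nonneg≤ (0≤old A l)

  0≤weight′ : ∀ A l → 0ℚ ≤ weight′ A l
  0≤weight′ A l = 0≤+ (0≤old A l) (0≤* 0≤p (0≤new A l))

  weight′≤1 : ∀ A l → weight′ A l ≤ 1ℚ
  weight′≤1 A l = ≤-byDiff (identity p (old A l)) (0≤* (≤⇒0≤- p≤1) (0≤new A l))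
    where
    identity : ∀ p a → 1ℚ - (a + p * (1ℚ - a)) ≡ (1ℚ - p) * (1ℚ - a)
    identity = solve-∀ ℚ-ring

  old-sum : ∀ A → ∑ alphabet (old A) ≡ 1ℚ + ι 2 * ι Subset.∣ A ∣
  old-sum A = trans (∑-letters (allFin N) (old A))
    (trans (cong (λ s → 1ℚ + (s + s)) (∑-∈ A)) (identity (ι Subset.∣ A ∣)))
    where
    identity : ∀ a → 1ℚ + (a + a) ≡ 1ℚ + (1ℚ + (1ℚ + 0ℚ)) * a
    identity = solve-∀ ℚ-ring

  weight′-sum : ∀ A → ∑ alphabet (weight′ A) ≤ 1ℚ + ι 2 * ι Subset.∣ A ∣ + ι 2 * (p * ι N)
  weight′-sum A = begin
    ∑ alphabet (weight′ A)
      ≡⟨ ∑-letters (allFin N) (weight′ A) ⟩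
    (1ℚ + p * (1ℚ - 1ℚ)) + (∑ (allFin N) (weight′ A ∘ pos) + ∑ (allFin N) (weight′ A ∘ neg))
      ≤⟨ ℚ.+-monoʳ-≤ (1ℚ + p * (1ℚ - 1ℚ)) (ℚ.+-mono-≤ half half) ⟩
    (1ℚ + p * (1ℚ - 1ℚ)) + ((ι Subset.∣ A ∣ + ι N * p) + (ι Subset.∣ A ∣ + ι N * p))
      ≡⟨ identity p (ι Subset.∣ A ∣) (ι N) ⟩
    1ℚ + ι 2 * ι Subset.∣ A ∣ + ι 2 * (p * ι N) ∎
    where
    half : ∑ (allFin N) (λ i → 𝟙 (i ∈? A) + p * (1ℚ - 𝟙 (i ∈? A))) ≤ ι Subset.∣ A ∣ + ι N * p
    half = begin
      ∑ (allFin N) (λ i → 𝟙 (i ∈? A) + p * (1ℚ - 𝟙 (i ∈? A)))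
        ≤⟨ ∑-mono (allFin N) (λ i → ℚ.+-monoʳ-≤ (𝟙 (i ∈? A)) (*≤1≤ 0≤p (-nonneg≤ (0≤𝟙 (i ∈? A))))) ⟩
      ∑ (allFin N) (λ i → 𝟙 (i ∈? A) + p)
        ≡⟨ ∑-+ (allFin N) (λ i → 𝟙 (i ∈? A)) (λ _ → p) ⟩
      ∑ (allFin N) (λ i → 𝟙 (i ∈? A)) + ∑ (allFin N) (λ _ → p)
        ≡⟨ cong₂ _+_ (∑-∈ A) (trans (∑-const (allFin N) p) (cong (λ n → ι n * p) (length-allFin N))) ⟩
      ι Subset.∣ A ∣ + ι N * p ∎
    identity : ∀ p a n → (1ℚ + p * (1ℚ - 1ℚ)) + ((a + n * p) + (a + n * p)) ≡
      1ℚ + (1ℚ + (1ℚ + 0ℚ)) * a + (1ℚ + (1ℚ + 0ℚ)) * (p * n)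
    identity = solve-∀ ℚ-ring

  -- d bounds the sizes of the sets relative to which letters count as old.
  module Sums (d : ℕ) (W : ℚ) (W-bound : 1ℚ + ι 2 * ι d + ι 2 * (p * ι N) ≤ W) where

    -- The largest possible number of letters that are old relative to a set of at most `d`
    -- elements: `skip`, and two signs for each element.
    O : ℚ
    O = 1ℚ + ι 2 * ι d

    0≤O : 0ℚ ≤ O
    0≤O = 0≤1+2ι d

    0≤2pN : 0ℚ ≤ ι 2 * (p * ι N)
    0≤2pN = 0≤* (0≤ι 2) (0≤* 0≤p (0≤ι N))

    O≤W : O ≤ W
    O≤W = ℚ.≤-trans (≤+nonneg 0≤2pN) W-bound

    0≤W : 0ℚ ≤ W
    0≤W = ℚ.≤-trans 0≤O O≤W

    old-sum≤ : ∀ A → Subset.∣ A ∣ ℕ.≤ d → ∑ alphabet (old A) ≤ O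
    old-sum≤ A h = subst (_≤ O) (sym (old-sum A)) (ℚ.+-monoʳ-≤ 1ℚ (*-monoˡ (0≤ι 2) (ι-mono h)))

    weight′-sum≤ : ∀ A → Subset.∣ A ∣ ℕ.≤ d → ∑ alphabet (weight′ A) ≤ W
    weight′-sum≤ A h = ℚ.≤-trans (weight′-sum A)
      (ℚ.≤-trans (ℚ.+-monoˡ-≤ (ι 2 * (p * ι N)) (ℚ.+-monoʳ-≤ 1ℚ (*-monoˡ (0≤ι 2) (ι-mono h)))) W-bound)

    vocabulary : ℕ → List (Word N)
    vocabulary = words (allFin N)

    mass : Word N → ℚ
    mass w = p ^ Subset.∣ support w ∣

    0≤mass : ∀ w → 0ℚ ≤ mass w
    0≤mass w = 0≤^ Subset.∣ support w ∣ 0≤p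

    mass-∷ : ∀ l w → mass (l ∷ w) ≡ weight′ (support w) l * mass w
    mass-∷ skip w = identity p (mass w)
      where
      identity : ∀ p m → m ≡ (1ℚ + p * (1ℚ - 1ℚ)) * m
      identity = solve-∀ ℚ-ring
    mass-∷ (pos i) w with i ∈? support w
    ... | yes h = trans (cong (p ^_) (∣insert∣-∈ h)) (identity p (mass w))
      where
      identity : ∀ p m → m ≡ (1ℚ + p * (1ℚ - 1ℚ)) * m
      identity = solve-∀ ℚ-ring
    ... | no h = trans (cong (p ^_) (∣insert∣-∉ h)) (identity p (mass w))
      where
      identity : ∀ p m → p * m ≡ (0ℚ + p * (1ℚ - 0ℚ)) * m
      identity = solve-∀ ℚ-ring
    mass-∷ (neg i) w = mass-∷ (pos i) w

    old-weight′ : ∀ A l → old A l * weight′ A l ≡ old A l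
    old-weight′ A l = go (old A l) (old-bit A l)
      where
      identity₀ : ∀ p → 0ℚ * (0ℚ + p * (1ℚ - 0ℚ)) ≡ 0ℚ
      identity₀ = solve-∀ ℚ-ring
      identity₁ : ∀ p → 1ℚ * (1ℚ + p * (1ℚ - 1ℚ)) ≡ 1ℚ
      identity₁ = solve-∀ ℚ-ring
      go : ∀ a → Bit a → a * (a + p * (1ℚ - a)) ≡ a
      go _ (zeroBit refl) = identity₀ p
      go _ (oneBit refl)  = identity₁ p

    private
      support-small : ∀ k → k ℕ.≤ d → ∀ w → w ∈ˡ vocabulary k → Subset.∣ support w ∣ ℕ.≤ d
      support-small k k≤d w w∈ = ℕ.≤-trans (∣support∣≤ w)
        (ℕ.≤-trans (ℕ.≤-reflexive (words-length (allFin N) k w∈)) k≤d)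

    -- The letters are exposed one after the other; relative to what is already present, each
    -- position has total weight at most `W`.
    mass-total : ∀ k → k ℕ.≤ d → ∑ (vocabulary k) mass ≤ W ^ k
    mass-total zero    _ = ℚ.≤-reflexive (trans (ℚ.+-identityʳ (p ^ Subset.∣ Subset.⊥ {N} ∣)) (cong (p ^_) (∣⊥∣≡0 N)))
    mass-total (suc k) k<d = begin
      ∑ (vocabulary (suc k)) mass
        ≡⟨ ∑-words (allFin N) k mass ⟩
      ∑ alphabet (λ l → ∑ (vocabulary k) (λ w → mass (l ∷ w)))
        ≡⟨ ∑-swap alphabet (vocabulary k) (λ l w → mass (l ∷ w)) ⟩
      ∑ (vocabulary k) (λ w → ∑ alphabet (λ l → mass (l ∷ w)))
        ≡⟨ ∑-cong (vocabulary k) (λ w → trans (∑-cong alphabet (λ l → mass-∷ l w)) (∑-*ʳ alphabet (mass w) (weight′ (support w)))) ⟩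
      ∑ (vocabulary k) (λ w → ∑ alphabet (weight′ (support w)) * mass w)
        ≤⟨ ∑-mono-∈ (vocabulary k) (λ w w∈ → *-monoʳ (0≤mass w)
             (weight′-sum≤ (support w) (support-small k (ℕ.<⇒≤ k<d) w w∈))) ⟩
      ∑ (vocabulary k) (λ w → W * mass w)
        ≡⟨ ∑-*ˡ (vocabulary k) W mass ⟩
      W * ∑ (vocabulary k) mass
        ≤⟨ *-monoˡ 0≤W (mass-total k (ℕ.<⇒≤ k<d)) ⟩
      W * W ^ k ∎

    -- In the counted position only old letters occur, so a factor `W` is replaced by `O`, and there
    -- are `k` positions. The extra factor `W` on the left avoids the exponent `k - 1`; the later
    -- totals use the same device.
    repeats-total : ∀ k → k ℕ.≤ d → W * ∑ (vocabulary k) (λ w → repeats w * mass w) ≤ ι k * O * W ^ k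
    repeats-total zero _ = ℚ.≤-reflexive (identity W (mass []) O)
      where
      identity : ∀ W m O → W * (0ℚ * m + 0ℚ) ≡ 0ℚ * O * 1ℚ
      identity = solve-∀ ℚ-ring
    repeats-total (suc k) k<d = begin
      W * ∑ (vocabulary (suc k)) (λ w → repeats w * mass w)
        ≡⟨ cong (W *_) (trans (∑-words (allFin N) k (λ w → repeats w * mass w))
             (∑-swap alphabet (vocabulary k) (λ l w → repeats (l ∷ w) * mass (l ∷ w)))) ⟩
      W * ∑ (vocabulary k) (λ w → ∑ alphabet (λ l → repeats (l ∷ w) * mass (l ∷ w)))
        ≤⟨ *-monoˡ 0≤W (∑-mono-∈ (vocabulary k) inner) ⟩
      W * ∑ (vocabulary k) (λ w → O * mass w + W * (repeats w * mass w))
        ≡⟨ cong (W *_) (trans (∑-+ (vocabulary k) (λ w → O * mass w) (λ w → W * (repeats w * mass w)))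
             (cong₂ _+_ (∑-*ˡ (vocabulary k) O mass) (∑-*ˡ (vocabulary k) W (λ w → repeats w * mass w)))) ⟩
      W * (O * ∑ (vocabulary k) mass + W * ∑ (vocabulary k) (λ w → repeats w * mass w))
        ≤⟨ *-monoˡ 0≤W (ℚ.+-mono-≤ (*-monoˡ 0≤O (mass-total k (ℕ.<⇒≤ k<d))) (repeats-total k (ℕ.<⇒≤ k<d))) ⟩
      W * (O * W ^ k + ι k * O * W ^ k)
        ≡⟨ identity W O (W ^ k) (ι k) ⟩
      (1ℚ + ι k) * O * (W * W ^ k) ∎
      where
      inner : ∀ w → w ∈ˡ vocabulary k →
        ∑ alphabet (λ l → repeats (l ∷ w) * mass (l ∷ w)) ≤ O * mass w + W * (repeats w * mass w)
      inner w w∈ = begin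
        ∑ alphabet (λ l → repeats (l ∷ w) * mass (l ∷ w))
          ≡⟨ ∑-cong alphabet (λ l → trans (cong (repeats (l ∷ w) *_) (mass-∷ l w))
               (trans (expand (old (support w) l) (repeats w) (weight′ (support w) l) (mass w))
                 (cong (λ z → z * mass w + weight′ (support w) l * (repeats w * mass w)) (old-weight′ (support w) l)))) ⟩
        ∑ alphabet (λ l → old (support w) l * mass w + weight′ (support w) l * (repeats w * mass w))
          ≡⟨ trans (∑-+ alphabet (λ l → old (support w) l * mass w) (λ l → weight′ (support w) l * (repeats w * mass w)))
               (cong₂ _+_ (∑-*ʳ alphabet (mass w) (old (support w)))
                          (∑-*ʳ alphabet (repeats w * mass w) (weight′ (support w)))) ⟩
        ∑ alphabet (old (support w)) * mass w + ∑ alphabet (weight′ (support w)) * (repeats w * mass w)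
          ≤⟨ ℚ.+-mono-≤ (*-monoʳ (0≤mass w) (old-sum≤ (support w) small))
               (*-monoʳ (0≤* (0≤repeats w) (0≤mass w)) (weight′-sum≤ (support w) small)) ⟩
        O * mass w + W * (repeats w * mass w) ∎
        where
        small = support-small k (ℕ.<⇒≤ k<d) w w∈
        expand : ∀ a r t m → (a + r) * (t * m) ≡ a * t * m + t * (r * m)
        expand = solve-∀ ℚ-ring
      identity : ∀ W O X κ → W * (O * X + κ * O * X) ≡ (1ℚ + κ) * O * (W * X)
      identity = solve-∀ ℚ-ring

    allOldIn : Subset N → Word N → ℚ
    allOldIn A []      = 1ℚ
    allOldIn A (l ∷ w) = old A l * allOldIn A w

    module Relative (A : Subset N) (∣A∣≤d : Subset.∣ A ∣ ℕ.≤ d) where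
      -- For a reduced word, `ω` is `p` to the number of elements of its support outside `A`. For
      -- other words every occurrence of a new letter is charged, which keeps `ω` a product over
      -- positions.
      ω olds news : Word N → ℚ
      ω []           = 1ℚ
      ω (l ∷ w)      = weight′ A l * ω w
      olds []        = 0ℚ
      olds (l ∷ w)   = old A l + olds w
      news []        = 0ℚ
      news (l ∷ w)   = new A l + news w

      allOld : Word N → ℚ
      allOld = allOldIn A

      0≤ω : ∀ w → 0ℚ ≤ ω w
      0≤ω []      = 0≤1
      0≤ω (l ∷ w) = 0≤* (0≤weight′ A l) (0≤ω w)

      ω≤1 : ∀ w → ω w ≤ 1ℚ
      ω≤1 []      = ℚ.≤-refl
      ω≤1 (l ∷ w) = ℚ.≤-trans (*≤1≤ (0≤weight′ A l) (ω≤1 w)) (weight′≤1 A l)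

      0≤olds : ∀ w → 0ℚ ≤ olds w
      0≤olds []      = ℚ.≤-refl
      0≤olds (l ∷ w) = 0≤+ (0≤old A l) (0≤olds w)

      0≤news : ∀ w → 0ℚ ≤ news w
      0≤news []      = ℚ.≤-refl
      0≤news (l ∷ w) = 0≤+ (0≤new A l) (0≤news w)

      0≤allOld : ∀ w → 0ℚ ≤ allOld w
      0≤allOld []      = 0≤1
      0≤allOld (l ∷ w) = 0≤* (0≤old A l) (0≤allOld w)

      olds≤ : ∀ w → olds w ≤ ι (length w)
      olds≤ []      = ℚ.≤-refl
      olds≤ (l ∷ w) = ℚ.+-mono-≤ (𝟙≤1 (old? A l)) (olds≤ w)

      new⊎allOld : ∀ w → 1ℚ ≤ news w + allOld w
      new⊎allOld []      = ℚ.≤-refl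
      new⊎allOld (l ∷ w) = go (old A l) (old-bit A l)
        where
        go : ∀ a → Bit a → 1ℚ ≤ ((1ℚ - a) + news w) + a * allOld w
        go _ (oneBit refl)  = subst (1ℚ ≤_) (identity (news w) (allOld w)) (new⊎allOld w)
          where
          identity : ∀ n o → n + o ≡ ((1ℚ - 1ℚ) + n) + 1ℚ * o
          identity = solve-∀ ℚ-ring
        go _ (zeroBit refl) = ≤-byDiff (identity (news w) (allOld w)) (0≤news w)
          where
          identity : ∀ n o → ((1ℚ - 0ℚ) + n) + 0ℚ * o - 1ℚ ≡ n
          identity = solve-∀ ℚ-ring

      -- Either the word has a new letter, and then that letter can be recovered from the product of
      -- the word; or all letters come from `A`, and there are few such words altogether.
      olds-split : ∀ w → olds w * ω w ≤ olds w * news w * ω w + ι (length w) * allOld w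
      olds-split w = begin
        olds w * ω w
          ≤⟨ ≤*1≤ (0≤* (0≤olds w) (0≤ω w)) (new⊎allOld w) ⟩
        olds w * ω w * (news w + allOld w)
          ≡⟨ identity (olds w) (ω w) (news w) (allOld w) ⟩
        olds w * news w * ω w + olds w * (ω w * allOld w)
          ≤⟨ ℚ.+-monoʳ-≤ (olds w * news w * ω w) (*-mono (0≤ι (length w)) (0≤* (0≤ω w) (0≤allOld w)) (olds≤ w)
               (subst (ω w * allOld w ≤_) (ℚ.*-identityˡ (allOld w)) (*-monoʳ (0≤allOld w) (ω≤1 w)))) ⟩
        olds w * news w * ω w + ι (length w) * allOld w ∎
        where
        identity : ∀ o t n a → o * t * (n + a) ≡ o * n * t + o * (t * a)
        identity = solve-∀ ℚ-ring

      ω-total : ∀ k → ∑ (vocabulary k) ω ≤ W ^ k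
      ω-total zero    = ℚ.≤-reflexive (ℚ.+-identityʳ 1ℚ)
      ω-total (suc k) = begin
        ∑ (vocabulary (suc k)) ω
          ≡⟨ trans (∑-words (allFin N) k ω) (trans (∑-cong alphabet (λ l → ∑-*ˡ (vocabulary k) (weight′ A l) ω))
               (∑-*ʳ alphabet (∑ (vocabulary k) ω) (weight′ A))) ⟩
        ∑ alphabet (weight′ A) * ∑ (vocabulary k) ω
          ≤⟨ *-mono 0≤W (0≤∑ (vocabulary k) 0≤ω) (weight′-sum≤ A ∣A∣≤d) (ω-total k) ⟩
        W * W ^ k ∎

      allOld-total : ∀ k → ∑ (vocabulary k) allOld ≤ O ^ k
      allOld-total zero    = ℚ.≤-reflexive (ℚ.+-identityʳ 1ℚ)
      allOld-total (suc k) = begin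
        ∑ (vocabulary (suc k)) allOld
          ≡⟨ trans (∑-words (allFin N) k allOld) (trans (∑-cong alphabet (λ l → ∑-*ˡ (vocabulary k) (old A l) allOld))
               (∑-*ʳ alphabet (∑ (vocabulary k) allOld) (old A))) ⟩
        ∑ alphabet (old A) * ∑ (vocabulary k) allOld
          ≤⟨ *-mono 0≤O (0≤∑ (vocabulary k) 0≤allOld) (old-sum≤ A ∣A∣≤d) (allOld-total k) ⟩
        O * O ^ k ∎

      olds-total : ∀ k → W * ∑ (vocabulary k) (λ w → olds w * ω w) ≤ ι k * O * W ^ k
      olds-total zero = ℚ.≤-reflexive (identity W O)
        where
        identity : ∀ W O → W * (0ℚ * 1ℚ + 0ℚ) ≡ 0ℚ * O * 1ℚ
        identity = solve-∀ ℚ-ring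
      olds-total (suc k) = begin
        W * ∑ (vocabulary (suc k)) (λ w → olds w * ω w)
          ≡⟨ cong (W *_) (trans (∑-words (allFin N) k (λ w → olds w * ω w)) (∑-cong alphabet inner)) ⟩
        W * ∑ alphabet (λ l → old A l * U + weight′ A l * C)
          ≡⟨ cong (W *_) (trans (∑-+ alphabet (λ l → old A l * U) (λ l → weight′ A l * C))
               (cong₂ _+_ (∑-*ʳ alphabet U (old A)) (∑-*ʳ alphabet C (weight′ A)))) ⟩
        W * (∑ alphabet (old A) * U + ∑ alphabet (weight′ A) * C)
          ≤⟨ *-monoˡ 0≤W (ℚ.+-mono-≤
               (*-mono 0≤O (0≤∑ (vocabulary k) 0≤ω) (old-sum≤ A ∣A∣≤d) (ω-total k))
               (ℚ.≤-trans (*-monoʳ (0≤∑ (vocabulary k) (λ w → 0≤* (0≤olds w) (0≤ω w))) (weight′-sum≤ A ∣A∣≤d))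
                          (olds-total k))) ⟩
        W * (O * W ^ k + ι k * O * W ^ k)
          ≡⟨ identity W O (W ^ k) (ι k) ⟩
        (1ℚ + ι k) * O * (W * W ^ k) ∎
        where
        U = ∑ (vocabulary k) ω
        C = ∑ (vocabulary k) (λ w → olds w * ω w)
        inner : ∀ l → ∑ (vocabulary k) (λ w → (old A l + olds w) * (weight′ A l * ω w)) ≡ old A l * U + weight′ A l * C
        inner l = trans (∑-cong (vocabulary k) (λ w → trans (expand (old A l) (olds w) (weight′ A l) (ω w))
            (cong (λ z → z * ω w + weight′ A l * (olds w * ω w)) (old-weight′ A l))))
          (trans (∑-+ (vocabulary k) (λ w → old A l * ω w) (λ w → weight′ A l * (olds w * ω w)))
            (cong₂ _+_ (∑-*ˡ (vocabulary k) (old A l) ω) (∑-*ˡ (vocabulary k) (weight′ A l) (λ w → olds w * ω w))))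
          where
          expand : ∀ a r t m → (a + r) * (t * m) ≡ a * t * m + t * (r * m)
          expand = solve-∀ ℚ-ring
        identity : ∀ W O X κ → W * (O * X + κ * O * X) ≡ (1ℚ + κ) * O * (W * X)
        identity = solve-∀ ℚ-ring

      overlap≤olds : ∀ {w} → Reduced w → ι Subset.∣ A Subset.∩ support w ∣ ≤ olds w
      overlap≤olds [] = ℚ.≤-trans (ι-mono (∣p∩q∣≤∣q∣ A Subset.⊥)) (ℚ.≤-reflexive (cong ι (∣⊥∣≡0 N)))
      overlap≤olds {w = l ∷ w} (pos {i} n r) = ℚ.≤-trans (∣∩insert∣≤ A i (support w))
        (ℚ.+-monoʳ-≤ (𝟙 (i ∈? A)) (overlap≤olds r))
      overlap≤olds {w = l ∷ w} (neg {i} n r) = ℚ.≤-trans (∣∩insert∣≤ A i (support w))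
        (ℚ.+-monoʳ-≤ (𝟙 (i ∈? A)) (overlap≤olds r))

      private
        union-mass-∷ : ∀ i w → i ∉ support w →
          p ^ Subset.∣ A Subset.∪ support w ∣ ≡ p ^ Subset.∣ A ∣ * ω w →
          p ^ Subset.∣ A Subset.∪ insert i (support w) ∣ ≡ p ^ Subset.∣ A ∣ * (weight′ A (pos i) * ω w)
        union-mass-∷ i w n ih with i ∈? A
        ... | yes i∈A = trans (cong (λ B → p ^ Subset.∣ B ∣) (∪-insert A i (support w)))
          (trans (cong (p ^_) (∣insert∣-∈ (x∈p∪q⁺ {q = support w} (inj₁ i∈A))))
            (trans ih (identity p (p ^ Subset.∣ A ∣) (ω w))))
          where
          identity : ∀ p a m → a * m ≡ a * ((1ℚ + p * (1ℚ - 1ℚ)) * m)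
          identity = solve-∀ ℚ-ring
        ... | no  i∉A = trans (cong (λ B → p ^ Subset.∣ B ∣) (∪-insert A i (support w)))
          (trans (cong (p ^_) (∣insert∣-∉ ([ i∉A , n ]′ ∘ x∈p∪q⁻ A (support w))))
            (trans (cong (p *_) ih) (identity p (p ^ Subset.∣ A ∣) (ω w))))
          where
          identity : ∀ p a m → p * (a * m) ≡ a * ((0ℚ + p * (1ℚ - 0ℚ)) * m)
          identity = solve-∀ ℚ-ring

      union-mass : ∀ {w} → Reduced w → p ^ Subset.∣ A Subset.∪ support w ∣ ≡ p ^ Subset.∣ A ∣ * ω w
      union-mass [] = trans (cong (λ B → p ^ Subset.∣ B ∣) (∪-identityʳ A)) (sym (ℚ.*-identityʳ (p ^ Subset.∣ A ∣)))
      union-mass {pos i ∷ w} (pos n r) = union-mass-∷ i w n (union-mass r)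
      union-mass {neg i ∷ w} (neg n r) = union-mass-∷ i w n (union-mass r)

      -- In a reduced word no element is counted twice, so the intersection and the union with `A`
      -- can be read off letter by letter.
      κ≤ : ∀ {w} → Reduced w → Covariance.κ p 0≤p p≤1 A (support w) ≤ p ^ Subset.∣ A ∣ * (olds w * ω w)
      κ≤ {w} r = begin
        ι Subset.∣ A Subset.∩ support w ∣ * p ^ Subset.∣ A Subset.∪ support w ∣
          ≡⟨ cong (ι Subset.∣ A Subset.∩ support w ∣ *_) (union-mass r) ⟩
        ι Subset.∣ A Subset.∩ support w ∣ * (p ^ Subset.∣ A ∣ * ω w)
          ≤⟨ *-monoʳ (0≤* (0≤^ Subset.∣ A ∣ 0≤p) (0≤ω w)) (overlap≤olds r) ⟩
        olds w * (p ^ Subset.∣ A ∣ * ω w)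
          ≡⟨ identity (olds w) (p ^ Subset.∣ A ∣) (ω w) ⟩
        p ^ Subset.∣ A ∣ * (olds w * ω w) ∎
        where
        identity : ∀ a b c → a * (b * c) ≡ b * (a * c)
        identity = solve-∀ ℚ-ring

-- Words evaluated in the group

module Evaluation {c ℓ : Level} {N : ℕ} (G : AbelianGroupOfOrder c ℓ N) where
  open AbelianGroupOfOrder G
  open AbelianGroup group using (ε; assoc; comm; identityˡ; identityʳ; inverseˡ; inverseʳ)
  private module ≈-Reasoning = SetoidReasoning carrierSetoid

  value : Letter N → Carrier
  value skip    = ε
  value (pos i) = element i
  value (neg i) = element i ⁻¹

  product : Word N → Carrier
  product []      = ε
  product (l ∷ w) = value l ∙ product w

  product-↭ : ∀ {v w} → v ↭ w → product v ≈ product w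
  product-↭ Perm.refl         = ≈-refl
  product-↭ (prep l p)        = ∙-cong ≈-refl (product-↭ p)
  product-↭ (swap {xs} {ys} k l p) = begin
    value k ∙ (value l ∙ product xs)   ≈⟨ assoc (value k) (value l) (product xs) ⟨
    (value k ∙ value l) ∙ product xs   ≈⟨ ∙-cong (comm (value k) (value l)) (product-↭ p) ⟩
    (value l ∙ value k) ∙ product ys   ≈⟨ assoc (value l) (value k) (product ys) ⟩
    value l ∙ (value k ∙ product ys)   ∎
    where open ≈-Reasoning
  product-↭ (Perm.trans p q)  = ≈-trans (product-↭ p) (product-↭ q)

  index-cong : ∀ {g h} → g ≈ h → index g ≡ index h
  index-cong = Inverse.to-cong enumeration

  element-index : ∀ g → element (index g) ≈ g
  element-index = Inverse.strictlyInverseʳ enumeration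

  index-element : ∀ i → index (element i) ≡ i
  index-element = Inverse.strictlyInverseˡ enumeration

  index≡⇒≈ : ∀ {g i} → index g ≡ i → g ≈ element i
  index≡⇒≈ {g} refl = ≈-sym (element-index g)

  ≈⇒index≡ : ∀ {g i} → g ≈ element i → index g ≡ i
  ≈⇒index≡ {i = i} eq = trans (index-cong eq) (index-element i)

  hits : Fin N → Word N → ℚ
  hits h w = 𝟙 (index (product w) Fin.≟ h)

  0≤hits : ∀ h w → 0ℚ ≤ hits h w
  0≤hits h w = 0≤𝟙 (index (product w) Fin.≟ h)

  hits-total : ∀ w → ∑ (allFin N) (λ h → hits h w) ≤ 1ℚ
  hits-total w = ∑-unique (index (product w) Fin.≟_) (allFin⁺ N) (λ p q → trans (sym p) q)

  target : Letter N → Fin N → Fin N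
  target l h = index (value l ⁻¹ ∙ element h)

  solve-left : ∀ x {y z} → x ∙ y ≈ z → y ≈ x ⁻¹ ∙ z
  solve-left x {y} {z} eq = begin
    y                ≈⟨ identityˡ y ⟨
    ε ∙ y            ≈⟨ ∙-cong (inverseˡ x) ≈-refl ⟨
    (x ⁻¹ ∙ x) ∙ y   ≈⟨ assoc (x ⁻¹) x y ⟩
    x ⁻¹ ∙ (x ∙ y)   ≈⟨ ∙-cong ≈-refl eq ⟩
    x ⁻¹ ∙ z         ∎
    where open ≈-Reasoning

  unsolve-left : ∀ x {y z} → y ≈ x ⁻¹ ∙ z → x ∙ y ≈ z
  unsolve-left x {y} {z} eq = begin
    x ∙ y            ≈⟨ ∙-cong ≈-refl eq ⟩
    x ∙ (x ⁻¹ ∙ z)   ≈⟨ assoc x (x ⁻¹) z ⟨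
    (x ∙ x ⁻¹) ∙ z   ≈⟨ ∙-cong (inverseʳ x) ≈-refl ⟩
    ε ∙ z            ≈⟨ identityˡ z ⟩
    z                ∎
    where open ≈-Reasoning

  cancel-right : ∀ {x y} z → x ∙ z ≈ y ∙ z → x ≈ y
  cancel-right {x} {y} z eq = begin
    x                ≈⟨ drop x ⟨
    (x ∙ z) ∙ z ⁻¹   ≈⟨ ∙-cong eq ≈-refl ⟩
    (y ∙ z) ∙ z ⁻¹   ≈⟨ drop y ⟩
    y                ∎
    where
    open ≈-Reasoning
    drop : ∀ x → (x ∙ z) ∙ z ⁻¹ ≈ x
    drop x = ≈-trans (assoc x z (z ⁻¹)) (≈-trans (∙-cong ≈-refl (inverseʳ z)) (identityʳ x))

  hits-∷ : ∀ h l w → hits h (l ∷ w) ≡ hits (target l h) w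
  hits-∷ h l w = 𝟙-cong (index (product (l ∷ w)) Fin.≟ h) (index (product w) Fin.≟ target l h)
    (λ p → index-cong (solve-left (value l) (index≡⇒≈ p)))
    (λ p → ≈⇒index≡ (unsolve-left (value l) (≈-trans (index≡⇒≈ p) (element-index (value l ⁻¹ ∙ element h)))))

  hits-letter : (s : Fin N → Letter N) → (∀ {i j} → value (s i) ≈ value (s j) → element i ≈ element j) →
                ∀ h w → ∑ (allFin N) (λ i → hits h (s i ∷ w)) ≤ 1ℚ
  hits-letter s s-injective h w = ∑-unique (λ i → index (product (s i ∷ w)) Fin.≟ h) (allFin⁺ N)
    (λ {i} {j} p q → trans (sym (index-element i)) (≈⇒index≡ (s-injective
      (cancel-right (product w) (≈-trans (index≡⇒≈ p) (≈-sym (index≡⇒≈ q)))))))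

  neg-injective : ∀ {x y} → x ⁻¹ ≈ y ⁻¹ → x ≈ y
  neg-injective {x} {y} eq = begin
    x             ≈⟨ identityʳ x ⟨
    x ∙ ε         ≈⟨ unsolve-left x (≈-trans (≈-sym (inverseˡ y)) (∙-cong (≈-sym eq) ≈-refl)) ⟩
    y             ∎
    where open ≈-Reasoning

  module Weighted (p : ℚ) (0≤p : 0ℚ ≤ p) (p≤1 : p ≤ 1ℚ)
                  (d : ℕ) (W : ℚ) (W-bound : 1ℚ + ι 2 * ι d + ι 2 * (p * ι N) ≤ W) where
    open LetterWeights p 0≤p p≤1 {N} public
    open Sums d W W-bound public

    module RelativeHits (A : Subset N) (∣A∣≤d : Subset.∣ A ∣ ℕ.≤ d) where
      open Relative A ∣A∣≤d public
      open ℚ.≤-Reasoning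

      -- Once the rest of the word and the product `h` are fixed, cancellation in the group leaves
      -- at most one first letter of each sign. The letter `skip` contributes nothing, being old.
      new-letter : ∀ k h {φ} → (∀ w → 0ℚ ≤ φ w) →
        ∑ alphabet (λ l → new A l * ∑ (vocabulary k) (λ w → hits h (l ∷ w) * φ w)) ≤ ι 2 * ∑ (vocabulary k) φ
      new-letter k h {φ} φ≥0 = begin
        ∑ alphabet (λ l → new A l * ∑ (vocabulary k) (λ w → hits h (l ∷ w) * φ w))
          ≡⟨ ∑-cong alphabet (λ l → sym (∑-*ˡ (vocabulary k) (new A l) (λ w → hits h (l ∷ w) * φ w))) ⟩
        ∑ alphabet (λ l → ∑ (vocabulary k) (λ w → new A l * (hits h (l ∷ w) * φ w)))
          ≡⟨ ∑-swap alphabet (vocabulary k) (λ l w → new A l * (hits h (l ∷ w) * φ w)) ⟩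
        ∑ (vocabulary k) (λ w → ∑ alphabet (λ l → new A l * (hits h (l ∷ w) * φ w)))
          ≡⟨ ∑-cong (vocabulary k) (λ w → trans (∑-cong alphabet (λ l → sym (ℚ.*-assoc (new A l) (hits h (l ∷ w)) (φ w))))
               (∑-*ʳ alphabet (φ w) (λ l → new A l * hits h (l ∷ w)))) ⟩
        ∑ (vocabulary k) (λ w → ∑ alphabet (λ l → new A l * hits h (l ∷ w)) * φ w)
          ≤⟨ ∑-mono (vocabulary k) (λ w → *-monoʳ (φ≥0 w) (at-most-two w)) ⟩
        ∑ (vocabulary k) (λ w → ι 2 * φ w)
          ≡⟨ ∑-*ˡ (vocabulary k) (ι 2) φ ⟩
        ι 2 * ∑ (vocabulary k) φ ∎
        where
        drop-new : ∀ l w → new A l * hits h (l ∷ w) ≤ hits h (l ∷ w)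
        drop-new l w = subst (new A l * hits h (l ∷ w) ≤_) (ℚ.*-identityˡ (hits h (l ∷ w)))
          (*-monoʳ (0≤hits h (l ∷ w)) (new≤1 A l))
        at-most-two : ∀ w → ∑ alphabet (λ l → new A l * hits h (l ∷ w)) ≤ ι 2
        at-most-two w = begin
          ∑ alphabet (λ l → new A l * hits h (l ∷ w))
            ≡⟨ ∑-letters (allFin N) (λ l → new A l * hits h (l ∷ w)) ⟩
          (1ℚ - 1ℚ) * hits h (skip ∷ w) +
            (∑ (allFin N) (λ i → new A (pos i) * hits h (pos i ∷ w)) + ∑ (allFin N) (λ i → new A (neg i) * hits h (neg i ∷ w)))
            ≤⟨ ℚ.+-mono-≤ (ℚ.≤-reflexive (ℚ.*-zeroˡ (hits h (skip ∷ w)))) (ℚ.+-mono-≤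
                 (ℚ.≤-trans (∑-mono (allFin N) (λ i → drop-new (pos i) w)) (hits-letter pos id h w))
                 (ℚ.≤-trans (∑-mono (allFin N) (λ i → drop-new (neg i) w)) (hits-letter neg neg-injective h w))) ⟩
          ι 2 ∎

      new-weight′ : ∀ l → new A l * weight′ A l ≡ p * new A l
      new-weight′ l = go (old A l) (old-bit A l)
        where
        identity₀ : ∀ p → (1ℚ - 0ℚ) * (0ℚ + p * (1ℚ - 0ℚ)) ≡ p * (1ℚ - 0ℚ)
        identity₀ = solve-∀ ℚ-ring
        identity₁ : ∀ p → (1ℚ - 1ℚ) * (1ℚ + p * (1ℚ - 1ℚ)) ≡ p * (1ℚ - 1ℚ)
        identity₁ = solve-∀ ℚ-ring
        go : ∀ a → Bit a → (1ℚ - a) * (a + p * (1ℚ - a)) ≡ p * (1ℚ - a)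
        go _ (zeroBit refl) = identity₀ p
        go _ (oneBit refl)  = identity₁ p

      old-new : ∀ l → old A l * new A l ≡ 0ℚ
      old-new l = go (old A l) (old-bit A l)
        where
        go : ∀ a → Bit a → a * (1ℚ - a) ≡ 0ℚ
        go _ (zeroBit refl) = refl
        go _ (oneBit refl)  = refl

      news-sum mixed-sum : ℕ → Fin N → ℚ
      news-sum  k h = ∑ (vocabulary k) (λ w → hits h w * (news w * ω w))
      mixed-sum k h = ∑ (vocabulary k) (λ w → hits h w * (olds w * news w * ω w))

      0≤mixed-sum : ∀ k h → 0ℚ ≤ mixed-sum k h
      0≤mixed-sum k h = 0≤∑ (vocabulary k) (λ w →
        0≤* (0≤hits h w) (0≤* (0≤* (0≤olds w) (0≤news w)) (0≤ω w)))

      private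
        2p : ℚ
        2p = ι 2 * p
        0≤2p : 0ℚ ≤ 2p
        0≤2p = 0≤* (0≤ι 2) 0≤p

        scaled-sum : ∀ {f g : Letter N → ℚ} {s b} → (∀ l → 0ℚ ≤ f l) → 0ℚ ≤ b → ∑ alphabet f ≤ s →
          (∀ l → W * g l ≤ b) → W * ∑ alphabet (λ l → f l * g l) ≤ s * b
        scaled-sum {f} {g} {s} {b} f≥0 b≥0 f≤s g≤b = begin
          W * ∑ alphabet (λ l → f l * g l)    ≡⟨ ∑-*ˡ alphabet W (λ l → f l * g l) ⟨
          ∑ alphabet (λ l → W * (f l * g l))  ≡⟨ ∑-cong alphabet (λ l → identity W (f l) (g l)) ⟩
          ∑ alphabet (λ l → f l * (W * g l))  ≤⟨ ∑-mono alphabet (λ l → *-monoˡ (f≥0 l) (g≤b l)) ⟩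
          ∑ alphabet (λ l → f l * b)          ≡⟨ ∑-*ʳ alphabet b f ⟩
          ∑ alphabet f * b                    ≤⟨ *-monoʳ b≥0 f≤s ⟩
          s * b                               ∎
          where
          identity : ∀ W f g → W * (f * g) ≡ f * (W * g)
          identity = solve-∀ ℚ-ring

      -- A marked new letter has weight `p` and two candidates, so its position contributes `2p`
      -- instead of `W`. If the mark lies further on, the first letter merely moves the required
      -- product to `target l h`.
      news-total : ∀ k h → W * news-sum k h ≤ 2p * ι k * W ^ k
      news-total zero h = ℚ.≤-reflexive (identity W (hits h []) 2p)
        where
        identity : ∀ W x t → W * (x * (0ℚ * 1ℚ) + 0ℚ) ≡ t * 0ℚ * 1ℚ
        identity = solve-∀ ℚ-ring
      news-total (suc k) h = begin
        W * news-sum (suc k) h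
          ≡⟨ cong (W *_) (trans (∑-words (allFin N) k (λ w → hits h w * (news w * ω w))) (trans (∑-cong alphabet inner)
               (∑-+ alphabet (λ l → p * (new A l * fresh l)) (λ l → weight′ A l * news-sum k (target l h))))) ⟩
        W * (∑ alphabet (λ l → p * (new A l * fresh l)) + ∑ alphabet (λ l → weight′ A l * news-sum k (target l h)))
          ≡⟨ trans (cong (λ z → W * (z + rest)) (∑-*ˡ alphabet p (λ l → new A l * fresh l)))
               (ℚ.*-distribˡ-+ W (p * ∑ alphabet (λ l → new A l * fresh l)) rest) ⟩
        W * (p * ∑ alphabet (λ l → new A l * fresh l)) + W * rest
          ≤⟨ ℚ.+-mono-≤
               (*-monoˡ 0≤W (*-monoˡ 0≤p (ℚ.≤-trans (new-letter k h 0≤ω) (*-monoˡ (0≤ι 2) (ω-total k)))))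
               (scaled-sum (0≤weight′ A) (0≤* (0≤* 0≤2p (0≤ι k)) (0≤^ k 0≤W)) (weight′-sum≤ A ∣A∣≤d)
                 (λ l → news-total k (target l h))) ⟩
        W * (p * (ι 2 * W ^ k)) + W * (2p * ι k * W ^ k)
          ≡⟨ identity W p (ι 2) (W ^ k) (ι k) ⟩
        2p * (1ℚ + ι k) * (W * W ^ k) ∎
        where
        fresh : Letter N → ℚ
        fresh l = ∑ (vocabulary k) (λ w → hits h (l ∷ w) * ω w)
        rest = ∑ alphabet (λ l → weight′ A l * news-sum k (target l h))
        expand : ∀ x n r t m → x * ((n + r) * (t * m)) ≡ n * t * (x * m) + t * (x * (r * m))
        expand = solve-∀ ℚ-ring
        inner : ∀ l → ∑ (vocabulary k) (λ w → hits h (l ∷ w) * ((new A l + news w) * (weight′ A l * ω w))) ≡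
                      p * (new A l * fresh l) + weight′ A l * news-sum k (target l h)
        inner l = trans (∑-cong (vocabulary k) (λ w → trans (expand (hits h (l ∷ w)) (new A l) (news w) (weight′ A l) (ω w))
            (cong₂ (λ a b → a * (hits h (l ∷ w) * ω w) + weight′ A l * (b * (news w * ω w))) (new-weight′ l) (hits-∷ h l w))))
          (trans (∑-+ (vocabulary k) (λ w → p * new A l * (hits h (l ∷ w) * ω w))
                    (λ w → weight′ A l * (hits (target l h) w * (news w * ω w))))
            (cong₂ _+_ (trans (∑-*ˡ (vocabulary k) (p * new A l) (λ w → hits h (l ∷ w) * ω w)) (ℚ.*-assoc p (new A l) (fresh l)))
              (∑-*ˡ (vocabulary k) (weight′ A l) (λ w → hits (target l h) w * (news w * ω w)))))
        identity : ∀ W p t X κ → W * (p * (t * X)) + W * (t * p * κ * X) ≡ t * p * (1ℚ + κ) * (W * X)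
        identity = solve-∀ ℚ-ring

      -- A letter of A and a letter outside A each save a factor of about pN.
      mixed-total : ∀ k h → W * (W * mixed-sum k h) ≤ 2p * O * (ι k * ι k) * W ^ k
      mixed-total zero h = ℚ.≤-reflexive (identity W (hits h []) (2p * O))
        where
        identity : ∀ W x t → W * (W * (x * (0ℚ * 0ℚ * 1ℚ) + 0ℚ)) ≡ t * (0ℚ * 0ℚ) * 1ℚ
        identity = solve-∀ ℚ-ring
      mixed-total (suc k) h = begin
        W * (W * mixed-sum (suc k) h)
          ≡⟨ cong (λ z → W * (W * z)) (trans (∑-words (allFin N) k (λ w → hits h w * (olds w * news w * ω w)))
               (trans (∑-cong alphabet inner) (trans
                 (∑-+ alphabet (λ l → old A l * news-sum k (target l h) + p * (new A l * fresh l)) (λ l → weight′ A l * mixed-sum k (target l h)))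
                 (cong (_+ rest₂) (trans (∑-+ alphabet (λ l → old A l * news-sum k (target l h)) (λ l → p * (new A l * fresh l)))
                   (cong (rest₁ +_) (∑-*ˡ alphabet p (λ l → new A l * fresh l)))))))) ⟩
        W * (W * (rest₁ + p * newest + rest₂))
          ≡⟨ distribute W rest₁ p newest rest₂ ⟩
        W * (W * rest₁) + W * (p * (W * newest)) + W * (W * rest₂)
          ≤⟨ ℚ.+-mono-≤ (ℚ.+-mono-≤ (*-monoˡ 0≤W bound₁) (*-monoˡ 0≤W (*-monoˡ 0≤p bound₂))) bound₃ ⟩
        W * (O * (2p * ι k * X)) + W * (p * (ι 2 * (ι k * O * X))) + W * (2p * O * (ι k * ι k) * X)
          -- The first letter carries the old mark, the new mark or neither; a letter cannot carry
          -- both. The positions number `k + k + k²`, one less than `(k + 1)²`.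
          ≤⟨ ≤-byDiff (identity W p (ι 2) O (ι k) X) (0≤* (0≤* 0≤2p 0≤O) (0≤* 0≤W (0≤^ k 0≤W))) ⟩
        2p * O * ((1ℚ + ι k) * (1ℚ + ι k)) * (W * X) ∎
        where
        X = W ^ k
        fresh : Letter N → ℚ
        fresh l = ∑ (vocabulary k) (λ w → hits h (l ∷ w) * (olds w * ω w))
        rest₁ = ∑ alphabet (λ l → old A l * news-sum k (target l h))
        newest = ∑ alphabet (λ l → new A l * fresh l)
        rest₂ = ∑ alphabet (λ l → weight′ A l * mixed-sum k (target l h))
        expand : ∀ x a o n r t m →
          x * ((a + o) * (n + r) * (t * m)) ≡
          (a * n) * (x * (t * m)) + ((a * t) * (x * (r * m)) + (n * t) * (x * (o * m)) + t * (x * (o * r * m)))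
        expand = solve-∀ ℚ-ring
        inner : ∀ l → ∑ (vocabulary k) (λ w → hits h (l ∷ w) * ((old A l + olds w) * (new A l + news w) * (weight′ A l * ω w))) ≡
                      old A l * news-sum k (target l h) + p * (new A l * fresh l) + weight′ A l * mixed-sum k (target l h)
        inner l = trans (∑-cong (vocabulary k) term)
          (trans (∑-+ (vocabulary k) (λ w → T₁ w + T₂ w) T₃)
            (cong₂ _+_ (trans (∑-+ (vocabulary k) T₁ T₂) (cong₂ _+_
                (∑-*ˡ (vocabulary k) (old A l) (λ w → hits (target l h) w * (news w * ω w)))
                (trans (∑-*ˡ (vocabulary k) (p * new A l) (λ w → hits h (l ∷ w) * (olds w * ω w))) (ℚ.*-assoc p (new A l) (fresh l)))))
              (∑-*ˡ (vocabulary k) (weight′ A l) (λ w → hits (target l h) w * (olds w * news w * ω w)))))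
          where
          T₁ T₂ T₃ : Word N → ℚ
          T₁ w = old A l * (hits (target l h) w * (news w * ω w))
          T₂ w = p * new A l * (hits h (l ∷ w) * (olds w * ω w))
          T₃ w = weight′ A l * (hits (target l h) w * (olds w * news w * ω w))
          term : ∀ w → hits h (l ∷ w) * ((old A l + olds w) * (new A l + news w) * (weight′ A l * ω w)) ≡ T₁ w + T₂ w + T₃ w
          term w = trans (expand (hits h (l ∷ w)) (old A l) (olds w) (new A l) (news w) (weight′ A l) (ω w))
            (trans (cong (λ z → z * (hits h (l ∷ w) * (weight′ A l * ω w)) + others) (old-new l))
              (trans (drop-0 (hits h (l ∷ w) * (weight′ A l * ω w)) others)
                (cong₂ _+_ (cong₂ _+_
                    (cong₂ (λ a b → a * (b * (news w * ω w))) (old-weight′ A l) (hits-∷ h l w))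
                    (cong (_* (hits h (l ∷ w) * (olds w * ω w))) (new-weight′ l)))
                  (cong (λ b → weight′ A l * (b * (olds w * news w * ω w))) (hits-∷ h l w)))))
            where
            others = (old A l * weight′ A l) * (hits h (l ∷ w) * (news w * ω w))
              + (new A l * weight′ A l) * (hits h (l ∷ w) * (olds w * ω w))
              + weight′ A l * (hits h (l ∷ w) * (olds w * news w * ω w))
        bound₁ : W * rest₁ ≤ O * (2p * ι k * X)
        bound₁ = scaled-sum (0≤old A) (0≤* (0≤* 0≤2p (0≤ι k)) (0≤^ k 0≤W)) (old-sum≤ A ∣A∣≤d)
          (λ l → news-total k (target l h))
        bound₂ : W * newest ≤ ι 2 * (ι k * O * X)
        bound₂ = begin
          W * newest
            ≤⟨ *-monoˡ 0≤W (new-letter k h (λ w → 0≤* (0≤olds w) (0≤ω w))) ⟩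
          W * (ι 2 * ∑ (vocabulary k) (λ w → olds w * ω w))
            ≡⟨ exchange W (ι 2) (∑ (vocabulary k) (λ w → olds w * ω w)) ⟩
          ι 2 * (W * ∑ (vocabulary k) (λ w → olds w * ω w))
            ≤⟨ *-monoˡ (0≤ι 2) (olds-total k) ⟩
          ι 2 * (ι k * O * X) ∎
          where
          exchange : ∀ a b c → a * (b * c) ≡ b * (a * c)
          exchange = solve-∀ ℚ-ring
        bound₃ : W * (W * rest₂) ≤ W * (2p * O * (ι k * ι k) * X)
        bound₃ = begin
          W * (W * rest₂)
            ≡⟨ cong (W *_) (trans (sym (∑-*ˡ alphabet W (λ l → weight′ A l * mixed-sum k (target l h))))
                 (∑-cong alphabet (λ l → exchange W (weight′ A l) (mixed-sum k (target l h))))) ⟩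
          W * ∑ alphabet (λ l → weight′ A l * (W * mixed-sum k (target l h)))
            ≤⟨ scaled-sum (0≤weight′ A) (0≤* (0≤* (0≤* 0≤2p 0≤O) (0≤* (0≤ι k) (0≤ι k))) (0≤^ k 0≤W)) (weight′-sum≤ A ∣A∣≤d)
                 (λ l → mixed-total k (target l h)) ⟩
          W * (2p * O * (ι k * ι k) * X) ∎
          where
          exchange : ∀ a b c → a * (b * c) ≡ b * (a * c)
          exchange = solve-∀ ℚ-ring
        distribute : ∀ W r p n s → W * (W * (r + p * n + s)) ≡ W * (W * r) + W * (p * (W * n)) + W * (W * s)
        distribute = solve-∀ ℚ-ring
        identity : ∀ W p t O κ X →
          t * p * O * ((1ℚ + κ) * (1ℚ + κ)) * (W * X) -
            (W * (O * (t * p * κ * X)) + W * (p * (t * (κ * O * X))) + W * (t * p * O * (κ * κ) * X)) ≡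
          t * p * O * (W * X)
        identity = solve-∀ ℚ-ring

-- Covered elements

∑-term : ∀ {a} {A : Set a} {xs : List A} {f : A → ℚ} {x} → (∀ y → 0ℚ ≤ f y) → x ∈ˡ xs → f x ≤ ∑ xs f
∑-term {xs = _ ∷ xs} f≥0 (Any.here refl) = ≤+nonneg (0≤∑ xs f≥0)
∑-term {xs = y ∷ _}  f≥0 (Any.there x∈)  = ℚ.≤-trans (∑-term f≥0 x∈) (nonneg+≤ (f≥0 y))

avoids≤1 : ∀ {n} (F : List (Subset n)) S → avoids F S ≤ 1ℚ
avoids≤1 []      S = ℚ.≤-refl
avoids≤1 (A ∷ F) S = ℚ.≤-trans (*≤1≤ (≤⇒0≤- (contains≤1 A S)) (avoids≤1 F S)) (-nonneg≤ (0≤contains A S))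

avoids-∈ : ∀ {n} {F : List (Subset n)} {A S} → A ∈ˡ F → contains A S ≡ 1ℚ → avoids F S ≡ 0ℚ
avoids-∈ {F = A ∷ F} {S = S} (Any.here refl) eq = trans (cong (λ z → (1ℚ - z) * avoids F S) eq) (ℚ.*-zeroˡ (avoids F S))
avoids-∈ {F = B ∷ F} {S = S} (Any.there A∈)  eq = trans (cong ((1ℚ - contains B S) *_) (avoids-∈ A∈ eq)) (ℚ.*-zeroʳ (1ℚ - contains B S))

∈-letters : ∀ {N} (l : Letter N) → l ∈ˡ letters (allFin N)
∈-letters skip    = Any.here refl
∈-letters (pos i) = Any.there (Mem.∈-++⁺ˡ (Mem.∈-map⁺ pos (∈-allFin i)))
∈-letters {N} (neg i) = Any.there (Mem.∈-++⁺ʳ (List.map pos (allFin N)) (Mem.∈-map⁺ neg (∈-allFin i)))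

module Covering {c ℓ : Level} {N : ℕ} (G : AbelianGroupOfOrder c ℓ N) (d : ℕ) where
  open AbelianGroupOfOrder G
  open AbelianGroup group using (ε; assoc; identityˡ; identityʳ; inverseˡ)
  open Evaluation G
  open Cayley G
  private module ≈-Reasoning = SetoidReasoning carrierSetoid

  supports : Fin N → List (Subset N)
  supports h = List.map support (filter (λ w → index (product w) Fin.≟ h) (signedSets (allFin N) d))

  -- repeats vanishes on reduced words, so only degenerate words contribute.
  degenerate : Fin N → Subset N → ℚ
  degenerate h S = ∑ (words (allFin N) d) (λ w → hits h w * (repeats w * contains (support w) S))

  ∣supports∣ : ∀ {h A} → A ∈ˡ supports h → Subset.∣ A ∣ ≡ d
  ∣supports∣ {h} A∈ with Mem.∈-map⁻ support A∈
  ... | w , w∈ , refl with proj₁ (Mem.∈-filter⁻ (λ w → index (product w) Fin.≟ h) {xs = signedSets (allFin N) d} w∈)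
  ...   | w∈′ = trans (∣support∣-reduced (signedSets-reduced d (allFin⁺ N) w∈′)) (signedSets-length (allFin N) d w∈′)

  private
    move : ∀ u {v x} → x ≈ u ⁻¹ ∙ v → ∀ {y w} → v ∙ y ≈ w → u ∙ (x ∙ y) ≈ w
    move u {v} {x} x≈ {y} {w} vy≈w = begin
      u ∙ (x ∙ y)   ≈⟨ assoc u x y ⟨
      (u ∙ x) ∙ y   ≈⟨ ∙-cong (unsolve-left u x≈) ≈-refl ⟩
      v ∙ y         ≈⟨ vy≈w ⟩
      w             ∎
      where open ≈-Reasoning

    flip : ∀ u v → (v ⁻¹ ∙ u) ⁻¹ ≈ u ⁻¹ ∙ v
    flip u v = begin
      (v ⁻¹ ∙ u) ⁻¹       ≈⟨ identityʳ ((v ⁻¹ ∙ u) ⁻¹) ⟨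
      (v ⁻¹ ∙ u) ⁻¹ ∙ ε   ≈⟨ solve-left (v ⁻¹ ∙ u) cancels ⟨
      u ⁻¹ ∙ v            ∎
      where
      open ≈-Reasoning
      cancels : (v ⁻¹ ∙ u) ∙ (u ⁻¹ ∙ v) ≈ ε
      cancels = begin
        (v ⁻¹ ∙ u) ∙ (u ⁻¹ ∙ v)   ≈⟨ assoc (v ⁻¹) u (u ⁻¹ ∙ v) ⟩
        v ⁻¹ ∙ (u ∙ (u ⁻¹ ∙ v))   ≈⟨ ∙-cong ≈-refl (unsolve-left u ≈-refl) ⟩
        v ⁻¹ ∙ v                  ≈⟨ inverseˡ v ⟩
        ε                         ∎

  walk⇒word : ∀ {S k u v} → Γ.Walk S k u v →
    ∃ λ w → length w ≡ k × All.All (Old S) w × u ∙ product w ≈ v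
  walk⇒word (Graph.stop u≈v) = [] , refl , [] , ≈-trans (identityʳ _) u≈v
  walk⇒word {u = u} (Graph.step {v = v} (_ , inj₁ s∈) walk) =
    let w , len , olds , eq = walk⇒word walk
    in pos (index (u ⁻¹ ∙ v)) ∷ w , cong suc len , s∈ ∷ olds , move u (element-index (u ⁻¹ ∙ v)) eq
  walk⇒word {u = u} (Graph.step {v = v} (_ , inj₂ s∈) walk) =
    let w , len , olds , eq = walk⇒word walk
    in neg (index (v ⁻¹ ∙ u)) ∷ w , cong suc len , s∈ ∷ olds ,
       move u (≈-trans (⁻¹-cong (element-index (v ⁻¹ ∙ u))) (flip u v)) eq

  pad : ∀ {S} j w → All.All (Old S) w →
    ∃ λ w′ → length w′ ≡ j ℕ.+ length w × All.All (Old S) w′ × product w′ ≈ product w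
  pad zero    w olds = w , refl , olds , ≈-refl
  pad (suc j) w olds =
    let w′ , len , olds′ , eq = pad j w olds
    in skip ∷ w′ , cong suc len , tt ∷ olds′ , ≈-trans (identityˡ (product w′)) eq

  diameter⇒word : ∀ {S} → DiameterAtMost d S → ∀ h →
    ∃ λ w → length w ≡ d × All.All (Old S) w × index (product w) ≡ h
  diameter⇒word (D , D≤d , connected , _) h =
    let k , k≤D , walk , _ = connected ε (element h)
        w , len , olds , eq = walk⇒word walk
        w′ , len′ , olds′ , eq′ = pad (d ℕ.∸ k) w olds
    in w′ , trans len′ (trans (cong (d ℕ.∸ k ℕ.+_) len) (ℕ.m∸n+n≡m (ℕ.≤-trans k≤D D≤d))) , olds′ ,
       ≈⇒index≡ (≈-trans eq′ (≈-trans (≈-sym (identityˡ (product w))) eq))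

  0≤degenerate-term : ∀ h S w → 0ℚ ≤ hits h w * (repeats w * contains (support w) S)
  0≤degenerate-term h S w = 0≤* (0≤hits h w) (0≤* (0≤repeats w) (0≤contains (support w) S))

  0≤degenerate : ∀ h S → 0ℚ ≤ degenerate h S
  0≤degenerate h S = 0≤∑ (words (allFin N) d) (0≤degenerate-term h S)

  covered : ∀ {S} → DiameterAtMost d S → ∀ h → avoids (supports h) S ≤ degenerate h S
  covered {S} diam h with diameter⇒word diam h
  ... | w , refl , olds , eq with reduced⊎repeats w
  ...   | inj₂ 1≤repeats = begin
    avoids (supports h) S                               ≤⟨ avoids≤1 (supports h) S ⟩
    1ℚ                                                  ≤⟨ 1≤repeats ⟩
    repeats w                                           ≡⟨ identity (repeats w) ⟩
    1ℚ * (repeats w * 1ℚ)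
      ≡⟨ cong₂ (λ a b → a * (repeats w * b)) (𝟙-yes (index (product w) Fin.≟ h) eq) (contains-support olds) ⟨
    hits h w * (repeats w * contains (support w) S)
      ≤⟨ ∑-term (0≤degenerate-term h S) (∈-words⁺ (allFin N) (All.universal ∈-letters w)) ⟩
    degenerate h S ∎
    where
    open ℚ.≤-Reasoning
    identity : ∀ r → r ≡ 1ℚ * (r * 1ℚ)
    identity = solve-∀ ℚ-ring
  ...   | inj₁ reduced =
    let v , v∈ , v↭w = signedSets-complete reduced
        hit = trans (index-cong (product-↭ v↭w)) eq
    in ℚ.≤-trans (ℚ.≤-reflexive (avoids-∈
         (Mem.∈-map⁺ support (Mem.∈-filter⁺ (λ w → index (product w) Fin.≟ h) v∈ hit))
         (contains-support (All-resp-↭ (↭-sym v↭w) olds))))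
       (0≤degenerate h S)

-- The second moment of the number of elements missed by the signed sets

module SecondMoment {c ℓ : Level} {N : ℕ} (G : AbelianGroupOfOrder c ℓ N)
  (p : ℚ) (0≤p : 0ℚ ≤ p) (p≤1 : p ≤ 1ℚ)
  (d : ℕ) (W : ℚ) (W-bound : 1ℚ + ι 2 * ι d + ι 2 * (p * ι N) ≤ W) where

  open Expectation p 0≤p p≤1 public
  open Covariance p 0≤p p≤1
  open AbelianGroupOfOrder G using (index)
  open Evaluation G
  open Covering G d public
  open Weighted p 0≤p p≤1 d W W-bound
  open ℚ.≤-Reasoning

  mixedSum : ∀ A → Subset.∣ A ∣ ℕ.≤ d → Fin N → ℚ
  mixedSum A ∣A∣≤d = RelativeHits.mixed-sum A ∣A∣≤d d

  mixedSum-bound : ∀ A (∣A∣≤d : Subset.∣ A ∣ ℕ.≤ d) h →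
    W * (W * mixedSum A ∣A∣≤d h) ≤ ι 2 * p * O * (ι d * ι d) * W ^ d
  mixedSum-bound A ∣A∣≤d h = RelativeHits.mixed-total A ∣A∣≤d d h

  0≤mixedSum : ∀ A (∣A∣≤d : Subset.∣ A ∣ ℕ.≤ d) h → 0ℚ ≤ mixedSum A ∣A∣≤d h
  0≤mixedSum A ∣A∣≤d h = RelativeHits.0≤mixed-sum A ∣A∣≤d d h

  P : Fin N → ℚ
  P h = E (avoids (supports h))

  0≤P : ∀ h → 0ℚ ≤ P h
  0≤P h = 0≤E (0≤avoids (supports h))

  count : Fin N → ℚ
  count h = ι (length (supports h))

  private
    x : ℚ
    x = p ^ d
    0≤x : 0ℚ ≤ x
    0≤x = 0≤^ d 0≤p

  insiders : Subset N → Fin N → ℚ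
  insiders A h = ∑ (vocabulary d) (λ w → hits h w * allOldIn A w)

  0≤allOldIn : ∀ A w → 0ℚ ≤ allOldIn A w
  0≤allOldIn A []      = 0≤1
  0≤allOldIn A (l ∷ w) = 0≤* (0≤old A l) (0≤allOldIn A w)

  0≤insiders : ∀ A h → 0ℚ ≤ insiders A h
  0≤insiders A h = 0≤∑ (vocabulary d) (λ w → 0≤* (0≤hits h w) (0≤allOldIn A w))

  -- Every word has only one product, so summing over `h` counts each word over `A` at most once.
  -- The bound is therefore independent of `N`, whereas no useful bound is available for a single
  -- `h`.
  insiders-total : ∀ A → Subset.∣ A ∣ ℕ.≤ d → ∑ (allFin N) (insiders A) ≤ O ^ d
  insiders-total A ∣A∣≤d = begin
    ∑ (allFin N) (insiders A)
      ≡⟨ ∑-swap (allFin N) (vocabulary d) (λ h w → hits h w * allOldIn A w) ⟩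
    ∑ (vocabulary d) (λ w → ∑ (allFin N) (λ h → hits h w * allOldIn A w))
      ≤⟨ ∑-mono (vocabulary d) (λ w → subst₂ _≤_ (sym (∑-*ʳ (allFin N) (allOldIn A w) (λ h → hits h w)))
           (ℚ.*-identityˡ (allOldIn A w)) (*-monoʳ (0≤allOldIn A w) (hits-total w))) ⟩
    ∑ (vocabulary d) (allOldIn A)
      ≤⟨ RelativeHits.allOld-total A ∣A∣≤d d ⟩
    O ^ d ∎

  degenerate-total : W * ∑ (allFin N) (λ h → E (degenerate h)) ≤ ι d * O * W ^ d
  degenerate-total = begin
    W * ∑ (allFin N) (λ h → E (degenerate h))
      ≡⟨ cong (W *_) (∑-cong (allFin N) degenerate-mean) ⟩
    W * ∑ (allFin N) (λ h → ∑ (vocabulary d) (λ w → hits h w * (repeats w * mass w)))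
      ≡⟨ cong (W *_) (∑-swap (allFin N) (vocabulary d) (λ h w → hits h w * (repeats w * mass w))) ⟩
    W * ∑ (vocabulary d) (λ w → ∑ (allFin N) (λ h → hits h w * (repeats w * mass w)))
      ≤⟨ *-monoˡ 0≤W (∑-mono (vocabulary d) (λ w → subst₂ _≤_
           (sym (∑-*ʳ (allFin N) (repeats w * mass w) (λ h → hits h w))) (ℚ.*-identityˡ (repeats w * mass w))
           (*-monoʳ (0≤* (0≤repeats w) (0≤mass w)) (hits-total w)))) ⟩
    W * ∑ (vocabulary d) (λ w → repeats w * mass w)
      ≤⟨ repeats-total d ℕ.≤-refl ⟩
    ι d * O * W ^ d ∎
    where
    degenerate-mean : ∀ h → E (degenerate h) ≡ ∑ (vocabulary d) (λ w → hits h w * (repeats w * mass w))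
    degenerate-mean h = trans (E-∑ (vocabulary d) (λ w S → hits h w * (repeats w * contains (support w) S)))
      (∑-cong (vocabulary d) (λ w → trans (E-*ˡ (hits h w) (λ S → repeats w * contains (support w) S))
        (cong (hits h w *_) (trans (E-*ˡ (repeats w) (contains (support w))) (cong (repeats w *_) (E-contains (support w)))))))

  degenerate-harris : ∀ h → E (λ S → avoids (supports h) S * degenerate h S) ≤ P h * E (degenerate h)
  degenerate-harris h = begin
    E (λ S → f S * degenerate h S)
      ≡⟨ E-cong (λ S → trans (sym (∑-*ˡ (vocabulary d) (f S) (term S)))
           (∑-cong (vocabulary d) (λ w → rearrange (f S) (hits h w) (repeats w) (contains (support w) S)))) ⟩
    E (λ S → ∑ (vocabulary d) (λ w → hits h w * repeats w * (f S * contains (support w) S)))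
      ≡⟨ trans (E-∑ (vocabulary d) (λ w S → hits h w * repeats w * (f S * contains (support w) S)))
           (∑-cong (vocabulary d) (λ w → E-*ˡ (hits h w * repeats w) (λ S → f S * contains (support w) S))) ⟩
    ∑ (vocabulary d) (λ w → hits h w * repeats w * E (λ S → f S * contains (support w) S))
      ≤⟨ ∑-mono (vocabulary d) (λ w → *-monoˡ (0≤* (0≤hits h w) (0≤repeats w))
           (harris-contains (decreasing-avoids (supports h)) (support w))) ⟩
    ∑ (vocabulary d) (λ w → hits h w * repeats w * (P h * p ^ Subset.∣ support w ∣))
      ≡⟨ ∑-cong (vocabulary d) (λ w → trans (sym (rearrange (P h) (hits h w) (repeats w) (p ^ Subset.∣ support w ∣)))
           (cong (λ z → P h * (hits h w * (repeats w * z))) (sym (E-contains (support w))))) ⟩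
    ∑ (vocabulary d) (λ w → P h * (hits h w * (repeats w * E (contains (support w)))))
      ≡⟨ ∑-*ˡ (vocabulary d) (P h) (λ w → hits h w * (repeats w * E (contains (support w)))) ⟩
    P h * ∑ (vocabulary d) (λ w → hits h w * (repeats w * E (contains (support w))))
      ≡⟨ cong (P h *_) (trans (E-∑ (vocabulary d) (λ w S → term S w))
           (∑-cong (vocabulary d) (λ w → trans (E-*ˡ (hits h w) (λ S → repeats w * contains (support w) S))
             (cong (hits h w *_) (E-*ˡ (repeats w) (contains (support w))))))) ⟨
    P h * E (degenerate h) ∎
    where
    f = avoids (supports h)
    term : Subset N → Word N → ℚ
    term S w = hits h w * (repeats w * contains (support w) S)
    rearrange : ∀ a b c d → a * (b * (c * d)) ≡ b * c * (a * d)
    rearrange = solve-∀ ℚ-ring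

  module Pairs (M̄ : ℚ) (0≤M̄ : 0ℚ ≤ M̄) (mixed≤ : ∀ A ∣A∣≤d h → mixedSum A ∣A∣≤d h ≤ M̄) where

    -- The two summands come from `olds-split`: the first is small for every `h`, the second only on
    -- average over `h`.
    κ-row : ∀ {A} h → Subset.∣ A ∣ ≡ d → ∑ (supports h) (κ A) ≤ x * (M̄ + ι d * insiders A h)
    κ-row {A} h ∣A∣≡d = begin
      ∑ (supports h) (κ A)
        ≡⟨ trans (∑-map support (filter hit? (signedSets (allFin N) d)) (κ A))
             (∑-filter hit? (signedSets (allFin N) d) (κ A ∘ support)) ⟩
      ∑ (signedSets (allFin N) d) (λ w → hits h w * κ A (support w))
        ≤⟨ ∑-mono-∈ (signedSets (allFin N) d) (λ w w∈ → *-monoˡ (0≤hits h w)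
             (subst (λ k → κ A (support w) ≤ p ^ k * (olds w * ω w)) ∣A∣≡d
               (κ≤ (signedSets-reduced d (allFin⁺ N) w∈)))) ⟩
      ∑ (signedSets (allFin N) d) (λ w → hits h w * (x * (olds w * ω w)))
        ≤⟨ signedSets≤words (allFin N) d (λ w → 0≤* (0≤hits h w) (0≤* 0≤x (0≤* (0≤olds w) (0≤ω w)))) ⟩
      ∑ (vocabulary d) (λ w → hits h w * (x * (olds w * ω w)))
        ≤⟨ ∑-mono-∈ (vocabulary d) split ⟩
      ∑ (vocabulary d) (λ w → x * (hits h w * (olds w * news w * ω w) + ι d * (hits h w * allOldIn A w)))
        ≡⟨ trans (∑-*ˡ (vocabulary d) x (λ w → hits h w * (olds w * news w * ω w) + ι d * (hits h w * allOldIn A w)))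
             (cong (x *_) (trans (∑-+ (vocabulary d) (λ w → hits h w * (olds w * news w * ω w)) (λ w → ι d * (hits h w * allOldIn A w)))
               (cong (mixed-sum d h +_) (∑-*ˡ (vocabulary d) (ι d) (λ w → hits h w * allOldIn A w))))) ⟩
      x * (mixed-sum d h + ι d * insiders A h)
        ≤⟨ *-monoˡ 0≤x (ℚ.+-monoˡ-≤ (ι d * insiders A h) (mixed≤ A ∣A∣≤d h)) ⟩
      x * (M̄ + ι d * insiders A h) ∎
      where
      ∣A∣≤d = ℕ.≤-reflexive ∣A∣≡d
      open RelativeHits A ∣A∣≤d
      hit? : ∀ w → Dec (index (product w) ≡ h)
      hit? w = index (product w) Fin.≟ h
      distribute : ∀ a x m k b → a * (x * (m + k * b)) ≡ x * (a * m + k * (a * b))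
      distribute = solve-∀ ℚ-ring
      split : ∀ w → w ∈ˡ vocabulary d → hits h w * (x * (olds w * ω w)) ≤
        x * (hits h w * (olds w * news w * ω w) + ι d * (hits h w * allOldIn A w))
      split w w∈ = begin
        hits h w * (x * (olds w * ω w))
          ≤⟨ *-monoˡ (0≤hits h w) (*-monoˡ 0≤x (olds-split w)) ⟩
        hits h w * (x * (olds w * news w * ω w + ι (length w) * allOldIn A w))
          ≡⟨ distribute (hits h w) x (olds w * news w * ω w) (ι (length w)) (allOldIn A w) ⟩
        x * (hits h w * (olds w * news w * ω w) + ι (length w) * (hits h w * allOldIn A w))
          ≡⟨ cong (λ k → x * (hits h w * (olds w * news w * ω w) + ι k * (hits h w * allOldIn A w))) (words-length (allFin N) d w∈) ⟩
        x * (hits h w * (olds w * news w * ω w) + ι d * (hits h w * allOldIn A w)) ∎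

    R : Fin N → Fin N → ℚ
    R g h = ∑ (supports g) (λ A → insiders A h)

    Θ-bound : ∀ g h → Θ (supports g) (supports h) ≤ x * count g * M̄ + x * ι d * R g h
    Θ-bound g h = begin
      Θ (supports g) (supports h)
        ≤⟨ ∑-mono-∈ (supports g) (λ A A∈ → κ-row h (∣supports∣ A∈)) ⟩
      ∑ (supports g) (λ A → x * (M̄ + ι d * insiders A h))
        ≡⟨ trans (∑-*ˡ (supports g) x (λ A → M̄ + ι d * insiders A h))
             (cong (x *_) (trans (∑-+ (supports g) (λ _ → M̄) (λ A → ι d * insiders A h))
               (cong₂ _+_ (∑-const (supports g) M̄) (∑-*ˡ (supports g) (ι d) (λ A → insiders A h))))) ⟩
      x * (count g * M̄ + ι d * R g h)
        ≡⟨ identity x (count g) M̄ (ι d) (R g h) ⟩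
      x * count g * M̄ + x * ι d * R g h ∎
      where
      identity : ∀ x a b c r → x * (a * b + c * r) ≡ x * a * b + x * c * r
      identity = solve-∀ ℚ-ring

    V : Fin N → Fin N → ℚ
    V g h = E (λ S → avoids (supports g) S * avoids (supports h) S)

    0≤V : ∀ g h → 0ℚ ≤ V g h
    0≤V g h = 0≤E (λ S → 0≤* (0≤avoids (supports g) S) (0≤avoids (supports h) S))

    V≤P : ∀ g h → V g h ≤ P g
    V≤P g h = E-mono (λ S → *≤1≤ (0≤avoids (supports g) S) (avoids≤1 (supports h) S))

    0≤R : ∀ g h → 0ℚ ≤ R g h
    0≤R g h = 0≤∑ (supports g) (λ A → 0≤insiders A h)

    R-total : ∀ g → ∑ (allFin N) (R g) ≤ count g * O ^ d
    R-total g = begin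
      ∑ (allFin N) (R g)
        ≡⟨ ∑-swap (allFin N) (supports g) (λ h A → insiders A h) ⟩
      ∑ (supports g) (λ A → ∑ (allFin N) (insiders A))
        ≤⟨ ∑-mono-∈ (supports g) (λ A A∈ → insiders-total A (ℕ.≤-reflexive (∣supports∣ A∈))) ⟩
      ∑ (supports g) (λ _ → O ^ d)
        ≡⟨ ∑-const (supports g) (O ^ d) ⟩
      count g * O ^ d ∎

    module Selected (t : Fin N → ℚ) (0≤t : ∀ h → 0ℚ ≤ t h) (t≤1 : ∀ h → t h ≤ 1ℚ)
             (L : ℚ) (0≤L : 0ℚ ≤ L) (count≤ : ∀ h → t h * (x * count h) ≤ t h * L) where

      X Y : Subset N → ℚ
      X S = ∑ (allFin N) (λ h → t h * avoids (supports h) S)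
      Y S = ∑ (allFin N) (λ h → t h * (avoids (supports h) S * degenerate h S))

      mean Z : ℚ
      mean = ∑ (allFin N) (λ h → t h * P h)
      Z    = ∑ (allFin N) (λ g → ∑ (allFin N) (λ h → t g * t h * V g h))

      0≤mean : 0ℚ ≤ mean
      0≤mean = 0≤∑ (allFin N) (λ h → 0≤* (0≤t h) (0≤P h))

      E-X : E X ≡ mean
      E-X = trans (E-∑ (allFin N) (λ h S → t h * avoids (supports h) S))
        (∑-cong (allFin N) (λ h → E-*ˡ (t h) (avoids (supports h))))

      E-X² : E (λ S → X S * X S) ≡ Z
      E-X² = trans (E-cong (λ S → ∑-product (allFin N) (allFin N) (λ g → t g * avoids (supports g) S) (λ h → t h * avoids (supports h) S)))
        (trans (E-∑ (allFin N) (λ g S → ∑ (allFin N) (λ h → (t g * avoids (supports g) S) * (t h * avoids (supports h) S))))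
          (∑-cong (allFin N) (λ g → trans (E-∑ (allFin N) (λ h S → (t g * avoids (supports g) S) * (t h * avoids (supports h) S)))
            (∑-cong (allFin N) (λ h → trans (E-cong (λ S → rearrange (t g) (avoids (supports g) S) (t h) (avoids (supports h) S)))
              (E-*ˡ (t g * t h) (λ S → avoids (supports g) S * avoids (supports h) S)))))))
        where
        rearrange : ∀ a b c d → (a * b) * (c * d) ≡ a * c * (b * d)
        rearrange = solve-∀ ℚ-ring

      E-Y : E Y ≤ ∑ (allFin N) (λ h → t h * (P h * E (degenerate h)))
      E-Y = ℚ.≤-trans
        (ℚ.≤-reflexive (trans (E-∑ (allFin N) (λ h S → t h * (avoids (supports h) S * degenerate h S)))
          (∑-cong (allFin N) (λ h → E-*ˡ (t h) (λ S → avoids (supports h) S * degenerate h S)))))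
        (∑-mono (allFin N) (λ h → *-monoˡ (0≤t h) (degenerate-harris h)))

      -- The uniformly small part keeps `V g h` as a factor, to be absorbed into `Z`. In the other
      -- part `V g h` is replaced by `P g`, because only `R g h` can then be summed over `h`.
      pair-term : ∀ g h → t g * t h * V g h ≤
        (t g * P g) * (t h * P h) + L * M̄ * (t g * t h * V g h) + (t g * P g) * (x * ι d) * R g h
      pair-term g h = begin
        t g * t h * V g h
          ≤⟨ *-monoˡ (0≤* (0≤t g) (0≤t h)) (covariance (supports g) (supports h)) ⟩
        t g * t h * (P g * P h + V g h * Θ (supports g) (supports h))
          ≤⟨ *-monoˡ (0≤* (0≤t g) (0≤t h)) (ℚ.+-monoʳ-≤ (P g * P h) (*-monoˡ (0≤V g h) (Θ-bound g h))) ⟩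
        t g * t h * (P g * P h + V g h * (x * count g * M̄ + x * ι d * R g h))
          ≡⟨ expand (t g) (t h) (P g) (P h) (V g h) x (count g) M̄ (ι d) (R g h) ⟩
        (t g * P g) * (t h * P h) + (t g * (x * count g)) * (M̄ * (t h * V g h)) + (t g * (x * ι d * R g h)) * (t h * V g h)
          ≤⟨ ℚ.+-mono-≤ (ℚ.+-monoʳ-≤ ((t g * P g) * (t h * P h))
               (*-monoʳ (0≤* 0≤M̄ (0≤* (0≤t h) (0≤V g h))) (count≤ g)))
               (*-monoˡ (0≤* (0≤t g) (0≤* (0≤* 0≤x (0≤ι d)) (0≤R g h)))
                 (subst (t h * V g h ≤_) (ℚ.*-identityˡ (P g)) (*-mono 0≤1 (0≤V g h) (t≤1 h) (V≤P g h)))) ⟩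
        (t g * P g) * (t h * P h) + (t g * L) * (M̄ * (t h * V g h)) + (t g * (x * ι d * R g h)) * P g
          ≡⟨ collect (t g) (t h) (P g) (P h) (V g h) x M̄ (ι d) (R g h) L ⟩
        (t g * P g) * (t h * P h) + L * M̄ * (t g * t h * V g h) + (t g * P g) * (x * ι d) * R g h ∎
        where
        expand : ∀ s t P Q V x c M k R → s * t * (P * Q + V * (x * c * M + x * k * R)) ≡
          (s * P) * (t * Q) + (s * (x * c)) * (M * (t * V)) + (s * (x * k * R)) * (t * V)
        expand = solve-∀ ℚ-ring
        collect : ∀ s t P Q V x M k R L →
          (s * P) * (t * Q) + (s * L) * (M * (t * V)) + (s * (x * k * R)) * P ≡
          (s * P) * (t * Q) + L * M * (s * t * V) + (s * P) * (x * k) * R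
        collect = solve-∀ ℚ-ring

      second-moment : Z ≤ mean * mean + L * M̄ * Z + L * (ι d * O ^ d) * mean
      second-moment = begin
        Z
          ≤⟨ ∑-mono (allFin N) (λ g → ∑-mono (allFin N) (pair-term g)) ⟩
        ∑ (allFin N) (λ g → ∑ (allFin N) (λ h →
          (t g * P g) * (t h * P h) + L * M̄ * (t g * t h * V g h) + (t g * P g) * (x * ι d) * R g h))
          ≡⟨ ∑-cong (allFin N) (λ g → trans
               (∑-+ (allFin N) (λ h → (t g * P g) * (t h * P h) + L * M̄ * (t g * t h * V g h)) (λ h → (t g * P g) * (x * ι d) * R g h))
               (cong₂ _+_ (trans (∑-+ (allFin N) (λ h → (t g * P g) * (t h * P h)) (λ h → L * M̄ * (t g * t h * V g h)))
                   (cong (∑ (allFin N) (λ h → (t g * P g) * (t h * P h)) +_) (∑-*ˡ (allFin N) (L * M̄) (λ h → t g * t h * V g h))))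
                 (∑-*ˡ (allFin N) ((t g * P g) * (x * ι d)) (R g)))) ⟩
        ∑ (allFin N) (λ g → A g + L * M̄ * B g + C g)
          ≡⟨ trans (∑-+ (allFin N) (λ g → A g + L * M̄ * B g) C)
               (cong (_+ ∑ (allFin N) C) (trans (∑-+ (allFin N) A (λ g → L * M̄ * B g))
                 (cong₂ _+_ (sym (∑-product (allFin N) (allFin N) (λ g → t g * P g) (λ h → t h * P h)))
                   (∑-*ˡ (allFin N) (L * M̄) B)))) ⟩
        mean * mean + L * M̄ * Z + ∑ (allFin N) C
          ≤⟨ ℚ.+-monoʳ-≤ (mean * mean + L * M̄ * Z) bad ⟩
        mean * mean + L * M̄ * Z + L * (ι d * O ^ d) * mean ∎
        where
        A B C : Fin N → ℚ
        A g = ∑ (allFin N) (λ h → (t g * P g) * (t h * P h))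
        B g = ∑ (allFin N) (λ h → t g * t h * V g h)
        C g = (t g * P g) * (x * ι d) * ∑ (allFin N) (R g)
        rearrange : ∀ t P x k c O → (t * P) * (x * k) * (c * O) ≡ (t * (x * c)) * (P * (k * O))
        rearrange = solve-∀ ℚ-ring
        rearrange′ : ∀ t P k O L → (t * L) * (P * (k * O)) ≡ L * (k * O) * (t * P)
        rearrange′ = solve-∀ ℚ-ring
        bad : ∑ (allFin N) C ≤ L * (ι d * O ^ d) * mean
        bad = begin
          ∑ (allFin N) C
            ≤⟨ ∑-mono (allFin N) (λ g → begin
                 (t g * P g) * (x * ι d) * ∑ (allFin N) (R g)
                   ≤⟨ *-monoˡ (0≤* (0≤* (0≤t g) (0≤P g)) (0≤* 0≤x (0≤ι d))) (R-total g) ⟩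
                 (t g * P g) * (x * ι d) * (count g * O ^ d)
                   ≡⟨ rearrange (t g) (P g) x (ι d) (count g) (O ^ d) ⟩
                 (t g * (x * count g)) * (P g * (ι d * O ^ d))
                   ≤⟨ *-monoʳ (0≤* (0≤P g) (0≤* (0≤ι d) (0≤^ d 0≤O))) (count≤ g) ⟩
                 (t g * L) * (P g * (ι d * O ^ d))
                   ≡⟨ rearrange′ (t g) (P g) (ι d) (O ^ d) L ⟩
                 L * (ι d * O ^ d) * (t g * P g) ∎) ⟩
          ∑ (allFin N) (λ g → L * (ι d * O ^ d) * (t g * P g))
            ≡⟨ ∑-*ˡ (allFin N) (L * (ι d * O ^ d)) (λ g → t g * P g) ⟩
          L * (ι d * O ^ d) * mean ∎

      -- On the event D we have X ≤ Y, hence mean² ≤ (X - mean)² + 2 mean Y there.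
      chebyshev : ∀ {D : Subset N → ℚ} → (∀ S → 0ℚ ≤ D S) → (∀ S → D S ≤ 1ℚ) →
        (∀ S → 0ℚ < D S → X S ≤ Y S) → mean * mean * E D ≤ Z - mean * mean + ι 2 * mean * E Y
      chebyshev {D} 0≤D D≤1 X≤Y = begin
        mean * mean * E D
          ≡⟨ E-*ˡ (mean * mean) D ⟨
        E (λ S → mean * mean * D S)
          ≤⟨ E-mono pointwise ⟩
        E (λ S → X S * X S + ((- (ι 2 * mean)) * X S + (mean * mean + ι 2 * mean * Y S)))
          ≡⟨ trans (E-+ (λ S → X S * X S) (λ S → (- (ι 2 * mean)) * X S + (mean * mean + ι 2 * mean * Y S)))
               (cong₂ _+_ E-X² (trans (E-+ (λ S → (- (ι 2 * mean)) * X S) (λ S → mean * mean + ι 2 * mean * Y S))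
                 (cong₂ _+_ (trans (E-*ˡ (- (ι 2 * mean)) X) (cong ((- (ι 2 * mean)) *_) E-X))
                   (trans (E-+ (λ _ → mean * mean) (λ S → ι 2 * mean * Y S))
                     (cong₂ _+_ (E-const {N} (mean * mean)) (E-*ˡ (ι 2 * mean) Y)))))) ⟩
        Z + ((- (ι 2 * mean)) * mean + (mean * mean + ι 2 * mean * E Y))
          ≡⟨ identity Z mean (E Y) ⟩
        Z - mean * mean + ι 2 * mean * E Y ∎
        where
        identity : ∀ z m y → z + ((- ((1ℚ + (1ℚ + 0ℚ)) * m)) * m + (m * m + (1ℚ + (1ℚ + 0ℚ)) * m * y)) ≡
          z - m * m + (1ℚ + (1ℚ + 0ℚ)) * m * y
        identity = solve-∀ ℚ-ring
        0≤Y : ∀ S → 0ℚ ≤ Y S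
        0≤Y S = 0≤∑ (allFin N) (λ h → 0≤* (0≤t h) (0≤* (0≤avoids (supports h) S) (0≤degenerate h S)))
        pointwise : ∀ S → mean * mean * D S ≤ X S * X S + ((- (ι 2 * mean)) * X S + (mean * mean + ι 2 * mean * Y S))
        pointwise S with 0ℚ ℚ.<? D S
        ... | yes 0<D = begin
          mean * mean * D S
            ≤⟨ *≤1≤ (0≤x² mean) (D≤1 S) ⟩
          mean * mean
            ≤⟨ ≤-byDiff (on-event mean (X S) (Y S)) (0≤+ (0≤x² (X S)) (0≤* (0≤* (0≤ι 2) 0≤mean) (≤⇒0≤- (X≤Y S 0<D)))) ⟩
          X S * X S + ((- (ι 2 * mean)) * X S + (mean * mean + ι 2 * mean * Y S)) ∎
          where
          on-event : ∀ m x y → x * x + ((- ((1ℚ + (1ℚ + 0ℚ)) * m)) * x + (m * m + (1ℚ + (1ℚ + 0ℚ)) * m * y)) - m * m ≡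
            x * x + (1ℚ + (1ℚ + 0ℚ)) * m * (y - x)
          on-event = solve-∀ ℚ-ring
        ... | no  0≮D = begin
          mean * mean * D S
            ≤⟨ *-monoˡ (0≤x² mean) (ℚ.≮⇒≥ 0≮D) ⟩
          mean * mean * 0ℚ
            ≤⟨ ≤-byDiff (off-event mean (X S) (Y S)) (0≤+ (0≤x² (X S - mean)) (0≤* (0≤* (0≤ι 2) 0≤mean) (0≤Y S))) ⟩
          X S * X S + ((- (ι 2 * mean)) * X S + (mean * mean + ι 2 * mean * Y S)) ∎
          where
          off-event : ∀ m x y → x * x + ((- ((1ℚ + (1ℚ + 0ℚ)) * m)) * x + (m * m + (1ℚ + (1ℚ + 0ℚ)) * m * y)) - m * m * 0ℚ ≡
            (x - m) * (x - m) + (1ℚ + (1ℚ + 0ℚ)) * m * y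
          off-event = solve-∀ ℚ-ring

archimedean : ∀ q → ∃ λ n → q ≤ ι n
archimedean q@(mkℚ (ℤ.+ n) k _) = n , subst (q ≤_) (/1≡ι n) (ℚ.toℚᵘ-cancel-≤
  (ℚᵘ.≤-respʳ-≃ (ℚᵘ.≃-sym (ℚ.toℚᵘ-fromℚᵘ (mkℚᵘ (ℤ.+ n) 0)))
    (ℚᵘ.*≤* (ℤ.*-monoˡ-≤-nonNeg (ℤ.+ n) (ℤ.+≤+ (ℕ.s≤s ℕ.z≤n))))))
archimedean q@(mkℚ ℤ.-[1+ _ ] _ _) = 0 , ℚ.<⇒≤ (ℚ.negative⁻¹ q)

archimedean-inverse : ∀ {η} → 0ℚ < η → ∃ λ n → 1ℚ ≤ ι n * η
archimedean-inverse {η} η>0 =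
  let n , 1/η≤n = archimedean (1/ η)
  in n , subst (_≤ ι n * η) (ℚ.*-inverseˡ η) (*-monoʳ (ℚ.<⇒≤ η>0) 1/η≤n)
  where instance
    η≢0 : NonZero η
    η≢0 = ℚ.pos⇒nonZero η {{positive η>0}}

-- Partial sums of the exponential series

inverse-! : ℕ → ℚ
inverse-! k = (ℤ.+ 1 / (k !)) {{k ℕ.!≢0}}

term : ℚ → ℕ → ℚ
term a k = a ^ k * inverse-! k

expSum : ℚ → ℕ → ℚ
expSum a zero    = 0ℚ
expSum a (suc k) = expSum a k + term a k

!*inverse-! : ∀ k → ι (k !) * inverse-! k ≡ 1ℚ
!*inverse-! k = ι*1/ (k !) {{k ℕ.!≢0}}

0<ι! : ∀ k → 0ℚ < ι (k !)
0<ι! k = ℚ.<-≤-trans 0<1 (ι-mono (ℕ.>-nonZero⁻¹ (k !) {{k ℕ.!≢0}}))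

0≤inverse-! : ∀ k → 0ℚ ≤ inverse-! k
0≤inverse-! k = *-cancelˡ (0<ι! k)
  (subst₂ _≤_ (sym (ℚ.*-zeroʳ (ι (k !)))) (sym (!*inverse-! k)) 0≤1)

inverse-!-suc : ∀ k → ι (suc k) * inverse-! (suc k) ≡ inverse-! k
inverse-!-suc k = begin
  s * j                           ≡⟨ trans (cong (_* (s * j)) (!*inverse-! k)) (ℚ.*-identityˡ (s * j)) ⟨
  ι (k !) * i * (s * j)           ≡⟨ rearrange (ι (k !)) i s j ⟩
  i * (s * ι (k !) * j)           ≡⟨ cong (λ z → i * (z * j)) (ι-* (suc k) (k !)) ⟨
  i * (ι (suc k !) * j)           ≡⟨ cong (i *_) (!*inverse-! (suc k)) ⟩
  i * 1ℚ                          ≡⟨ ℚ.*-identityʳ i ⟩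
  i                               ∎
  where
  open ≡-Reasoning
  s = ι (suc k)
  i = inverse-! k
  j = inverse-! (suc k)
  rearrange : ∀ f i s j → f * i * (s * j) ≡ i * (s * f * j)
  rearrange = solve-∀ ℚ-ring

term-suc : ∀ a k → ι (suc k) * term a (suc k) ≡ a * term a k
term-suc a k = trans (rearrange (ι (suc k)) a (a ^ k) (inverse-! (suc k)))
  (cong (λ z → a * (a ^ k * z)) (inverse-!-suc k))
  where
  rearrange : ∀ s a x i → s * (a * x * i) ≡ a * (x * (s * i))
  rearrange = solve-∀ ℚ-ring

0≤term : ∀ {a} k → 0ℚ ≤ a → 0ℚ ≤ term a k
0≤term k a≥0 = 0≤* (0≤^ k a≥0) (0≤inverse-! k)

term-mono : ∀ {a b} k → 0ℚ ≤ a → a ≤ b → term a k ≤ term b k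
term-mono k a≥0 a≤b = *-monoʳ (0≤inverse-! k) (^-mono k a≥0 a≤b)

expSum-mono : ∀ {a b} k → 0ℚ ≤ a → a ≤ b → expSum a k ≤ expSum b k
expSum-mono zero    a≥0 a≤b = ℚ.≤-refl
expSum-mono (suc k) a≥0 a≤b = ℚ.+-mono-≤ (expSum-mono k a≥0 a≤b) (term-mono k a≥0 a≤b)

expSum-monoʳ : ∀ {a j k} → 0ℚ ≤ a → j ℕ.≤ k → expSum a j ≤ expSum a k
expSum-monoʳ {a} {j} a≥0 j≤k = go (ℕ.≤⇒≤′ j≤k)
  where
  go : ∀ {k} → j ℕ.≤′ k → expSum a j ≤ expSum a k
  go (ℕ.≤′-reflexive refl) = ℚ.≤-refl
  go (ℕ.≤′-step {k} h)     = ℚ.≤-trans (go h) (≤+nonneg (0≤term k a≥0))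

0≤expSum : ∀ {a} k → 0ℚ ≤ a → 0ℚ ≤ expSum a k
0≤expSum k a≥0 = expSum-monoʳ {j = 0} {k = k} a≥0 ℕ.z≤n

-- Cauchy products and the addition formula for partial exponential sums

convolution : ℕ → (ℕ → ℚ) → (ℕ → ℚ) → ℚ
convolution zero    f g = f 0 * g 0
convolution (suc k) f g = f 0 * g (suc k) + convolution k (f ∘ suc) g

module _ where
  open ≡-Reasoning

  convolution-cong : ∀ k {f f′ g g′} → (∀ i → f i ≡ f′ i) → (∀ i → g i ≡ g′ i) →
                     convolution k f g ≡ convolution k f′ g′
  convolution-cong zero    hf hg = cong₂ _*_ (hf 0) (hg 0)
  convolution-cong (suc k) hf hg = cong₂ _+_ (cong₂ _*_ (hf 0) (hg (suc k))) (convolution-cong k (hf ∘ suc) hg)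

  convolution-+ˡ : ∀ k f f′ g → convolution k (λ i → f i + f′ i) g ≡ convolution k f g + convolution k f′ g
  convolution-+ˡ zero    f f′ g = ℚ.*-distribʳ-+ (g 0) (f 0) (f′ 0)
  convolution-+ˡ (suc k) f f′ g = trans
    (cong ((f 0 + f′ 0) * g (suc k) +_) (convolution-+ˡ k (f ∘ suc) (f′ ∘ suc) g))
    (identity (f 0) (f′ 0) (g (suc k)) (convolution k (f ∘ suc) g) (convolution k (f′ ∘ suc) g))
    where
    identity : ∀ a b g x y → (a + b) * g + (x + y) ≡ (a * g + x) + (b * g + y)
    identity = solve-∀ ℚ-ring

  convolution-+ʳ : ∀ k f g g′ → convolution k f (λ i → g i + g′ i) ≡ convolution k f g + convolution k f g′
  convolution-+ʳ zero    f g g′ = ℚ.*-distribˡ-+ (f 0) (g 0) (g′ 0)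
  convolution-+ʳ (suc k) f g g′ = trans
    (cong (f 0 * (g (suc k) + g′ (suc k)) +_) (convolution-+ʳ k (f ∘ suc) g g′))
    (identity (f 0) (g (suc k)) (g′ (suc k)) (convolution k (f ∘ suc) g) (convolution k (f ∘ suc) g′))
    where
    identity : ∀ f a b x y → f * (a + b) + (x + y) ≡ (f * a + x) + (f * b + y)
    identity = solve-∀ ℚ-ring

  convolution-*ˡ : ∀ k c f g → convolution k (λ i → c * f i) g ≡ c * convolution k f g
  convolution-*ˡ zero    c f g = ℚ.*-assoc c (f 0) (g 0)
  convolution-*ˡ (suc k) c f g = trans
    (cong (c * f 0 * g (suc k) +_) (convolution-*ˡ k c (f ∘ suc) g))
    (identity c (f 0) (g (suc k)) (convolution k (f ∘ suc) g))
    where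
    identity : ∀ c f g x → c * f * g + c * x ≡ c * (f * g + x)
    identity = solve-∀ ℚ-ring

  convolution-*ʳ : ∀ k c f g → convolution k f (λ i → c * g i) ≡ c * convolution k f g
  convolution-*ʳ zero    c f g = identity c (f 0) (g 0)
    where
    identity : ∀ c f g → f * (c * g) ≡ c * (f * g)
    identity = solve-∀ ℚ-ring
  convolution-*ʳ (suc k) c f g = trans
    (cong (f 0 * (c * g (suc k)) +_) (convolution-*ʳ k c (f ∘ suc) g))
    (identity c (f 0) (g (suc k)) (convolution k (f ∘ suc) g))
    where
    identity : ∀ c f g x → f * (c * g) + c * x ≡ c * (f * g + x)
    identity = solve-∀ ℚ-ring

  convolution-shift : ∀ k f g → convolution (suc k) f g ≡ convolution k f (g ∘ suc) + f (suc k) * g 0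
  convolution-shift zero    f g = refl
  convolution-shift (suc k) f g = trans
    (cong (f 0 * g (suc (suc k)) +_) (convolution-shift k (f ∘ suc) g))
    (sym (ℚ.+-assoc (f 0 * g (suc (suc k))) (convolution k (f ∘ suc) (g ∘ suc)) (f (suc (suc k)) * g 0)))

  derivative : (ℕ → ℚ) → ℕ → ℚ
  derivative f i = ι (suc i) * f (suc i)

  -- The product rule for formal power series, read off coefficientwise.
  leibniz : ∀ k f g → ι (suc k) * convolution (suc k) f g ≡
                      convolution k (derivative f) g + convolution k f (derivative g)
  leibniz zero f g = identity (f 0) (f 1) (g 0) (g 1)
    where
    identity : ∀ a b c d → (1ℚ + 0ℚ) * (a * d + b * c) ≡ ((1ℚ + 0ℚ) * b) * c + a * ((1ℚ + 0ℚ) * d)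
    identity = solve-∀ ℚ-ring
  leibniz (suc k) f g = begin
    (1ℚ + s) * (f 0 * g₂ + (f 1 * g₁ + convolution k f″ g))
      ≡⟨ identity₁ s (f 0) g₂ (f 1 * g₁) (convolution k f″ g) ⟩
    f 0 * ((1ℚ + s) * g₂) + s * (f 1 * g₁ + convolution k f″ g) + (f 1 * g₁ + convolution k f″ g)
      ≡⟨ cong (λ z → f 0 * ((1ℚ + s) * g₂) + z + (f 1 * g₁ + convolution k f″ g)) (leibniz k (f ∘ suc) g) ⟩
    f 0 * ((1ℚ + s) * g₂) + (convolution k (derivative (f ∘ suc)) g + convolution k (f ∘ suc) (derivative g))
      + (f 1 * g₁ + convolution k f″ g)
      ≡⟨ identity₂ (f 0 * ((1ℚ + s) * g₂)) (convolution k (derivative (f ∘ suc)) g)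
           (convolution k (f ∘ suc) (derivative g)) (f 1) g₁ (convolution k f″ g) ⟩
    ((1ℚ + 0ℚ) * f 1) * g₁ + (convolution k f″ g + convolution k (derivative (f ∘ suc)) g)
      + (f 0 * ((1ℚ + s) * g₂) + convolution k (f ∘ suc) (derivative g))
      ≡⟨ cong (λ z → ((1ℚ + 0ℚ) * f 1) * g₁ + z + (f 0 * ((1ℚ + s) * g₂) + convolution k (f ∘ suc) (derivative g)))
           (trans (sym (convolution-+ˡ k f″ (derivative (f ∘ suc)) g))
             (convolution-cong k (λ i → identity₃ (ι (suc i)) (f (suc (suc i)))) (λ _ → refl))) ⟩
    convolution (suc k) (derivative f) g + convolution (suc k) f (derivative g) ∎
    where
    s = ι (suc k)
    f″ : ℕ → ℚ
    f″ i = f (suc (suc i))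
    g₁ = g (suc k)
    g₂ = g (suc (suc k))
    identity₁ : ∀ s f g a b → (1ℚ + s) * (f * g + (a + b)) ≡ f * ((1ℚ + s) * g) + s * (a + b) + (a + b)
    identity₁ = solve-∀ ℚ-ring
    identity₂ : ∀ a b c f g e → a + (b + c) + (f * g + e) ≡ ((1ℚ + 0ℚ) * f) * g + (e + b) + (a + c)
    identity₂ = solve-∀ ℚ-ring
    identity₃ : ∀ n f → f + n * f ≡ (1ℚ + n) * f
    identity₃ = solve-∀ ℚ-ring

  *-cancelˡ-≡ : ∀ {c a b} → 0ℚ < c → c * a ≡ c * b → a ≡ b
  *-cancelˡ-≡ c>0 eq = ℚ.≤-antisym (*-cancelˡ c>0 (ℚ.≤-reflexive eq)) (*-cancelˡ c>0 (ℚ.≤-reflexive (sym eq)))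

  -- The binomial theorem without binomial coefficients: by `leibniz`, both sides obey the recursion
  -- that encodes the differential equation with factor `a + b`.
  convolution-term : ∀ k a b → convolution k (term a) (term b) ≡ term (a + b) k
  convolution-term zero    a b = refl
  convolution-term (suc k) a b = *-cancelˡ-≡ (0<ι k) (begin
    ι (suc k) * convolution (suc k) (term a) (term b)
      ≡⟨ leibniz k (term a) (term b) ⟩
    convolution k (derivative (term a)) (term b) + convolution k (term a) (derivative (term b))
      ≡⟨ cong₂ _+_ (convolution-cong k {g = term b} (term-suc a) (λ _ → refl))
                   (convolution-cong k {f = term a} (λ _ → refl) (term-suc b)) ⟩
    convolution k (λ i → a * term a i) (term b) + convolution k (term a) (λ i → b * term b i)
      ≡⟨ cong₂ _+_ (convolution-*ˡ k a (term a) (term b)) (convolution-*ʳ k b (term a) (term b)) ⟩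
    a * convolution k (term a) (term b) + b * convolution k (term a) (term b)
      ≡⟨ ℚ.*-distribʳ-+ (convolution k (term a) (term b)) a b ⟨
    (a + b) * convolution k (term a) (term b)
      ≡⟨ cong ((a + b) *_) (convolution-term k a b) ⟩
    (a + b) * term (a + b) k
      ≡⟨ term-suc (a + b) k ⟨
    ι (suc k) * term (a + b) (suc k) ∎)

  -- The terms of total degree below `k` are grouped by their degree in `a`. The last summand of the
  -- convolution is zero, as it meets the empty sum `expSum b 0`.
  expSum-+ : ∀ k a b → expSum (a + b) k ≡ convolution k (term a) (expSum b)
  expSum-+ zero    a b = sym (ℚ.*-zeroʳ (term a 0))
  expSum-+ (suc k) a b = begin
    expSum (a + b) k + term (a + b) k
      ≡⟨ cong₂ _+_ (expSum-+ k a b) (sym (convolution-term k a b)) ⟩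
    convolution k (term a) (expSum b) + convolution k (term a) (term b)
      ≡⟨ convolution-+ʳ k (term a) (expSum b) (term b) ⟨
    convolution k (term a) (expSum b ∘ suc)
      ≡⟨ ℚ.+-identityʳ (convolution k (term a) (expSum b ∘ suc)) ⟨
    convolution k (term a) (expSum b ∘ suc) + 0ℚ
      ≡⟨ cong (convolution k (term a) (expSum b ∘ suc) +_) (ℚ.*-zeroʳ (term a (suc k))) ⟨
    convolution k (term a) (expSum b ∘ suc) + term a (suc k) * 0ℚ
      ≡⟨ convolution-shift k (term a) (expSum b) ⟨
    convolution (suc k) (term a) (expSum b) ∎

  prefix : ℕ → (ℕ → ℚ) → ℚ
  prefix zero    f = 0ℚ
  prefix (suc k) f = f 0 + prefix k (f ∘ suc)

  prefix-snoc : ∀ k f → prefix k f + f k ≡ prefix (suc k) f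
  prefix-snoc zero    f = ℚ.+-comm 0ℚ (f 0)
  prefix-snoc (suc k) f = trans (ℚ.+-assoc (f 0) (prefix k (f ∘ suc)) (f (suc k))) (cong (f 0 +_) (prefix-snoc k (f ∘ suc)))

  expSum-prefix : ∀ a k → expSum a k ≡ prefix k (term a)
  expSum-prefix a zero    = refl
  expSum-prefix a (suc k) = trans (cong (_+ term a k) (expSum-prefix a k)) (prefix-snoc k (term a))

module _ where
  open ℚ.≤-Reasoning

  -- The first `j` values of `f` meet values of `g` at indices above `k`, where `v` is a lower
  -- bound; the remaining ones keep their own convolution.
  convolution-split : ∀ j k {f g v} → (∀ i → 0ℚ ≤ f i) → (∀ i → k ℕ.≤ i → i ℕ.≤ j ℕ.+ k → v ≤ g i) →
    v * prefix j f + convolution k (f ∘ (j ℕ.+_)) g ≤ convolution (j ℕ.+ k) f g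
  convolution-split zero    k {f} {g} {v} f≥0 h = ℚ.≤-reflexive (identity v (convolution k f g))
    where
    identity : ∀ v c → v * 0ℚ + c ≡ c
    identity = solve-∀ ℚ-ring
  convolution-split (suc j) k {f} {g} {v} f≥0 h = begin
    v * (f 0 + prefix j (f ∘ suc)) + c
      ≡⟨ identity v (f 0) (prefix j (f ∘ suc)) c ⟩
    f 0 * v + (v * prefix j (f ∘ suc) + c)
      ≤⟨ ℚ.+-mono-≤ (*-monoˡ (f≥0 0) (h (suc j ℕ.+ k) (ℕ.m≤n+m k (suc j)) ℕ.≤-refl))
           (convolution-split j k (f≥0 ∘ suc) (λ i k≤i i≤ → h i k≤i (ℕ.m≤n⇒m≤1+n i≤))) ⟩
    f 0 * g (suc j ℕ.+ k) + convolution (j ℕ.+ k) (f ∘ suc) g ∎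
    where
    c = convolution k (f ∘ (suc j ℕ.+_)) g
    identity : ∀ v a b c → v * (a + b) + c ≡ a * v + (v * b + c)
    identity = solve-∀ ℚ-ring

  convolution-≥ : ∀ k {f g z b} → (∀ i → 0ℚ ≤ f i) → (∀ i → f i ≤ z) → 0ℚ ≤ b → (∀ i → i ℕ.≤ k → - b ≤ g i) →
    - (ι (suc k) * (z * b)) ≤ convolution k f g
  convolution-≥ zero {f} {g} {z} {b} f≥0 f≤z b≥0 g≥ = begin
    - ((1ℚ + 0ℚ) * (z * b))   ≡⟨ identity₁ z b ⟩
    - (z * b)                 ≤⟨ ℚ.neg-antimono-≤ (*-monoʳ b≥0 (f≤z 0)) ⟩
    - (f 0 * b)               ≡⟨ identity₂ (f 0) b ⟩
    f 0 * (- b)               ≤⟨ *-monoˡ (f≥0 0) (g≥ 0 ℕ.z≤n) ⟩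
    f 0 * g 0                 ∎
    where
    identity₁ : ∀ z b → - ((1ℚ + 0ℚ) * (z * b)) ≡ - (z * b)
    identity₁ = solve-∀ ℚ-ring
    identity₂ : ∀ z b → - (z * b) ≡ z * (- b)
    identity₂ = solve-∀ ℚ-ring
  convolution-≥ (suc k) {f} {g} {z} {b} f≥0 f≤z b≥0 g≥ = begin
    - ((1ℚ + ι (suc k)) * (z * b))                ≡⟨ identity₁ (ι (suc k)) z b ⟩
    - (z * b) + - (ι (suc k) * (z * b))
      ≤⟨ ℚ.+-mono-≤ (ℚ.≤-trans (ℚ.neg-antimono-≤ (*-monoʳ b≥0 (f≤z 0))) (ℚ.≤-trans (ℚ.≤-reflexive (identity₂ (f 0) b))
             (*-monoˡ (f≥0 0) (g≥ (suc k) ℕ.≤-refl))))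
           (convolution-≥ k (f≥0 ∘ suc) (f≤z ∘ suc) b≥0 (λ i i≤k → g≥ i (ℕ.m≤n⇒m≤1+n i≤k))) ⟩
    f 0 * g (suc k) + convolution k (f ∘ suc) g   ∎
    where
    identity₁ : ∀ s z b → - ((1ℚ + s) * (z * b)) ≡ - (z * b) + - (s * (z * b))
    identity₁ = solve-∀ ℚ-ring
    identity₂ : ∀ z b → - (z * b) ≡ z * (- b)
    identity₂ = solve-∀ ℚ-ring

  0≤convolution : ∀ k {f g} → (∀ i → 0ℚ ≤ f i) → (∀ i → 0ℚ ≤ g i) → 0ℚ ≤ convolution k f g
  0≤convolution zero    f≥0 g≥0 = 0≤* (f≥0 0) (g≥0 0)
  0≤convolution (suc k) f≥0 g≥0 = 0≤+ (0≤* (f≥0 0) (g≥0 (suc k))) (0≤convolution k (f≥0 ∘ suc) g≥0)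

  expSum-*≤ : ∀ {a b} j k → 0ℚ ≤ a → 0ℚ ≤ b → expSum a j * expSum b k ≤ expSum (a + b) (j ℕ.+ k)
  expSum-*≤ {a} {b} j k a≥0 b≥0 = begin
    expSum a j * expSum b k
      ≡⟨ trans (cong (_* expSum b k) (expSum-prefix a j)) (ℚ.*-comm (prefix j (term a)) (expSum b k)) ⟩
    expSum b k * prefix j (term a)
      ≤⟨ ≤+nonneg (0≤convolution k (λ i → 0≤term (j ℕ.+ i) a≥0) (λ i → 0≤expSum i b≥0)) ⟩
    expSum b k * prefix j (term a) + convolution k (term a ∘ (j ℕ.+_)) (expSum b)
      ≤⟨ convolution-split j k (λ i → 0≤term i a≥0) (λ i k≤i _ → expSum-monoʳ b≥0 k≤i) ⟩
    convolution (j ℕ.+ k) (term a) (expSum b)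
      ≡⟨ expSum-+ (j ℕ.+ k) a b ⟨
    expSum (a + b) (j ℕ.+ k) ∎

  -- The additional term is needed for `m = 0`, where the empty product 1 has to be a partial sum at
  -- 0.
  expSum-^≤ : ∀ {a} m k → 0ℚ ≤ a → expSum a k ^ m ≤ expSum (ι m * a) (suc (m ℕ.* k))
  expSum-^≤ {a} zero    k a≥0 = ℚ.≤-refl
  expSum-^≤ {a} (suc m) k a≥0 = begin
    expSum a k * expSum a k ^ m
      ≤⟨ *-monoˡ (0≤expSum k a≥0) (expSum-^≤ m k a≥0) ⟩
    expSum a k * expSum (ι m * a) (suc (m ℕ.* k))
      ≤⟨ expSum-*≤ k (suc (m ℕ.* k)) a≥0 (0≤* (0≤ι m) a≥0) ⟩
    expSum (a + ι m * a) (k ℕ.+ suc (m ℕ.* k))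
      ≡⟨ cong₂ expSum (identity a (ι m)) (ℕ.+-suc k (m ℕ.* k)) ⟩
    expSum (ι (suc m) * a) (suc (suc m ℕ.* k)) ∎
    where
    identity : ∀ a m → a + m * a ≡ (1ℚ + m) * a
    identity = solve-∀ ℚ-ring

  expSum-2 : ∀ a → expSum a 2 ≡ 1ℚ + a
  expSum-2 a = identity a
    where
    identity : ∀ a → 0ℚ + 1ℚ * 1ℚ + (a * 1ℚ) * 1ℚ ≡ 1ℚ + a
    identity = solve-∀ ℚ-ring

  -- Beyond `2a` each term is at most half its predecessor. Hence the partial sum plus twice the
  -- next term no longer increases, and its value at `n` is a bound.
  expSum-bounded : ∀ {a} → 0ℚ ≤ a → ∃ λ b → 0ℚ ≤ b × ∀ k → expSum a k ≤ b
  expSum-bounded {a} a≥0 with archimedean (a + a)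
  ... | n , 2a≤n = expSum a n + (term a n + term a n) ,
                   0≤+ (0≤expSum n a≥0) (0≤+ (0≤term n a≥0) (0≤term n a≥0)) , bound
    where
    b : ℕ → ℚ
    b j = expSum a j + (term a j + term a j)
    halve : ∀ j → n ℕ.≤ j → term a (suc j) + term a (suc j) ≤ term a j
    halve j n≤j = *-cancelˡ (0<ι j) (begin
      ι (suc j) * (term a (suc j) + term a (suc j))
        ≡⟨ identity₁ (ι (suc j)) (term a (suc j)) ⟩
      ι (suc j) * term a (suc j) + ι (suc j) * term a (suc j)
        ≡⟨ cong (λ z → z + z) (term-suc a j) ⟩
      a * term a j + a * term a j
        ≡⟨ ℚ.*-distribʳ-+ (term a j) a a ⟨
      (a + a) * term a j
        ≤⟨ *-monoʳ (0≤term j a≥0) (ℚ.≤-trans 2a≤n (ι-mono (ℕ.m≤n⇒m≤1+n n≤j))) ⟩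
      ι (suc j) * term a j ∎)
      where
      identity₁ : ∀ s t → s * (t + t) ≡ s * t + s * t
      identity₁ = solve-∀ ℚ-ring
    descend : ∀ {j} → n ℕ.≤′ j → b j ≤ b n
    descend (ℕ.≤′-reflexive refl) = ℚ.≤-refl
    descend (ℕ.≤′-step {j} h) = ℚ.≤-trans (begin
      expSum a j + term a j + (term a (suc j) + term a (suc j))
        ≤⟨ ℚ.+-monoʳ-≤ (expSum a j + term a j) (halve j (ℕ.≤′⇒≤ h)) ⟩
      expSum a j + term a j + term a j
        ≡⟨ ℚ.+-assoc (expSum a j) (term a j) (term a j) ⟩
      b j ∎) (descend h)
    bound : ∀ k → expSum a k ≤ b n
    bound k with ℕ.≤-total k n
    ... | inj₁ k≤n = ℚ.≤-trans (expSum-monoʳ a≥0 k≤n) (≤+nonneg (0≤+ (0≤term n a≥0) (0≤term n a≥0)))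
    ... | inj₂ n≤k = ℚ.≤-trans (≤+nonneg (0≤+ (0≤term k a≥0) (0≤term k a≥0))) (descend (ℕ.≤⇒≤′ n≤k))

  term-vanishes : ∀ {a} → 0ℚ ≤ a → ∀ z → ∃ λ n → ∀ j → n ℕ.≤ j → ι z * term a j ≤ 1ℚ
  term-vanishes {a} a≥0 z with expSum-bounded a≥0
  ... | b , b≥0 , bounded with archimedean (ι z * (a * b))
  ...   | n , zab≤n = suc n , λ { (suc j) (ℕ.s≤s n≤j) → *-cancelˡ (0<ι j) (begin
      ι (suc j) * (ι z * term a (suc j))   ≡⟨ exchange (ι (suc j)) (ι z) (term a (suc j)) ⟩
      ι z * (ι (suc j) * term a (suc j))   ≡⟨ cong (ι z *_) (term-suc a j) ⟩
      ι z * (a * term a j)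
        ≤⟨ *-monoˡ (0≤ι z) (*-monoˡ a≥0 (ℚ.≤-trans (nonneg+≤ (0≤expSum j a≥0)) (bounded (suc j)))) ⟩
      ι z * (a * b)                        ≤⟨ zab≤n ⟩
      ι n                                  ≤⟨ ι-mono (ℕ.m≤n⇒m≤1+n n≤j) ⟩
      ι (suc j)                            ≡⟨ ℚ.*-identityʳ (ι (suc j)) ⟨
      ι (suc j) * 1ℚ                       ∎) }
    where
    exchange : ∀ a b c → a * (b * c) ≡ b * (a * c)
    exchange = solve-∀ ℚ-ring

  -- A single term suffices: that of degree `k + 1`, whose denominator is cancelled by one of its
  -- factors `a`.
  power≤expSum : ∀ {a} k → ι (suc k !) ≤ a → a ^ k ≤ expSum a (suc (suc k))
  power≤expSum {a} k big = begin
    a ^ k                            ≡⟨ ℚ.*-identityˡ (a ^ k) ⟨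
    1ℚ * a ^ k                       ≡⟨ cong (_* a ^ k) (!*inverse-! (suc k)) ⟨
    ι (suc k !) * inverse-! (suc k) * a ^ k
      ≤⟨ *-monoʳ (0≤^ k a≥0) (*-monoʳ (0≤inverse-! (suc k)) big) ⟩
    a * inverse-! (suc k) * a ^ k    ≡⟨ identity a (inverse-! (suc k)) (a ^ k) ⟩
    term a (suc k)                   ≤⟨ nonneg+≤ (0≤expSum (suc k) a≥0) ⟩
    expSum a (suc (suc k))           ∎
    where
    a≥0 = ℚ.≤-trans (0≤ι (suc k !)) big
    identity : ∀ a i x → a * i * x ≡ a * x * i
    identity = solve-∀ ℚ-ring

-- The estimate for rational parameters

ι!≤^ : ∀ {d} k → k ℕ.≤ d → ι (k !) ≤ ι d ^ k
ι!≤^ zero    _   = ℚ.≤-refl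
ι!≤^ {d} (suc k) k<d = subst (_≤ ι d ^ suc k) (sym (ι-* (suc k) (k !)))
  (*-mono (0≤ι d) (0≤ι (k !)) (ι-mono k<d) (ι!≤^ k (ℕ.<⇒≤ k<d)))

^-* : ∀ a m n → a ^ (m ℕ.* n) ≡ (a ^ m) ^ n
^-* a m n = sym (^-assocʳ a m n)

bernoulli-exp : ∀ {u} m → 0ℚ ≤ u → ∃ λ k → (1ℚ + u) ^ m ≤ expSum (ι m * u) k
bernoulli-exp {u} m u≥0 = suc (m ℕ.* 2) , subst (λ z → z ^ m ≤ expSum (ι m * u) (suc (m ℕ.* 2))) (expSum-2 u) (expSum-^≤ m 2 u≥0)

-- With u slightly larger than x we have (1 + u)(1 - x) ≥ 1, while M ≥ exp L ≥ (1 + u)^((K+1)j) for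
-- the least multiple Kj > n; K = 4F leaves enough room for rounding n up.
module Missing (F : ℕ) (2≤F : 2 ℕ.≤ F) where
  open ℚ.≤-Reasoning

  K : ℕ
  K = 4 ℕ.* F

  instance
    K≢0 : ℕ.NonZero K
    K≢0 = ℕ.m*n≢0 4 F {{_}} {{ℕ.>-nonZero (ℕ.≤-trans (ℕ.s≤s ℕ.z≤n) 2≤F)}}

  missing-power : ∀ {L x M} n → 0ℚ ≤ x → ι (suc K) * x ≤ 1ℚ → ι (25 ℕ.* (F ℕ.* F)) ≤ L → 0ℚ ≤ L →
    (∀ k → expSum L k ≤ M) → ι F * (x * ι n) ≤ ι (F ℕ.∸ 1) * L → M ≤ (M * (1ℚ - x) ^ n) ^ suc K
  missing-power {L} {x} {M} n x≥0 Kx≤1 25F²≤L L≥0 exp≤M few = begin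
    M
      ≤⟨ ≤*1≤ M≥0 (1≤^ K amplified) ⟩
    -- The `K`-th power of `amplified` has exponent `(K + 1) K j`, at least `(K + 1) n` because
    -- `K j` is `n` rounded up; together with the leading `M` it becomes a `(K + 1)`-st power.
    M * (M * y ^ (suc K ℕ.* j)) ^ K
      ≡⟨ cong (M *_) (trans (^-distrib-* M (y ^ (suc K ℕ.* j)) K)
           (cong (M ^ K *_) (trans (cong (λ z → z ^ K) (^-* y (suc K) j)) (sym (trans (cong (λ i → (y ^ suc K) ^ i) (ℕ.*-comm K j)) (^-* (y ^ suc K) j K)))))) ⟩
    M * (M ^ K * (y ^ suc K) ^ (K ℕ.* j))
      ≤⟨ *-monoˡ M≥0 (*-monoˡ (0≤^ K M≥0) (^-antitone (0≤^ (suc K) y≥0) (^≤1 (suc K) y≥0 y≤1) n≤Kj)) ⟩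
    M * (M ^ K * (y ^ suc K) ^ n)
      ≡⟨ ℚ.*-assoc M (M ^ K) ((y ^ suc K) ^ n) ⟨
    M ^ suc K * (y ^ suc K) ^ n
      ≡⟨ cong (M ^ suc K *_) (trans (^-assocʳ y (suc K) n) (trans (cong (y ^_) (ℕ.*-comm (suc K) n)) (^-* y n (suc K)))) ⟩
    M ^ suc K * (y ^ n) ^ suc K
      ≡⟨ ^-distrib-* M (y ^ n) (suc K) ⟨
    (M * y ^ n) ^ suc K ∎
    where
    y = 1ℚ - x
    j = suc (n ℕ./ K)
    M≥0 : 0ℚ ≤ M
    M≥0 = exp≤M 0
    x≤1 : x ≤ 1ℚ
    x≤1 = ℚ.≤-trans (subst (_≤ ι (suc K) * x) (ℚ.*-identityˡ x) (*-monoʳ x≥0 (1≤ι K))) Kx≤1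
    y≥0 : 0ℚ ≤ y
    y≥0 = ≤⇒0≤- x≤1
    y≤1 : y ≤ 1ℚ
    y≤1 = -nonneg≤ x≥0
    n≡ : n ≡ n ℕ.% K ℕ.+ (n ℕ./ K) ℕ.* K
    n≡ = ℕ.m≡m%n+[m/n]*n n K
    n≤Kj : n ℕ.≤ K ℕ.* j
    n≤Kj = ℕ.≤-trans (ℕ.≤-reflexive n≡) (ℕ.≤-trans
      (ℕ.+-monoˡ-≤ ((n ℕ./ K) ℕ.* K) (ℕ.<⇒≤ (ℕ.m%n<n n K))) (ℕ.≤-reflexive (ℕ.*-comm (suc (n ℕ./ K)) K)))
    Kj≤n+K : K ℕ.* j ℕ.≤ n ℕ.+ K
    Kj≤n+K = ℕ.≤-trans (ℕ.≤-reflexive (trans (ℕ.*-comm K j) (ℕ.+-comm K ((n ℕ./ K) ℕ.* K))))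
      (ℕ.+-monoˡ-≤ K (ℕ.m/n*n≤m n K))
    κ : ℚ
    κ = ℤ.+ 1 / K
    Kκ : ι K * κ ≡ 1ℚ
    Kκ = ι*1/ K
    0<K : 0ℚ < ι K
    0<K = ℚ.<-≤-trans 0<1 (ι-mono (ℕ.>-nonZero⁻¹ K))
    κ≥0 : 0ℚ ≤ κ
    κ≥0 = *-cancelˡ 0<K (subst₂ _≤_ (sym (ℚ.*-zeroʳ (ι K))) (sym Kκ) 0≤1)
    u = x * (1ℚ + κ)
    u≥0 : 0ℚ ≤ u
    u≥0 = 0≤* x≥0 (0≤+ 0≤1 κ≥0)
    inverse : 1ℚ ≤ (1ℚ + u) * y
    inverse = ≤-byDiff (identity x κ) (0≤* x≥0 (≤⇒0≤- (*-cancelˡ 0<K (begin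
      ι K * u                     ≡⟨ identity₂ (ι K) x κ ⟩
      (ι K + ι K * κ) * x         ≡⟨ cong (λ z → (ι K + z) * x) Kκ ⟩
      (ι K + 1ℚ) * x              ≡⟨ cong (_* x) (ℚ.+-comm (ι K) 1ℚ) ⟩
      ι (suc K) * x               ≤⟨ Kx≤1 ⟩
      1ℚ                          ≡⟨ Kκ ⟨
      ι K * κ                     ∎))))
      where
      identity : ∀ x κ → (1ℚ + x * (1ℚ + κ)) * (1ℚ - x) - 1ℚ ≡ x * (κ - x * (1ℚ + κ))
      identity = solve-∀ ℚ-ring
      identity₂ : ∀ K x κ → K * (x * (1ℚ + κ)) ≡ (K + K * κ) * x
      identity₂ = solve-∀ ℚ-ring
    0<F : 0ℚ < ι F
    0<F = ℚ.<-≤-trans 0<1 (ι-mono (ℕ.≤-trans (ℕ.s≤s ℕ.z≤n) 2≤F))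
    exponent : ι (suc K ℕ.* j) * u ≤ L
    exponent = *-cancelˡ 0<F (*-cancelˡ 0<K (*-cancelˡ 0<K (begin
      ι K * (ι K * (ι F * (ι (suc K ℕ.* j) * u)))
        ≡⟨ cong (λ z → ι K * (ι K * (ι F * (z * u)))) (ι-* (suc K) j) ⟩
      ι K * (ι K * (ι F * ((1ℚ + ι K) * ι j * u)))
        ≡⟨ identity₁ (ι K) (ι F) (ι j) x κ ⟩
      (1ℚ + ι K) * (ι K + ι K * κ) * (ι F * (x * (ι K * ι j)))
        ≡⟨ cong₂ (λ a b → (1ℚ + ι K) * (ι K + a) * (ι F * (x * b))) Kκ (sym (ι-* K j)) ⟩
      (1ℚ + ι K) * (ι K + 1ℚ) * (ι F * (x * ι (K ℕ.* j)))
        ≤⟨ *-monoˡ (0≤* (0≤ι (suc K)) (0≤+ (0≤ι K) 0≤1)) (*-monoˡ (0≤ι F) (*-monoˡ x≥0 (ι-mono Kj≤n+K))) ⟩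
      (1ℚ + ι K) * (ι K + 1ℚ) * (ι F * (x * ι (n ℕ.+ K)))
        ≡⟨ cong (λ z → (1ℚ + ι K) * (ι K + 1ℚ) * (ι F * (x * z))) (ι-+ n K) ⟩
      (1ℚ + ι K) * (ι K + 1ℚ) * (ι F * (x * (ι n + ι K)))
        ≡⟨ cong ((1ℚ + ι K) * (ι K + 1ℚ) *_) (identity₂ (ι F) x (ι n) (ι K)) ⟩
      (1ℚ + ι K) * (ι K + 1ℚ) * (ι F * (x * ι n) + ι F * ι K * x)
        ≤⟨ *-monoˡ (0≤* (0≤ι (suc K)) (0≤+ (0≤ι K) 0≤1)) (ℚ.+-mono-≤ few
             (*≤1≤ (0≤* (0≤ι F) (0≤ι K)) x≤1)) ⟩
      (1ℚ + ι K) * (ι K + 1ℚ) * (ι (F ℕ.∸ 1) * L + ι F * ι K)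
        ≤⟨ numeric F 2≤F 25F²≤L ⟩
      ι K * (ι K * (ι F * L)) ∎)))
      where
      identity₁ : ∀ K F j x κ → K * (K * (F * ((1ℚ + K) * j * (x * (1ℚ + κ))))) ≡
        (1ℚ + K) * (K + K * κ) * (F * (x * (K * j)))
      identity₁ = solve-∀ ℚ-ring
      identity₂ : ∀ F x n K → F * (x * (n + K)) ≡ F * (x * n) + F * K * x
      identity₂ = solve-∀ ℚ-ring
      -- With `K = 4F`, the product of `(1 + 1/K)²` and `1 - 1/F` is at most `1 - 1/(2F)`. The
      -- remaining room takes up the rounding term since `25 F²` exceeds `(K + 1)²`, namely by
      -- `(F - 1)(9F + 1)`.
      numeric : ∀ F → 2 ℕ.≤ F → ι (25 ℕ.* (F ℕ.* F)) ≤ L →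
        (1ℚ + ι (4 ℕ.* F)) * (ι (4 ℕ.* F) + 1ℚ) * (ι (F ℕ.∸ 1) * L + ι F * ι (4 ℕ.* F)) ≤
        ι (4 ℕ.* F) * (ι (4 ℕ.* F) * (ι F * L))
      numeric (suc f) _ 25F²≤L = subst (λ z → (1ℚ + z) * (z + 1ℚ) * (ι f * L + ι (suc f) * z) ≤ z * (z * (ι (suc f) * L)))
        (sym (ι-* 4 (suc f)))
        (≤-byDiff (identity (ι f) L)
          (0≤+ (0≤* (0≤* (0≤ι 4) (0≤* (0≤ι (suc f)) (0≤ι (suc f)))) (0≤+ (≤⇒0≤- bound)
                 (0≤* (0≤ι f) (0≤+ (0≤* (0≤ι 9) (0≤ι (suc f))) 0≤1))))
               (0≤* (0≤+ (0≤+ (0≤* (0≤ι 4) (0≤* (0≤ι (suc f)) (0≤ι (suc f)))) (0≤* (0≤ι 7) (0≤ι (suc f)))) 0≤1) L≥0)))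
        where
        bound : ι 25 * (ι (suc f) * ι (suc f)) ≤ L
        bound = subst (_≤ L) (trans (ι-* 25 (suc f ℕ.* suc f)) (cong (ι 25 *_) (ι-* (suc f) (suc f)))) 25F²≤L
        identity : ∀ f L →
          ι 4 * (1ℚ + f) * (ι 4 * (1ℚ + f) * ((1ℚ + f) * L)) -
            (1ℚ + ι 4 * (1ℚ + f)) * (ι 4 * (1ℚ + f) + 1ℚ) * (f * L + (1ℚ + f) * (ι 4 * (1ℚ + f))) ≡
          ι 4 * ((1ℚ + f) * (1ℚ + f)) * (L - ι 25 * ((1ℚ + f) * (1ℚ + f)) + f * (ι 9 * (1ℚ + f) + 1ℚ)) +
            (ι 4 * ((1ℚ + f) * (1ℚ + f)) + ι 7 * (1ℚ + f) + 1ℚ) * L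
        identity = solve-∀ ℚ-ring
    amplified : 1ℚ ≤ M * y ^ (suc K ℕ.* j)
    amplified = let k , le = bernoulli-exp (suc K ℕ.* j) u≥0 in begin
      1ℚ                                                     ≤⟨ 1≤^ (suc K ℕ.* j) inverse ⟩
      ((1ℚ + u) * y) ^ (suc K ℕ.* j)                         ≡⟨ ^-distrib-* (1ℚ + u) y (suc K ℕ.* j) ⟩
      (1ℚ + u) ^ (suc K ℕ.* j) * y ^ (suc K ℕ.* j)           ≤⟨ *-monoʳ (0≤^ (suc K ℕ.* j) y≥0)
                                                                  (ℚ.≤-trans le (ℚ.≤-trans (expSum-mono k (0≤* (0≤ι (suc K ℕ.* j)) u≥0) exponent) (exp≤M k))) ⟩
      M * y ^ (suc K ℕ.* j)                                  ∎

-- Powers of `L` are compared with `M` in two ways: a bounded exponent by one term of the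
-- exponential series, an exponent growing with `d` by the hypothesis that comes from the degree
-- bound.
large-power : ∀ {L M} m m₁ q → 1ℚ ≤ L → ι (suc m₁ !) ≤ L → (∀ k → expSum L k ≤ M) → L ^ q ≤ M →
              m ℕ.≤ m₁ ⊎ m ℕ.≤ q → L ^ m ≤ M
large-power m m₁ q 1≤L big exp≤M Lq≤M (inj₂ m≤q)  = ℚ.≤-trans (^-monoʳ 1≤L m≤q) Lq≤M
large-power m m₁ q 1≤L big exp≤M Lq≤M (inj₁ m≤m₁) = ℚ.≤-trans (^-monoʳ 1≤L m≤m₁)
  (ℚ.≤-trans (power≤expSum m₁ big) (exp≤M (suc (suc m₁))))

avoids-bit : ∀ {n} (F : List (Subset n)) S → avoids F S ≡ 0ℚ ⊎ avoids F S ≡ 1ℚ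
avoids-bit []      S = inj₂ refl
avoids-bit (A ∷ F) S with contains-bit A S
  where
  contains-bit : ∀ {n} (A S : Subset n) → contains A S ≡ 0ℚ ⊎ contains A S ≡ 1ℚ
  contains-bit []            []            = inj₂ refl
  contains-bit (outside ∷ A) (_ ∷ S)       = contains-bit A S
  contains-bit (inside ∷ A)  (inside ∷ S)  = contains-bit A S
  contains-bit (inside ∷ A)  (outside ∷ S) = inj₁ refl
... | inj₂ eq = inj₁ (trans (cong (λ z → (1ℚ - z) * avoids F S) eq) (ℚ.*-zeroˡ (avoids F S)))
... | inj₁ eq with avoids-bit F S
...   | inj₁ eq′ = inj₁ (trans (cong ((1ℚ - contains A S) *_) eq′) (ℚ.*-zeroʳ (1ℚ - contains A S)))
...   | inj₂ eq′ = inj₂ (cong₂ (λ a b → (1ℚ - a) * b) eq eq′)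

-- e and C encode ε = 1/(e+1) and the error probability 1/C.
module Core (e C : ℕ) where

  -- `f / F` is `1 - ε/2`, halfway between the average `1 - ε` and 1. In `c`, the factor 6 is the
  -- constant of `c-bound`, and the summand 2 provides `2 ≤ c` for the crude bound `Z≤3m²`.
  f F c : ℕ
  f = suc (2 ℕ.* e)
  F = suc f
  c = 6 ℕ.* C ℕ.+ 2

  2≤F : 2 ℕ.≤ F
  2≤F = ℕ.s≤s (ℕ.s≤s ℕ.z≤n)

  open Missing F 2≤F using (K; missing-power)

  -- Bounds the exponents that are needed for d ≤ K, where the bound on d gives nothing.
  m₁ : ℕ
  m₁ = (K ℕ.+ 6) ℕ.* suc K

  -- The summands serve, in turn: powers of `L` with exponent at most `m₁`; the rounding in
  -- `missing-power`; `(K + 1) x ≤ 1`; a bound `N/(2f)` on the elements with many degenerate words;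
  -- and the errors `1/L` and `b/m`, which must be at most `1/c`.
  threshold : ℕ
  threshold = suc m₁ ! ℕ.+ (25 ℕ.* (F ℕ.* F) ℕ.+ (suc K ℕ.+ (2 ℕ.* f ℕ.* c ℕ.+ c)))

  module _ {a ℓ : Level} {N : ℕ} (G : AbelianGroupOfOrder a ℓ N) (d′ : ℕ) (1≤d′ : 1 ℕ.≤ d′)
           (L p : ℚ) (0≤p : 0ℚ ≤ p) (p≤1 : p ≤ 1ℚ) (1≤N : 1 ℕ.≤ N)
           (threshold≤L : ι threshold ≤ L) (5d≤L : ι 5 * ι (suc d′) ≤ L)
           (exp≤N : ∀ k → expSum L k ≤ ι N) (power≤N : L ^ (2 ℕ.* (suc d′ ℕ.* suc d′)) ≤ ι N)
           (p-bound : ι (suc e) * ((ι 2 * p) ^ suc d′ * ι N ^ d′) ≤ ι e * (ι (suc d′ !) * L)) where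

    open ℚ.≤-Reasoning

    private
      d : ℕ
      d = suc d′

      -- The maximum with `R` keeps `W` large even if `p N` is small. The exponent `d + 6` is
      -- `d + 1` from `W^d`, plus 3 from `O d²` in the mixed sums, plus 2 to make them at most
      -- `1/L²`.
      x R M W O : ℚ
      x = p ^ d
      R = L ^ (d ℕ.+ 6)
      M = p * ι N ⊔ R
      W = ι 3 * M
      O = 1ℚ + ι 2 * ι d

      below : ∀ {n} → n ℕ.≤ threshold → ι n ≤ L
      below h = ℚ.≤-trans (ι-mono h) threshold≤L

      r₁ r₂ r₃ : ℕ
      r₃ = 2 ℕ.* f ℕ.* c ℕ.+ c
      r₂ = suc K ℕ.+ r₃
      r₁ = 25 ℕ.* (F ℕ.* F) ℕ.+ r₂

      r₃≤ : r₃ ℕ.≤ threshold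
      r₃≤ = ℕ.≤-trans (ℕ.m≤n+m r₃ (suc K)) (ℕ.≤-trans (ℕ.m≤n+m r₂ (25 ℕ.* (F ℕ.* F))) (ℕ.m≤n+m r₁ (suc m₁ !)))

      factorial≤L : ι (suc m₁ !) ≤ L
      factorial≤L = below (ℕ.m≤m+n (suc m₁ !) r₁)

      25F²≤L : ι (25 ℕ.* (F ℕ.* F)) ≤ L
      25F²≤L = below (ℕ.≤-trans (ℕ.m≤m+n (25 ℕ.* (F ℕ.* F)) r₂) (ℕ.m≤n+m r₁ (suc m₁ !)))

      K<L : ι (suc K) ≤ L
      K<L = below (ℕ.≤-trans (ℕ.m≤m+n (suc K) r₃) (ℕ.≤-trans (ℕ.m≤n+m r₂ (25 ℕ.* (F ℕ.* F))) (ℕ.m≤n+m r₁ (suc m₁ !))))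

      2fc≤L : ι (2 ℕ.* f ℕ.* c) ≤ L
      2fc≤L = below (ℕ.≤-trans (ℕ.m≤m+n (2 ℕ.* f ℕ.* c) c) r₃≤)

      c≤L : ι c ≤ L
      c≤L = below (ℕ.≤-trans (ℕ.m≤n+m c (2 ℕ.* f ℕ.* c)) r₃≤)

      2≤c : ι 2 ≤ ι c
      2≤c = ι-mono (ℕ.m≤n+m 2 (6 ℕ.* C))

      2f≤L : ι (2 ℕ.* f) ≤ L
      2f≤L = ℚ.≤-trans (ι-mono (ℕ.≤-trans (ℕ.≤-reflexive (sym (ℕ.*-identityʳ (2 ℕ.* f))))
        (ℕ.*-monoʳ-≤ (2 ℕ.* f) (ℕ.≤-trans (ℕ.s≤s ℕ.z≤n) (ℕ.m≤n+m 2 (6 ℕ.* C)))))) 2fc≤L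

      1≤L : 1ℚ ≤ L
      1≤L = ℚ.≤-trans (1≤ι K) K<L

      0≤L : 0ℚ ≤ L
      0≤L = ℚ.≤-trans 0≤1 1≤L

      0<L : 0ℚ < L
      0<L = ℚ.<-≤-trans 0<1 1≤L

      L^ : ∀ n → 0ℚ ≤ L ^ n
      L^ n = 0≤^ n 0≤L

      0≤x : 0ℚ ≤ x
      0≤x = 0≤^ d 0≤p

      0≤N : 0ℚ ≤ ι N
      0≤N = 0≤ι N

      1≤N′ : 1ℚ ≤ ι N
      1≤N′ = ι-mono 1≤N

      d≤L : ι d ≤ L
      d≤L = ℚ.≤-trans (subst (_≤ ι 5 * ι d) (ℚ.*-identityˡ (ι d)) (*-monoʳ (0≤ι d) (1≤ι 4))) 5d≤L

      O≤L : O ≤ L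
      O≤L = ℚ.≤-trans (≤-byDiff (identity (ι d′)) (0≤+ (0≤* (0≤ι 3) (0≤ι d′)) (0≤ι 2))) 5d≤L
        where
        identity : ∀ d → ι 5 * (1ℚ + d) - (1ℚ + ι 2 * (1ℚ + d)) ≡ ι 3 * d + ι 2
        identity = solve-∀ ℚ-ring

      0≤O′ : 0ℚ ≤ O
      0≤O′ = 0≤1+2ι d

      L≤R : L ≤ R
      L≤R = subst (_≤ R) (ℚ.*-identityʳ L) (^-monoʳ {L} {1} {d ℕ.+ 6} 1≤L (ℕ.s≤s ℕ.z≤n))

      1≤R : 1ℚ ≤ R
      1≤R = ℚ.≤-trans 1≤L L≤R

      0<R : 0ℚ < R
      0<R = ℚ.<-≤-trans 0<1 1≤R

      R≤M : R ≤ M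
      R≤M = ℚ.p≤q⊔p (p * ι N) R

      0≤M : 0ℚ ≤ M
      0≤M = ℚ.≤-trans (ℚ.<⇒≤ 0<R) R≤M

      M≤W : M ≤ W
      M≤W = subst (_≤ W) (ℚ.*-identityˡ M) (*-monoʳ 0≤M (1≤ι 2))

      R≤W : R ≤ W
      R≤W = ℚ.≤-trans R≤M M≤W

      0≤W′ : 0ℚ ≤ W
      0≤W′ = ℚ.≤-trans 0≤M M≤W

      W-bound : 1ℚ + ι 2 * ι d + ι 2 * (p * ι N) ≤ W
      W-bound = begin
        O + ι 2 * (p * ι N)
          ≤⟨ ℚ.+-mono-≤ (ℚ.≤-trans O≤L (ℚ.≤-trans L≤R R≤M)) (*-monoˡ (0≤ι 2) (ℚ.p≤p⊔q (p * ι N) R)) ⟩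
        M + ι 2 * M
          ≡⟨ identity M ⟩
        W ∎
        where
        identity : ∀ m → m + ι 2 * m ≡ ι 3 * m
        identity = solve-∀ ℚ-ring

      R^d≤N : R ^ d ≤ ι N
      R^d≤N = subst (_≤ ι N) (^-* L (d ℕ.+ 6) d)
        (large-power ((d ℕ.+ 6) ℕ.* d) m₁ (2 ℕ.* (d ℕ.* d)) 1≤L factorial≤L exp≤N power≤N cases)
        where
        cases : (d ℕ.+ 6) ℕ.* d ℕ.≤ m₁ ⊎ (d ℕ.+ 6) ℕ.* d ℕ.≤ 2 ℕ.* (d ℕ.* d)
        cases with ℕ.≤-total d K
        ... | inj₁ d≤K = inj₁ (ℕ.*-mono-≤ (ℕ.+-monoˡ-≤ 6 d≤K) (ℕ.m≤n⇒m≤1+n d≤K))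
        ... | inj₂ K≤d = inj₂ (ℕ.≤-trans (ℕ.*-monoˡ-≤ d (ℕ.+-monoʳ-≤ d (ℕ.≤-trans 6≤K K≤d)))
              (ℕ.≤-reflexive (trans (cong (ℕ._* d) (cong (d ℕ.+_) (sym (ℕ.+-identityʳ d)))) (ℕ.*-assoc 2 d d))))
          where
          6≤K : 6 ℕ.≤ K
          6≤K = ℕ.≤-trans (ℕ.m≤m+n 6 2) (ℕ.*-monoʳ-≤ 4 2≤F)

      R≤N : R ≤ ι N
      R≤N = ℚ.≤-trans (≤*1≤ (ℚ.<⇒≤ 0<R) (1≤^ d′ 1≤R)) R^d≤N

      slots≤ : (ι 2 * p) ^ d * ι N ^ d′ ≤ ι (d !) * L
      slots≤ = *-cancelˡ (0<ι e) (ℚ.≤-trans p-bound (*-monoʳ (0≤* (0≤ι (d !)) 0≤L) (ι-mono (ℕ.n≤1+n e))))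

      x≤slots : x ≤ (ι 2 * p) ^ d
      x≤slots = ^-mono d 0≤p (subst (_≤ ι 2 * p) (ℚ.*-identityˡ p) (*-monoʳ 0≤p (1≤ι 1)))

      d!≤ : ι (d !) ≤ L ^ d
      d!≤ = ℚ.≤-trans (ι!≤^ d ℕ.≤-refl) (^-mono d (0≤ι d) d≤L)

      1≤d! : 1ℚ ≤ ι (d !)
      1≤d! = ι-mono (ℕ.>-nonZero⁻¹ (d !) {{d ℕ.!≢0}})

      M^d≤ : M ^ d ≤ ι N * (ι (d !) * L)
      M^d≤ with ℚ.⊔-sel (p * ι N) R
      ... | inj₂ eq = begin
        M ^ d                    ≡⟨ cong (_^ d) eq ⟩
        R ^ d                    ≤⟨ R^d≤N ⟩
        ι N                      ≤⟨ ≤*1≤ 0≤N (ℚ.≤-trans 1≤d! (≤*1≤ (0≤ι (d !)) 1≤L)) ⟩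
        ι N * (ι (d !) * L)      ∎
      ... | inj₁ eq = begin
        M ^ d                    ≡⟨ cong (_^ d) eq ⟩
        (p * ι N) ^ d            ≡⟨ ^-distrib-* p (ι N) d ⟩
        x * (ι N * ι N ^ d′)     ≡⟨ identity x (ι N) (ι N ^ d′) ⟩
        ι N * (x * ι N ^ d′)     ≤⟨ *-monoˡ 0≤N (ℚ.≤-trans (*-monoʳ (0≤^ d′ 0≤N) x≤slots) slots≤) ⟩
        ι N * (ι (d !) * L)      ∎
        where
        identity : ∀ a b c → a * (b * c) ≡ b * (a * c)
        identity = solve-∀ ℚ-ring

      -- The factors `3^d` and `d !` together are at most `(3d)^d`, hence at most `L^d` because
      -- `5d ≤ L`.
      W^d≤ : W ^ d ≤ ι N * L ^ suc d
      W^d≤ = begin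
        W ^ d                              ≡⟨ ^-distrib-* (ι 3) M d ⟩
        ι 3 ^ d * M ^ d                    ≤⟨ *-monoˡ (0≤^ d (0≤ι 3)) M^d≤ ⟩
        ι 3 ^ d * (ι N * (ι (d !) * L))    ≡⟨ identity (ι 3 ^ d) (ι N) (ι (d !)) L ⟩
        ι N * (L * (ι 3 ^ d * ι (d !)))    ≤⟨ *-monoˡ 0≤N (*-monoˡ 0≤L small) ⟩
        ι N * (L * L ^ d)                  ∎
        where
        identity : ∀ a n f l → a * (n * (f * l)) ≡ n * (l * (a * f))
        identity = solve-∀ ℚ-ring
        small : ι 3 ^ d * ι (d !) ≤ L ^ d
        small = begin
          ι 3 ^ d * ι (d !)     ≤⟨ *-monoˡ (0≤^ d (0≤ι 3)) (ι!≤^ d ℕ.≤-refl) ⟩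
          ι 3 ^ d * ι d ^ d     ≡⟨ ^-distrib-* (ι 3) (ι d) d ⟨
          (ι 3 * ι d) ^ d       ≤⟨ ^-mono d (0≤* (0≤ι 3) (0≤ι d))
                                     (ℚ.≤-trans (*-monoʳ (0≤ι d) (ι-mono (ℕ.m≤m+n 3 2))) 5d≤L) ⟩
          L ^ d                 ∎

      -- Here `d ≥ 2` enters, as `N ≤ N^(d-1)`: the bound on `p` then gives `x N ≤ L^(d+1)`, while
      -- `N` is at least `L^(d+6)`.
      Lx≤1 : L * x ≤ 1ℚ
      Lx≤1 = *-cancelˡ (0<^ (suc d) 0<L) (begin
        L ^ suc d * (L * x)        ≡⟨ identity (L ^ suc d) L x ⟩
        L ^ suc (suc d) * x        ≤⟨ *-monoʳ 0≤x (^-monoʳ 1≤L 2+d≤) ⟩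
        R * x                      ≤⟨ *-monoʳ 0≤x R≤N ⟩
        ι N * x                    ≡⟨ ℚ.*-comm (ι N) x ⟩
        x * ι N                    ≤⟨ *-mono (0≤^ d (0≤* (0≤ι 2) 0≤p)) 0≤N x≤slots
                                        (subst (_≤ ι N ^ d′) (ℚ.*-identityʳ (ι N)) (^-monoʳ {ι N} {1} {d′} 1≤N′ 1≤d′)) ⟩
        (ι 2 * p) ^ d * ι N ^ d′   ≤⟨ slots≤ ⟩
        ι (d !) * L                ≤⟨ *-monoʳ 0≤L d!≤ ⟩
        L ^ d * L                  ≡⟨ trans (ℚ.*-comm (L ^ d) L) (sym (ℚ.*-identityʳ (L ^ suc d))) ⟩
        L ^ suc d * 1ℚ             ∎)
        where
        identity : ∀ a b c → a * (b * c) ≡ b * a * c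
        identity = solve-∀ ℚ-ring
        2+d≤ : suc (suc d) ℕ.≤ d ℕ.+ 6
        2+d≤ = ℕ.≤-trans (ℕ.≤-reflexive (ℕ.+-comm 2 d)) (ℕ.+-monoʳ-≤ d (ℕ.m≤m+n 2 4))

      Kx≤1 : ι (suc K) * x ≤ 1ℚ
      Kx≤1 = ℚ.≤-trans (*-monoʳ 0≤x K<L) Lx≤1

    open Evaluation G using (hits; hits-total; product)
    open SecondMoment G p 0≤p p≤1 d W W-bound
      using (E; 0≤E; avoids-lower; supports; ∣supports∣; degenerate; 0≤degenerate; covered; count; P; 0≤P;
             mixedSum; mixedSum-bound; 0≤mixedSum; degenerate-total; module Pairs)

    private
      Λ : ℚ
      Λ = ∑ (allFin N) (λ h → E (degenerate h))

      0≤E-degenerate : ∀ h → 0ℚ ≤ E (degenerate h)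
      0≤E-degenerate h = 0≤E (0≤degenerate h)

      0≤Λ : 0ℚ ≤ Λ
      0≤Λ = 0≤∑ (allFin N) 0≤E-degenerate

      LΛ≤N : L * Λ ≤ ι N
      LΛ≤N = *-cancelˡ (0<^ (3 ℕ.+ d) 0<L) (begin
        L ^ (3 ℕ.+ d) * (L * Λ)               ≡⟨ identity₁ (L ^ (3 ℕ.+ d)) L Λ ⟩
        L ^ (4 ℕ.+ d) * Λ                     ≤⟨ *-monoʳ 0≤Λ (^-monoʳ 1≤L (ℕ.≤-trans (ℕ.+-monoˡ-≤ d (ℕ.m≤m+n 4 2)) (ℕ.≤-reflexive (ℕ.+-comm 6 d)))) ⟩
        R * Λ                                 ≤⟨ *-monoʳ 0≤Λ R≤W ⟩
        W * Λ                                 ≤⟨ degenerate-total ⟩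
        ι d * O * W ^ d                       ≤⟨ *-mono (0≤* 0≤L 0≤L) (0≤^ d 0≤W′) (*-mono 0≤L 0≤O′ d≤L O≤L) W^d≤ ⟩
        L * L * (ι N * L ^ suc d)             ≡⟨ identity₂ L (ι N) (L ^ suc d) ⟩
        L ^ (3 ℕ.+ d) * ι N                   ∎)
        where
        identity₁ : ∀ a b c → a * (b * c) ≡ b * a * c
        identity₁ = solve-∀ ℚ-ring
        identity₂ : ∀ l n x → l * l * (n * x) ≡ l * (l * x) * n
        identity₂ = solve-∀ ℚ-ring

      instance
        L²≢0 : NonZero (L * L)
        L²≢0 = ℚ.pos⇒nonZero (L * L) {{positive (0<* 0<L 0<L)}}

      M̄ : ℚ
      M̄ = 1/ (L * L)

      L²M̄≡1 : L * L * M̄ ≡ 1ℚ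
      L²M̄≡1 = ℚ.*-inverseʳ (L * L)

      0≤M̄ : 0ℚ ≤ M̄
      0≤M̄ = *-cancelˡ (0<* 0<L 0<L) (subst₂ _≤_ (sym (ℚ.*-zeroʳ (L * L))) (sym L²M̄≡1) 0≤1)

      mixed≤ : ∀ A ∣A∣≤d h → mixedSum A ∣A∣≤d h ≤ M̄
      mixed≤ A ∣A∣≤d h = *-cancelˡ (0<* 0<L 0<L) (subst (L * L * μ ≤_) (sym L²M̄≡1) (*-cancelˡ (0<^ (4 ℕ.+ d) 0<L) (begin
        L ^ (4 ℕ.+ d) * (L * L * μ)            ≡⟨ identity₁ L (L ^ (4 ℕ.+ d)) μ ⟩
        L ^ (6 ℕ.+ d) * μ                      ≡⟨ cong (λ n → L ^ n * μ) (ℕ.+-comm 6 d) ⟩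
        R * μ                                  ≤⟨ *-monoʳ 0≤μ R≤W ⟩
        W * μ                                  ≤⟨ *-cancelˡ 0<N (*-cancelˡ 0<W scaled) ⟩
        L ^ (4 ℕ.+ d)                          ≡⟨ ℚ.*-identityʳ (L ^ (4 ℕ.+ d)) ⟨
        L ^ (4 ℕ.+ d) * 1ℚ                     ∎)))
        where
        μ = mixedSum A ∣A∣≤d h
        0≤μ : 0ℚ ≤ μ
        0≤μ = 0≤mixedSum A ∣A∣≤d h
        0<N : 0ℚ < ι N
        0<N = ℚ.<-≤-trans 0<1 1≤N′
        0<W : 0ℚ < W
        0<W = ℚ.<-≤-trans 0<R R≤W
        identity₁ : ∀ l x m → x * (l * l * m) ≡ l * (l * x) * m
        identity₁ = solve-∀ ℚ-ring
        identity₂ : ∀ w n m → w * (n * (w * m)) ≡ n * (w * (w * m))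
        identity₂ = solve-∀ ℚ-ring
        identity₃ : ∀ n p o d w → n * (ι 2 * p * o * (d * d) * w) ≡ (ι 2 * (p * n)) * (o * (d * d) * w)
        identity₃ = solve-∀ ℚ-ring
        identity₄ : ∀ l n x → l * (l * l) * (n * (l * x)) ≡ n * (l * (l * (l * (l * x))))
        identity₄ = solve-∀ ℚ-ring
        -- The factor `N` completes `2p` to `2pN`, which `W` dominates; this cancels one of the two
        -- factors `W`, and the `N` in the bound for `W^d` cancels the added one.
        scaled : W * (ι N * (W * μ)) ≤ W * (ι N * L ^ (4 ℕ.+ d))
        scaled = begin
          W * (ι N * (W * μ))
            ≡⟨ identity₂ W (ι N) μ ⟩
          ι N * (W * (W * μ))
            ≤⟨ *-monoˡ 0≤N (mixedSum-bound A ∣A∣≤d h) ⟩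
          ι N * (ι 2 * p * O * (ι d * ι d) * W ^ d)
            ≡⟨ identity₃ (ι N) p O (ι d) (W ^ d) ⟩
          (ι 2 * (p * ι N)) * (O * (ι d * ι d) * W ^ d)
            ≤⟨ *-mono 0≤W′ (0≤* (0≤* 0≤O′ (0≤* (0≤ι d) (0≤ι d))) (0≤^ d 0≤W′))
                 (ℚ.≤-trans (nonneg+≤ 0≤O′) W-bound)
                 (*-mono (0≤* 0≤L (0≤* 0≤L 0≤L)) (0≤^ d 0≤W′)
                   (*-mono 0≤L (0≤* (0≤ι d) (0≤ι d)) O≤L (*-mono 0≤L (0≤ι d) d≤L d≤L)) W^d≤) ⟩
          W * (L * (L * L) * (ι N * L ^ suc d))
            ≡⟨ cong (W *_) (identity₄ L (ι N) (L ^ d)) ⟩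
          W * (ι N * L ^ (4 ℕ.+ d)) ∎

      Good : Fin N → Set
      Good h = (ι F * (x * count h) ≤ ι f * L) × (ι c * E (degenerate h) ≤ 1ℚ)

      good? : ∀ h → Dec (Good h)
      good? h = (ι F * (x * count h) ℚ.≤? ι f * L) ×-dec (ι c * E (degenerate h) ℚ.≤? 1ℚ)

      t : Fin N → ℚ
      t h = 𝟙 (good? h)

      0≤t : ∀ h → 0ℚ ≤ t h
      0≤t h = 0≤𝟙 (good? h)

      0≤count : ∀ h → 0ℚ ≤ count h
      0≤count h = 0≤ι (length (supports h))

      count≤ : ∀ h → t h * (x * count h) ≤ t h * L
      count≤ h = 𝟙*-mono (good? h) (λ (few , _) → *-cancelˡ (0<ι f)
        (ℚ.≤-trans few (*-monoʳ 0≤L (ι-mono (ℕ.n≤1+n f)))))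

      -- Markov's inequality for the two requirements on good elements.
      markov : ∀ h → ι f * L * (1ℚ - t h) ≤ ι F * (x * count h) + ι f * L * (ι c * E (degenerate h))
      markov h = bound (good? h)
        where
        fL = ι f * L
        0≤fL : 0ℚ ≤ fL
        0≤fL = 0≤* (0≤ι f) 0≤L
        0≤a : 0ℚ ≤ ι F * (x * count h)
        0≤a = 0≤* (0≤ι F) (0≤* 0≤x (0≤count h))
        0≤b : 0ℚ ≤ fL * (ι c * E (degenerate h))
        0≤b = 0≤* 0≤fL (0≤* (0≤ι c) (0≤E-degenerate h))
        bad : ¬ Good h → fL ≤ ι F * (x * count h) + fL * (ι c * E (degenerate h))
        bad ¬good with ι F * (x * count h) ℚ.≤? fL
        ... | no  many = ℚ.≤-trans (ℚ.<⇒≤ (ℚ.≰⇒> many)) (≤+nonneg 0≤b)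
        ... | yes few with ι c * E (degenerate h) ℚ.≤? 1ℚ
        ...   | yes rare = contradiction (few , rare) ¬good
        ...   | no  often = ℚ.≤-trans (≤*1≤ 0≤fL (ℚ.<⇒≤ (ℚ.≰⇒> often))) (nonneg+≤ 0≤a)
        bound : (g? : Dec (Good h)) → fL * (1ℚ - 𝟙 g?) ≤ ι F * (x * count h) + fL * (ι c * E (degenerate h))
        bound (yes _) = ℚ.≤-trans (ℚ.≤-reflexive (ℚ.*-zeroʳ fL)) (0≤+ 0≤a 0≤b)
        bound (no ¬g) = ℚ.≤-trans (ℚ.≤-reflexive (ℚ.*-identityʳ fL)) (bad ¬g)

      T : ℚ
      T = ∑ (allFin N) t

      count-total : ∑ (allFin N) count ≤ ι (length (signedSets (allFin N) d))
      count-total = begin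
        ∑ (allFin N) count
          ≡⟨ ∑-cong (allFin N) count≡ ⟩
        ∑ (allFin N) (λ h → ∑ (signedSets (allFin N) d) (λ w → hits h w))
          ≡⟨ ∑-swap (allFin N) (signedSets (allFin N) d) (λ h w → hits h w) ⟩
        ∑ (signedSets (allFin N) d) (λ w → ∑ (allFin N) (λ h → hits h w))
          ≤⟨ ∑-mono (signedSets (allFin N) d) hits-total ⟩
        ∑ (signedSets (allFin N) d) (λ _ → 1ℚ)
          ≡⟨ trans (∑-const (signedSets (allFin N) d) 1ℚ) (ℚ.*-identityʳ (ι (length (signedSets (allFin N) d)))) ⟩
        ι (length (signedSets (allFin N) d)) ∎
        where
        open AbelianGroupOfOrder G using (index)
        count≡ : ∀ h → count h ≡ ∑ (signedSets (allFin N) d) (λ w → hits h w)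
        count≡ h = trans (cong ι (length-map support filtered)) (trans (sym (ℚ.*-identityʳ (ι (length filtered))))
          (trans (sym (∑-const filtered 1ℚ))
            (trans (∑-filter (λ w → index (product w) Fin.≟ h) (signedSets (allFin N) d) (λ _ → 1ℚ))
              (∑-cong (signedSets (allFin N) d) (λ w → ℚ.*-identityʳ (hits h w))))))
          where filtered = filter (λ w → index (product w) Fin.≟ h) (signedSets (allFin N) d)

      ∑count : ℚ
      ∑count = ∑ (allFin N) count

      mean-count : ι (suc e) * (x * ∑count) ≤ ι e * (L * ι N)
      mean-count = *-cancelˡ (ℚ.<-≤-trans 0<1 1≤d!) (begin
        ι (d !) * (ι (suc e) * (x * ∑count))
          ≤⟨ *-monoˡ (0≤ι (d !)) (*-monoˡ (0≤ι (suc e)) (*-monoˡ 0≤x count-total)) ⟩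
        ι (d !) * (ι (suc e) * (x * ι (length (signedSets (allFin N) d))))
          ≡⟨ identity₁ (ι (d !)) (ι (suc e)) x (ι (length (signedSets (allFin N) d))) ⟩
        ι (suc e) * (x * (ι (d !) * ι (length (signedSets (allFin N) d))))
          ≤⟨ *-monoˡ (0≤ι (suc e)) (*-monoˡ 0≤x (signedSets-count (allFin N) d)) ⟩
        ι (suc e) * (x * (ι 2 * ι (length (allFin N))) ^ d)
          ≡⟨ cong (λ n → ι (suc e) * (x * (ι 2 * ι n) ^ d)) (length-allFin N) ⟩
        ι (suc e) * (x * (ι 2 * ι N) ^ d)
          ≡⟨ cong (ι (suc e) *_) (trans (sym (^-distrib-* p (ι 2 * ι N) d))
               (trans (cong (_^ d) (identity₂ p (ι 2) (ι N))) (^-distrib-* (ι 2 * p) (ι N) d))) ⟩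
        ι (suc e) * ((ι 2 * p) ^ d * (ι N * ι N ^ d′))
          ≡⟨ identity₃ (ι (suc e)) ((ι 2 * p) ^ d) (ι N) (ι N ^ d′) ⟩
        ι N * (ι (suc e) * ((ι 2 * p) ^ d * ι N ^ d′))
          ≤⟨ *-monoˡ 0≤N p-bound ⟩
        ι N * (ι e * (ι (d !) * L))
          ≡⟨ identity₄ (ι N) (ι e) (ι (d !)) L ⟩
        ι (d !) * (ι e * (L * ι N)) ∎)
        where
        identity₁ : ∀ f a x l → f * (a * (x * l)) ≡ a * (x * (f * l))
        identity₁ = solve-∀ ℚ-ring
        identity₂ : ∀ p t n → p * (t * n) ≡ t * p * n
        identity₂ = solve-∀ ℚ-ring
        identity₃ : ∀ a y n m → a * (y * (n * m)) ≡ n * (a * (y * m))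
        identity₃ = solve-∀ ℚ-ring
        identity₄ : ∀ n e f l → n * (e * (f * l)) ≡ f * (e * (l * n))
        identity₄ = solve-∀ ℚ-ring

      ∑1≡N : ∑ (allFin N) (λ _ → 1ℚ) ≡ ι N
      ∑1≡N = trans (∑-const (allFin N) 1ℚ) (trans (ℚ.*-identityʳ (ι (length (allFin N)))) (cong ι (length-allFin N)))

      -- By Markov's inequality at most `2eN/f` elements have too many sets, and at most
      -- `cΛ ≤ N/(2f)` have too many degenerate words. Since `f = 2e + 1`, at least `N/(2f)` good
      -- elements remain.
      N≤2fT : ι N ≤ ι 2 * ι f * T
      N≤2fT = 0≤-⇒≤ (*-cancelˡ 0<L (subst₂ _≤_ (sym (ℚ.*-zeroʳ L)) collect
        (0≤+ (0≤+ (0≤* (0≤ι 2) (≤⇒0≤- summed)) (0≤* (0≤ι 4) (≤⇒0≤- mean-count))) (0≤* 0≤L (≤⇒0≤- rare)))))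
        where
        lhs = ι f * L * (ι N - T)
        rhs = ι F * (x * ∑count) + ι f * L * (ι c * Λ)
        rare : ι 2 * ι f * ι c * Λ ≤ ι N
        rare = ℚ.≤-trans (*-monoʳ 0≤Λ (subst (_≤ L) (trans (ι-* (2 ℕ.* f) c) (cong (_* ι c) (ι-* 2 f))) 2fc≤L)) LΛ≤N
        summed : lhs ≤ rhs
        summed = begin
          ι f * L * (ι N - T)
            ≡⟨ cong (ι f * L *_) (trans (cong (_- T) (sym ∑1≡N)) (complement (∑ (allFin N) (λ _ → 1ℚ)) T)) ⟩
          ι f * L * (∑ (allFin N) (λ _ → 1ℚ) + (- 1ℚ) * T)
            ≡⟨ cong (ι f * L *_) (trans (cong (∑ (allFin N) (λ _ → 1ℚ) +_) (sym (∑-*ˡ (allFin N) (- 1ℚ) t)))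
                 (trans (sym (∑-+ (allFin N) (λ _ → 1ℚ) (λ h → (- 1ℚ) * t h)))
                   (∑-cong (allFin N) (λ h → sym (complement 1ℚ (t h)))))) ⟩
          ι f * L * ∑ (allFin N) (λ h → 1ℚ - t h)
            ≡⟨ ∑-*ˡ (allFin N) (ι f * L) (λ h → 1ℚ - t h) ⟨
          ∑ (allFin N) (λ h → ι f * L * (1ℚ - t h))
            ≤⟨ ∑-mono (allFin N) markov ⟩
          ∑ (allFin N) (λ h → ι F * (x * count h) + ι f * L * (ι c * E (degenerate h)))
            ≡⟨ trans (∑-+ (allFin N) (λ h → ι F * (x * count h)) (λ h → ι f * L * (ι c * E (degenerate h))))
                 (cong₂ _+_
                   (trans (∑-*ˡ (allFin N) (ι F) (λ h → x * count h)) (cong (ι F *_) (∑-*ˡ (allFin N) x count)))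
                   (trans (∑-*ˡ (allFin N) (ι f * L) (λ h → ι c * E (degenerate h)))
                     (cong (ι f * L *_) (∑-*ˡ (allFin N) (ι c) (λ h → E (degenerate h)))))) ⟩
          rhs ∎
          where
          complement : ∀ a b → a - b ≡ a + (- 1ℚ) * b
          complement = solve-∀ ℚ-ring
        identity : ∀ e c L N T X Λ →
          ι 2 * ((1ℚ + (1ℚ + ι 2 * e)) * X + (1ℚ + ι 2 * e) * L * (c * Λ) - (1ℚ + ι 2 * e) * L * (N - T))
            + ι 4 * (e * (L * N) - (1ℚ + e) * X) + L * (N - ι 2 * (1ℚ + ι 2 * e) * c * Λ) ≡
          L * (ι 2 * (1ℚ + ι 2 * e) * T - N)
        identity = solve-∀ ℚ-ring
        collect : ι 2 * (rhs - lhs) + ι 4 * (ι e * (L * ι N) - ι (suc e) * (x * ∑count))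
            + L * (ι N - ι 2 * ι f * ι c * Λ) ≡ L * (ι 2 * ι f * T - ι N)
        collect = subst (λ z →
            ι 2 * ((1ℚ + (1ℚ + z)) * (x * ∑count) + (1ℚ + z) * L * (ι c * Λ) - (1ℚ + z) * L * (ι N - T))
              + ι 4 * (ι e * (L * ι N) - ι (suc e) * (x * ∑count)) + L * (ι N - ι 2 * (1ℚ + z) * ι c * Λ) ≡
            L * (ι 2 * (1ℚ + z) * T - ι N))
          (sym (ι-* 2 e)) (identity (ι e) (ι c) L (ι N) T (x * ∑count) Λ)

      -- `missing-power` with `M = N` shows that `N P h` is at least the `(K + 1)`-st root of `N`.
      -- It therefore suffices that `L^((d+4)(K+1))` is at most `N`; when `d` exceeds `K`, its
      -- exponent is at most `2d²`.
      missed : ∀ h → Good h → L ^ (d ℕ.+ 4) ≤ ι N * P h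
      missed h (few , _) = ℚ.≤-trans
        (^-cancel-≤ K (0≤* 0≤N (0≤^ n (≤⇒0≤- (^≤1 d 0≤p p≤1)))) (ℚ.≤-trans
          (subst (_≤ ι N) (^-* L (d ℕ.+ 4) (suc K))
            (large-power ((d ℕ.+ 4) ℕ.* suc K) m₁ (2 ℕ.* (d ℕ.* d)) 1≤L factorial≤L exp≤N power≤N cases))
          (missing-power n 0≤x Kx≤1 25F²≤L 0≤L exp≤N few)))
        (*-monoˡ 0≤N (avoids-lower d (supports h) (λ A → ∣supports∣)))
        where
        n = length (supports h)
        cases : (d ℕ.+ 4) ℕ.* suc K ℕ.≤ m₁ ⊎ (d ℕ.+ 4) ℕ.* suc K ℕ.≤ 2 ℕ.* (d ℕ.* d)
        cases with d ℕ.≤? K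
        ... | yes d≤K = inj₁ (ℕ.*-monoˡ-≤ (suc K) (ℕ.+-mono-≤ d≤K (ℕ.m≤m+n 4 2)))
        ... | no  d≰K = inj₂ (ℕ.≤-trans (ℕ.*-mono-≤ (ℕ.+-monoʳ-≤ d (ℕ.≤-trans 4≤K (ℕ.<⇒≤ K<d))) K<d)
              (ℕ.≤-reflexive (trans (cong (ℕ._* d) (cong (d ℕ.+_) (sym (ℕ.+-identityʳ d)))) (ℕ.*-assoc 2 d d))))
          where
          K<d = ℕ.≰⇒> d≰K
          4≤K : 4 ℕ.≤ K
          4≤K = ℕ.≤-trans (ℕ.m≤m+n 4 4) (ℕ.*-monoʳ-≤ 4 2≤F)

      open Pairs M̄ 0≤M̄ mixed≤ using (module Selected)
      open Selected t 0≤t (λ h → 𝟙≤1 (good? h)) L 0≤L count≤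
        using (X; Y; Z; second-moment; chebyshev; E-Y) renaming (mean to m; 0≤mean to 0≤m)

      m-large : L ^ (3 ℕ.+ d) ≤ m
      m-large = *-cancelˡ 0<L (ℚ.≤-trans bound (*-monoʳ 0≤m (subst (_≤ L) (ι-* 2 f) 2f≤L)))
        where
        identity : ∀ n t p → n * (t * p) ≡ t * (n * p)
        identity = solve-∀ ℚ-ring
        Nm : T * L ^ (4 ℕ.+ d) ≤ ι N * m
        Nm = begin
          T * L ^ (4 ℕ.+ d)
            ≡⟨ ∑-*ʳ (allFin N) (L ^ (4 ℕ.+ d)) t ⟨
          ∑ (allFin N) (λ h → t h * L ^ (4 ℕ.+ d))
            ≤⟨ ∑-mono (allFin N) (λ h → 𝟙*-mono (good? h) (λ g → subst (λ j → L ^ j ≤ ι N * P h) (ℕ.+-comm d 4) (missed h g))) ⟩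
          ∑ (allFin N) (λ h → t h * (ι N * P h))
            ≡⟨ trans (∑-cong (allFin N) (λ h → sym (identity (ι N) (t h) (P h)))) (∑-*ˡ (allFin N) (ι N) (λ h → t h * P h)) ⟩
          ι N * m ∎
        identity₂ : ∀ n f m → n * (ι 2 * f * m) ≡ ι 2 * f * (n * m)
        identity₂ = solve-∀ ℚ-ring
        bound : L * L ^ (3 ℕ.+ d) ≤ ι 2 * ι f * m
        bound = *-cancelˡ (ℚ.<-≤-trans 0<1 1≤N′) (begin
          ι N * L ^ (4 ℕ.+ d)                ≤⟨ *-monoʳ (L^ (4 ℕ.+ d)) N≤2fT ⟩
          ι 2 * ι f * T * L ^ (4 ℕ.+ d)      ≡⟨ ℚ.*-assoc (ι 2 * ι f) T (L ^ (4 ℕ.+ d)) ⟩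
          ι 2 * ι f * (T * L ^ (4 ℕ.+ d))    ≤⟨ *-monoˡ (0≤* (0≤ι 2) (0≤ι f)) Nm ⟩
          ι 2 * ι f * (ι N * m)              ≡⟨ identity₂ (ι N) (ι f) m ⟨
          ι N * (ι 2 * ι f * m)              ∎)


      0<m : 0ℚ < m
      0<m = ℚ.<-≤-trans (0<^ (3 ℕ.+ d) 0<L) m-large

      b : ℚ
      b = L * (ι d * O ^ d)

      cb≤m : ι c * b ≤ m
      cb≤m = ℚ.≤-trans (*-mono 0≤L (0≤* 0≤L (0≤* (0≤ι d) (0≤^ d 0≤O′))) c≤L
        (*-monoˡ 0≤L (*-mono 0≤L (0≤^ d 0≤O′) d≤L (^-mono d 0≤O′ O≤L)))) m-large

      cθ≤1 : ι c * (L * M̄) ≤ 1ℚ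
      cθ≤1 = ℚ.≤-trans (*-monoʳ (0≤* 0≤L 0≤M̄) c≤L) (ℚ.≤-reflexive (trans (sym (ℚ.*-assoc L L M̄)) L²M̄≡1))

      cEY≤m : ι c * E Y ≤ m
      cEY≤m = begin
        ι c * E Y
          ≤⟨ *-monoˡ (0≤ι c) E-Y ⟩
        ι c * ∑ (allFin N) (λ h → t h * (P h * E (degenerate h)))
          ≡⟨ trans (sym (∑-*ˡ (allFin N) (ι c) (λ h → t h * (P h * E (degenerate h)))))
               (∑-cong (allFin N) (λ h → identity (ι c) (t h) (P h) (E (degenerate h)))) ⟩
        ∑ (allFin N) (λ h → t h * (P h * (ι c * E (degenerate h))))
          ≤⟨ ∑-mono (allFin N) (λ h → 𝟙*-mono (good? h) (λ (_ , rare) → *≤1≤ (0≤P h) rare)) ⟩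
        m ∎
        where
        identity : ∀ c t p e → c * (t * (p * e)) ≡ t * (p * (c * e))
        identity = solve-∀ ℚ-ring

      0≤Z : 0ℚ ≤ Z
      0≤Z = 0≤∑ (allFin N) (λ g → 0≤∑ (allFin N) (λ h → 0≤* (0≤* (0≤t g) (0≤t h))
        (0≤E (λ S → 0≤* (0≤avoids (supports g) S) (0≤avoids (supports h) S)))))

      D : Subset N → ℚ
      D S = 𝟙 (Cayley.diameterAtMost? G d S)

      X≤Y : ∀ S → 0ℚ < D S → X S ≤ Y S
      X≤Y S 0<D = go (Cayley.diameterAtMost? G d S) 0<D
        where
        go : (diam? : Dec (Cayley.DiameterAtMost G d S)) → 0ℚ < 𝟙 diam? → X S ≤ Y S
        go (no _)     0<0 = contradiction 0<0 (ℚ.<-irrefl refl)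
        go (yes diam) _   = ∑-mono (allFin N) (λ h → *-monoˡ (0≤t h) (dominated h))
          where
          -- `avoids` takes only the values 0 and 1, so it may be multiplied into the bound of
          -- `covered`. The product is what `degenerate-harris` controls.
          dominated : ∀ h → avoids (supports h) S ≤ avoids (supports h) S * degenerate h S
          dominated h with avoids-bit (supports h) S
          ... | inj₁ eq = ℚ.≤-reflexive (trans eq (sym (trans (cong (_* degenerate h S) eq) (ℚ.*-zeroˡ (degenerate h S)))))
          ... | inj₂ eq = ℚ.≤-trans (covered diam h)
                (ℚ.≤-reflexive (sym (trans (cong (_* degenerate h S) eq) (ℚ.*-identityˡ (degenerate h S)))))

      -- A crude bound is enough: in `c-bound` the absorbed error leaves one full `Z`, which has to
      -- be expressed by `m`. With `c ≥ 2` half of `Z` can be moved to the left in `second-moment`.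
      Z≤3m² : Z ≤ ι 3 * (m * m)
      Z≤3m² = ≤-byDiff (identity Z m (L * M̄) b)
        (0≤+ (0≤+ (0≤* (0≤ι 2) (≤⇒0≤- second-moment)) (0≤* 0≤Z (≤⇒0≤- 2θ≤1))) (0≤* 0≤m (≤⇒0≤- 2b≤m)))
        where
        identity : ∀ z m θ b → ι 3 * (m * m) - z ≡
          ι 2 * (m * m + θ * z + b * m - z) + z * (1ℚ - ι 2 * θ) + m * (m - ι 2 * b)
        identity = solve-∀ ℚ-ring
        2θ≤1 : ι 2 * (L * M̄) ≤ 1ℚ
        2θ≤1 = ℚ.≤-trans (*-monoʳ (0≤* 0≤L 0≤M̄) 2≤c) cθ≤1
        2b≤m : ι 2 * b ≤ m
        2b≤m = ℚ.≤-trans (*-monoʳ (0≤* 0≤L (0≤* (0≤ι d) (0≤^ d 0≤O′))) 2≤c) cb≤m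

      -- The constant 6 is 3 from `c θ Z ≤ Z ≤ 3m²`, where `θ = L M̄`, plus 1 from `c b m ≤ m²`,
      -- plus 2 from `2 c m E Y ≤ 2m²`.
      c-bound : ι c * E D ≤ ι 6
      c-bound = *-cancelˡ (0<* 0<m 0<m) (≤-byDiff (identity (ι c) m Z (E Y) (L * M̄) b (E D))
        (0≤+ (0≤+ (0≤+ (0≤+ (0≤+ (0≤* (0≤ι c) (≤⇒0≤- bounded)) (0≤* (0≤ι c) (≤⇒0≤- second-moment)))
          (0≤* 0≤Z (≤⇒0≤- cθ≤1))) (0≤* 0≤m (≤⇒0≤- cb≤m))) (0≤* (0≤* (0≤ι 2) 0≤m) (≤⇒0≤- cEY≤m))) (≤⇒0≤- Z≤3m²)))
        where
        bounded : m * m * E D ≤ Z - m * m + ι 2 * m * E Y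
        bounded = chebyshev (λ S → 0≤𝟙 (Cayley.diameterAtMost? G d S)) (λ S → 𝟙≤1 (Cayley.diameterAtMost? G d S)) X≤Y
        identity : ∀ c m z y θ b p →
          m * m * ι 6 - m * m * (c * p) ≡
          c * (z - m * m + ι 2 * m * y - m * m * p) + c * (m * m + θ * z + b * m - z)
            + z * (1ℚ - c * θ) + m * (m - c * b) + ι 2 * m * (m - c * y) + (ι 3 * (m * m) - z)
        identity = solve-∀ ℚ-ring

    core : ι C * E (λ S → 𝟙 (Cayley.diameterAtMost? G d S)) ≤ 1ℚ
    core = *-cancelˡ (0<ι 5) (ℚ.≤-trans (subst (_≤ ι c * E D) (trans (cong (_* E D) (ι-* 6 C)) (ℚ.*-assoc (ι 6) (ι C) (E D)))
        (*-monoʳ (0≤E (λ S → 0≤𝟙 (Cayley.diameterAtMost? G d S))) (ι-mono (ℕ.m≤m+n (6 ℕ.* C) 2)))) c-bound)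

-- Sequences of rationals

Eventually : (ℕ → Set) → Set
Eventually P = ∃ λ M → ∀ n → M ℕ.≤ n → P n

module _ where
  always : ∀ {P : ℕ → Set} → (∀ n → P n) → Eventually P
  always h = 0 , λ n _ → h n

  eventually-map : ∀ {P Q : ℕ → Set} → (∀ n → P n → Q n) → Eventually P → Eventually Q
  eventually-map f (M , h) = M , λ n M≤n → f n (h n M≤n)

  infixr 2 _&_
  _&_ : ∀ {P Q : ℕ → Set} → Eventually P → Eventually Q → Eventually (λ n → P n × Q n)
  (M , h) & (M′ , h′) = M ℕ.⊔ M′ , λ n M≤n →
    h n (ℕ.m⊔n≤o⇒m≤o M M′ M≤n) , h′ n (ℕ.m⊔n≤o⇒n≤o M M′ M≤n)

  eventually-≤ : ∀ {P : ℕ → ℕ → Set} K → (∀ k → Eventually (P k)) → Eventually (λ n → ∀ k → k ℕ.≤ K → P k n)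
  eventually-≤ {P} zero    h = eventually-map {P 0} (λ { n p zero ℕ.z≤n → p }) (h 0)
  eventually-≤ {P} (suc K) h = eventually-map (λ { n (p , q) k k≤ → combine n p q k (ℕ.m≤n⇒m<n∨m≡n k≤) })
    (h (suc K) & eventually-≤ K h)
    where
    combine : ∀ n → P (suc K) n → (∀ k → k ℕ.≤ K → P k n) → ∀ k → k ℕ.< suc K ⊎ k ≡ suc K → P k n
    combine n p q k (inj₁ (ℕ.s≤s k≤K)) = q k k≤K
    combine n p q k (inj₂ refl)        = p

  witness : ∀ {P : ℕ → Set} → Eventually P → ∃ P
  witness (M , h) = M , h M ℕ.≤-refl

∣∣-≤ : ∀ q → q ≤ ∣ q ∣
∣∣-≤ q with ℚ.≤-total 0ℚ q
... | inj₁ h = ℚ.≤-reflexive (sym (ℚ.0≤p⇒∣p∣≡p h))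
... | inj₂ h = ℚ.≤-trans h (ℚ.0≤∣p∣ q)

∣∣-bound : ∀ {q b} → q ≤ b → - q ≤ b → ∣ q ∣ ≤ b
∣∣-bound {q} {b} h₁ h₂ with ℚ.∣p∣≡p∨∣p∣≡-p q
... | inj₁ eq = subst (_≤ b) (sym eq) h₁
... | inj₂ eq = subst (_≤ b) (sym eq) h₂

∣-∣-≤ : ∀ {a b η} → ∣ a - b ∣ ≤ η → a ≤ b + η
∣-∣-≤ {a} {b} {η} h = subst (_≤ b + η) (identity a b) (ℚ.+-monoʳ-≤ b (ℚ.≤-trans (∣∣-≤ (a - b)) h))
  where
  identity : ∀ a b → b + (a - b) ≡ a
  identity = solve-∀ ℚ-ring

∣-∣-sym : ∀ a b → ∣ a - b ∣ ≡ ∣ b - a ∣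
∣-∣-sym a b = trans (sym (ℚ.∣-p∣≡∣p∣ (a - b))) (cong ∣_∣ (identity a b))
  where
  identity : ∀ a b → - (a - b) ≡ b - a
  identity = solve-∀ ℚ-ring

∣-∣-bound : ∀ {a b η} → a ≤ b + η → b ≤ a + η → ∣ a - b ∣ ≤ η
∣-∣-bound {a} {b} {η} h₁ h₂ = ∣∣-bound
  (≤-byDiff (identity₁ a b η) (≤⇒0≤- h₁)) (≤-byDiff (identity₂ a b η) (≤⇒0≤- h₂))
  where
  identity₁ : ∀ a b η → η - (a - b) ≡ b + η - a
  identity₁ = solve-∀ ℚ-ring
  identity₂ : ∀ a b η → η - (- (a - b)) ≡ a + η - b
  identity₂ = solve-∀ ℚ-ring

infix 4 _≋_

_≋_ : (ℕ → ℚ) → (ℕ → ℚ) → Set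
x ≋ y = ∀ η → 0ℚ < η → Eventually (λ n → ∣ x n - y n ∣ ≤ η)

Bounded : (ℕ → ℚ) → Set
Bounded x = ∃ λ b → 0ℚ ≤ b × Eventually (λ n → ∣ x n ∣ ≤ b)

-- Boundedness is included so that products preserve closeness; it is required of one sequence only,
-- since the other inherits it.
Close : (ℕ → ℚ) → (ℕ → ℚ) → Set
Close x y = Bounded x × x ≋ y

1/suc : ℕ → ℚ
1/suc k = ℤ.+ 1 / suc k

suc*1/suc : ∀ k → ι (suc k) * 1/suc k ≡ 1ℚ
suc*1/suc k = ι*1/ (suc k)

0<1/suc : ∀ k → 0ℚ < 1/suc k
0<1/suc k = ℚ.≰⇒> λ h → ℚ.<-irrefl refl (ℚ.<-≤-trans 0<1
  (subst₂ _≤_ (suc*1/suc k) (ℚ.*-zeroʳ (ι (suc k))) (*-monoˡ (0≤ι (suc k)) h)))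

≋-sym : ∀ {x y} → x ≋ y → y ≋ x
≋-sym {x} {y} h η η>0 = eventually-map (λ n → subst (_≤ η) (∣-∣-sym (x n) (y n))) (h η η>0)

half : ∀ η → ½ * η + ½ * η ≡ η
half = solve-∀ ℚ-ring

0<½ : 0ℚ < ½
0<½ = ℚ.positive⁻¹ ½

0<½* : ∀ {η} → 0ℚ < η → 0ℚ < ½ * η
0<½* = 0<* 0<½

∣-∣-triangle : ∀ a b c {r s} → ∣ a - b ∣ ≤ r → ∣ b - c ∣ ≤ s → ∣ a - c ∣ ≤ r + s
∣-∣-triangle a b c {r} {s} h₁ h₂ = subst (λ z → ∣ z ∣ ≤ r + s) (identity a b c)
  (ℚ.≤-trans (ℚ.∣p+q∣≤∣p∣+∣q∣ (a - b) (b - c)) (ℚ.+-mono-≤ h₁ h₂))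
  where
  identity : ∀ a b c → (a - b) + (b - c) ≡ a - c
  identity = solve-∀ ℚ-ring

≋-trans : ∀ {x y z} → x ≋ y → y ≋ z → x ≋ z
≋-trans {x} {y} {z} h₁ h₂ η η>0 = eventually-map
  (λ n (a , b) → subst (∣ x n - z n ∣ ≤_) (half η) (∣-∣-triangle (x n) (y n) (z n) a b))
  (h₁ (½ * η) (0<½* η>0) & h₂ (½ * η) (0<½* η>0))

≃ᵣ⇒≋ : ∀ {x y} → x ≃ᵣ y → seq x ≋ seq y
≃ᵣ⇒≋ h η η>0 = eventually-map (λ n → ℚ.<⇒≤) (h η η>0)

cauchy⇒bounded : ∀ x → Bounded (seq x)
cauchy⇒bounded x with cauchy x 1ℚ 0<1
... | M , h = ∣ seq x M ∣ + 1ℚ , 0≤+ (ℚ.0≤∣p∣ (seq x M)) 0≤1 , M , λ n M≤n →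
  subst (λ z → ∣ z ∣ ≤ ∣ seq x M ∣ + 1ℚ) (identity (seq x n) (seq x M))
    (ℚ.≤-trans (ℚ.∣p+q∣≤∣p∣+∣q∣ (seq x M) (seq x n - seq x M))
      (ℚ.+-monoʳ-≤ ∣ seq x M ∣ (ℚ.<⇒≤ (h n M M≤n ℕ.≤-refl))))
  where
  identity : ∀ a b → b + (a - b) ≡ a
  identity = solve-∀ ℚ-ring

close-const : ∀ c → Close (λ _ → c) (λ _ → c)
close-const c = (∣ c ∣ , ℚ.0≤∣p∣ c , always (λ _ → ℚ.≤-refl)) , λ η η>0 →
  always (λ _ → subst (λ z → ∣ z ∣ ≤ η) (sym (ℚ.+-inverseʳ c)) (ℚ.<⇒≤ η>0))

close-+ : ∀ {x y x′ y′} → Close x x′ → Close y y′ → Close (λ n → x n + y n) (λ n → x′ n + y′ n)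
close-+ {x} {y} {x′} {y′} ((b , b≥0 , bx) , hx) ((b′ , b′≥0 , by) , hy) =
  (b + b′ , 0≤+ b≥0 b′≥0 , eventually-map (λ n (h , h′) → ℚ.≤-trans (ℚ.∣p+q∣≤∣p∣+∣q∣ (x n) (y n)) (ℚ.+-mono-≤ h h′)) (bx & by)) ,
  λ η η>0 → eventually-map
    (λ n (h , h′) → subst₂ (λ z e → ∣ z ∣ ≤ e) (sym (identity (x n) (y n) (x′ n) (y′ n))) (half η)
      (ℚ.≤-trans (ℚ.∣p+q∣≤∣p∣+∣q∣ (x n - x′ n) (y n - y′ n)) (ℚ.+-mono-≤ h h′)))
    (hx (½ * η) (0<½* η>0) & hy (½ * η) (0<½* η>0))
  where
  identity : ∀ a b c d → a + b - (c + d) ≡ (a - c) + (b - d)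
  identity = solve-∀ ℚ-ring

close-* : ∀ {x y x′ y′} → Close x x′ → Close y y′ → Close (λ n → x n * y n) (λ n → x′ n * y′ n)
close-* {x} {y} {x′} {y′} ((b , b≥0 , bx) , hx) ((b′ , b′≥0 , by) , hy) =
  (b * b′ , 0≤* b≥0 b′≥0 , eventually-map (λ n (h , h′) → subst (_≤ b * b′) (sym (ℚ.∣p*q∣≡∣p∣*∣q∣ (x n) (y n)))
    (*-mono b≥0 (ℚ.0≤∣p∣ (y n)) h h′)) (bx & by)) ,
  λ η η>0 →
    let k , B≤k = archimedean (b + (b′ + 1ℚ))
        ζ = 1/suc k * η
        0<ζ = 0<* (0<1/suc k) η>0
    in eventually-map (λ n (h₁ , h₂ , h₃ , h₄ , h₅) → begin
         ∣ x n * y n - x′ n * y′ n ∣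
           ≡⟨ cong ∣_∣ (identity₁ (x n) (y n) (x′ n) (y′ n)) ⟩
         ∣ x′ n * (y n - y′ n) + y n * (x n - x′ n) ∣
           ≤⟨ ℚ.∣p+q∣≤∣p∣+∣q∣ (x′ n * (y n - y′ n)) (y n * (x n - x′ n)) ⟩
         ∣ x′ n * (y n - y′ n) ∣ + ∣ y n * (x n - x′ n) ∣
           ≡⟨ cong₂ _+_ (ℚ.∣p*q∣≡∣p∣*∣q∣ (x′ n) (y n - y′ n)) (ℚ.∣p*q∣≡∣p∣*∣q∣ (y n) (x n - x′ n)) ⟩
         ∣ x′ n ∣ * ∣ y n - y′ n ∣ + ∣ y n ∣ * ∣ x n - x′ n ∣
           ≤⟨ ℚ.+-mono-≤ (*-mono (0≤+ b≥0 0≤1) (ℚ.0≤∣p∣ (y n - y′ n)) (x′-bound n h₁ h₅) h₄)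
                (*-mono b′≥0 (ℚ.0≤∣p∣ (x n - x′ n)) h₂ h₃) ⟩
         (b + 1ℚ) * ζ + b′ * ζ
           ≡⟨ identity₂ b b′ ζ ⟩
         (b + (b′ + 1ℚ)) * ζ
           ≤⟨ *-monoʳ (ℚ.<⇒≤ 0<ζ) (ℚ.≤-trans B≤k (ι-mono (ℕ.n≤1+n k))) ⟩
         ι (suc k) * (1/suc k * η)
           ≡⟨ trans (sym (ℚ.*-assoc (ι (suc k)) (1/suc k) η)) (trans (cong (_* η) (suc*1/suc k)) (ℚ.*-identityˡ η)) ⟩
         η ∎)
       (bx & by & hx ζ 0<ζ & hy ζ 0<ζ & hx 1ℚ 0<1)
  where
  open ℚ.≤-Reasoning
  identity₁ : ∀ a b c d → a * b - c * d ≡ c * (b - d) + b * (a - c)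
  identity₁ = solve-∀ ℚ-ring
  identity₂ : ∀ a b z → (a + 1ℚ) * z + b * z ≡ (a + (b + 1ℚ)) * z
  identity₂ = solve-∀ ℚ-ring
  identity₃ : ∀ a c → a + (c - a) ≡ c
  identity₃ = solve-∀ ℚ-ring
  x′-bound : ∀ n → ∣ x n ∣ ≤ b → ∣ x n - x′ n ∣ ≤ 1ℚ → ∣ x′ n ∣ ≤ b + 1ℚ
  x′-bound n h₁ h₅ = subst (λ z → ∣ z ∣ ≤ b + 1ℚ) (identity₃ (x n) (x′ n))
    (ℚ.≤-trans (ℚ.∣p+q∣≤∣p∣+∣q∣ (x n) (x′ n - x n))
      (ℚ.+-mono-≤ h₁ (subst (_≤ 1ℚ) (∣-∣-sym (x n) (x′ n)) h₅)))

close-^ : ∀ {x x′} d → Close x x′ → Close (λ n → x n ^ d) (λ n → x′ n ^ d)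
close-^ zero    h = close-const 1ℚ
close-^ (suc d) h = close-* h (close-^ d h)

seq-^ : ∀ x d n → seq (x ^ᵣ d) n ≡ seq x n ^ d
seq-^ x zero    n = refl
seq-^ x (suc d) n = cong (seq x n *_) (seq-^ x d n)

-- The probability as a polynomial in `p`

expectation : ∀ {n} → ℚ → (Subset n → ℚ) → ℚ
expectation {zero}  p f = f []
expectation {suc n} p f = p * expectation p (f ∘ (inside ∷_)) + (1ℚ - p) * expectation p (f ∘ (outside ∷_))

-- `E` presupposes `0 ≤ p ≤ 1`, which approximations of a real number in that interval may violate.
-- `expectation` is the same polynomial without the presupposition, and this returns to `E` after
-- clamping.
expectation≡E : ∀ {n} p 0≤p p≤1 (f : Subset n → ℚ) → expectation p f ≡ Expectation.E p 0≤p p≤1 f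
expectation≡E {zero}  p 0≤p p≤1 f = refl
expectation≡E {suc n} p 0≤p p≤1 f = cong₂ (λ a b → p * a + (1ℚ - p) * b)
  (expectation≡E p 0≤p p≤1 (f ∘ (inside ∷_))) (expectation≡E p 0≤p p≤1 (f ∘ (outside ∷_)))

close-expectation : ∀ {m} (f : Subset m → ℚ) {p p′} → Close p p′ →
                    Close (λ n → expectation (p n) f) (λ n → expectation (p′ n) f)
close-expectation {zero}  f h = close-const (f [])
close-expectation {suc m} f {p} {p′} h = close-+
  (close-* {p} {x′ = p′} h (close-expectation (f ∘ (inside ∷_)) h))
  (close-* {λ n → 1ℚ - p n} {x′ = λ n → 1ℚ - p′ n}
    (close-+ {λ _ → 1ℚ} {x′ = λ _ → 1ℚ} (close-const 1ℚ) (close-neg h)) (close-expectation (f ∘ (outside ∷_)) h))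
  where
  close-neg : ∀ {x y} → Close x y → Close (λ n → - x n) (λ n → - y n)
  close-neg {x} {y} ((b , b≥0 , bx) , h) =
    (b , b≥0 , eventually-map (λ n → subst (_≤ b) (sym (ℚ.∣-p∣≡∣p∣ (x n)))) bx) ,
    λ η η>0 → eventually-map (λ n → subst (_≤ η) (trans (∣-∣-sym (x n) (y n)) (cong ∣_∣ (identity (x n) (y n))))) (h η η>0)
    where
    identity : ∀ a b → b - a ≡ - a - (- b)
    identity = solve-∀ ℚ-ring

module _ (p : ℝ) (k : ℕ) where

  ∑-weights : ∀ {n} (f : Subset n → ℚ) →
    ∑ (subsets n) (λ S → f S * seq (weight p S) k) ≡ expectation (seq p k) f
  ∑-weights {zero}  f = trans (ℚ.+-identityʳ (f [] * 1ℚ)) (ℚ.*-identityʳ (f []))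
  ∑-weights {suc n} f = trans
    (∑-++ (List.map (inside ∷_) (subsets n)) (List.map (outside ∷_) (subsets n)) (λ S → f S * seq (weight p S) k))
    (cong₂ _+_ (branch inside (seq p k) (λ S → refl)) (branch outside (1ℚ - seq p k) (λ S → refl)))
    where
    identity : ∀ f q w → f * (q * w) ≡ q * (f * w)
    identity = solve-∀ ℚ-ring
    branch : ∀ b q → (∀ S → seq (weight p (b ∷ S)) k ≡ q * seq (weight p S) k) →
      ∑ (List.map (b ∷_) (subsets n)) (λ S → f S * seq (weight p S) k) ≡ q * expectation (seq p k) (f ∘ (b ∷_))
    branch b q eq = trans (∑-map (b ∷_) (subsets n) (λ S → f S * seq (weight p S) k))
      (trans (∑-cong (subsets n) (λ S → trans (cong (f (b ∷ S) *_) (eq S)) (identity (f (b ∷ S)) q (seq (weight p S) k))))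
        (trans (∑-*ˡ (subsets n) q (λ S → f (b ∷ S) * seq (weight p S) k)) (cong (q *_) (∑-weights (f ∘ (b ∷_))))))

  seq-sumᵣ : ∀ {a} {A : Set a} (g : A → ℝ) (xs : List A) →
             seq (sumᵣ (List.map g xs)) k ≡ ∑ xs (λ x → seq (g x) k)
  seq-sumᵣ g []       = refl
  seq-sumᵣ g (x ∷ xs) = cong (seq (g x) k +_) (seq-sumᵣ g xs)

  seq-Pr : ∀ {n a} {Ev : Pred (Subset n) a} (Ev? : Decidable Ev) →
           seq (Pr p Ev?) k ≡ expectation (seq p k) (λ S → 𝟙 (Ev? S))
  seq-Pr {n} Ev? = trans (seq-sumᵣ (weight p) (filter Ev? (subsets n)))
    (trans (∑-filter Ev? (subsets n) (λ S → seq (weight p S) k)) (∑-weights (λ S → 𝟙 (Ev? S))))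

-- Exponentials of reals

seq-expPartialSum : ∀ y k n → seq (expPartialSum y k) n ≡ expSum (seq y n) k
seq-expPartialSum y zero    n = refl
seq-expPartialSum y (suc k) n = cong₂ (λ a b → a + b * inverse-! k) (seq-expPartialSum y k n) (seq-^ y k n)

fromℚ>0 : ∀ {η} → 0ℚ < η → 0ᵣ <ᵣ fromℚ η
fromℚ>0 {η} η>0 = ½ * η , 0<½* η>0 , 0 , λ _ _ →
  subst₂ _<_ (sym (ℚ.+-identityˡ (½ * η))) (half η) (ℚ.<-respˡ-≡ (ℚ.+-identityʳ (½ * η)) (ℚ.+-monoʳ-< (½ * η) (0<½* η>0)))

<ᵣ⇒≤ : ∀ {x y} → x <ᵣ y → Eventually (λ n → seq x n ≤ seq y n)
<ᵣ⇒≤ (η , η>0 , M , h) = M , λ n M≤n → ℚ.≤-trans (≤+nonneg (ℚ.<⇒≤ η>0)) (ℚ.<⇒≤ (h n M≤n))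

module _ {x y : ℝ} (x≡exp : x IsExpOf y) where

  exp-limit : ∀ η → 0ℚ < η → ∃ λ K → ∀ k → K ℕ.≤ k → Eventually (λ n →
    expSum (seq y n) k ≤ seq x n + η × seq x n ≤ expSum (seq y n) k + η)
  exp-limit η η>0 =
    let K , h = x≡exp (fromℚ η) (fromℚ>0 η>0)
    in K , λ k K≤k → eventually-map
      (λ n (a , b) → subst (_≤ seq x n + η) (seq-expPartialSum y k n) a ,
                     subst (λ z → seq x n ≤ z + η) (seq-expPartialSum y k n) b)
      (<ᵣ⇒≤ {expPartialSum y k} {x +ᵣ fromℚ η} (proj₁ (h k K≤k)) &
       <ᵣ⇒≤ {x} {expPartialSum y k +ᵣ fromℚ η} (proj₂ (h k K≤k)))

  expSum≤ : ∀ k η → 0ℚ < η → Eventually (λ n → ∀ z → 0ℚ ≤ z → z ≤ seq y n → expSum z k ≤ seq x n + η)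
  expSum≤ k η η>0 =
    let K , h = exp-limit η η>0
    in eventually-map (λ n (a , _) z 0≤z z≤y → ℚ.≤-trans
         (ℚ.≤-trans (expSum-monoʳ 0≤z (ℕ.m≤n+m k K)) (expSum-mono (K ℕ.+ k) 0≤z z≤y)) a)
       (h (K ℕ.+ k) (ℕ.m≤m+n K k))

∣^∣ : ∀ a k → ∣ a ^ k ∣ ≡ ∣ a ∣ ^ k
∣^∣ a zero    = refl
∣^∣ a (suc k) = trans (ℚ.∣p*q∣≡∣p∣*∣q∣ a (a ^ k)) (cong (∣ a ∣ *_) (∣^∣ a k))

∣expSum∣≤ : ∀ a k → ∣ expSum a k ∣ ≤ expSum ∣ a ∣ k
∣expSum∣≤ a zero    = ℚ.≤-refl
∣expSum∣≤ a (suc k) = ℚ.≤-trans (ℚ.∣p+q∣≤∣p∣+∣q∣ (expSum a k) (term a k)) (ℚ.+-mono-≤ (∣expSum∣≤ a k)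
  (ℚ.≤-reflexive (trans (ℚ.∣p*q∣≡∣p∣*∣q∣ (a ^ k) (inverse-! k))
    (cong₂ _*_ (∣^∣ a k) (ℚ.0≤p⇒∣p∣≡p (0≤inverse-! k))))))

module _ where
  open ℚ.≤-Reasoning

  module Gap (x y : ℕ → ℚ) (U : ℚ) (U≥0 : 0ℚ ≤ U) (k₀ : ℕ) (b : ℚ) (b≥0 : 0ℚ ≤ b)
                     (q : ℕ) (Q≤q : ι 2 * (ι (suc k₀) * expSum b k₀) ≤ ι q)
                     (J₀ : ℕ) (late : ∀ j → J₀ ℕ.≤ j → ι (suc q) * term U j ≤ 1ℚ) (K₀ : ℕ) where
    -- The summand 2 secures the terms `1 + u`, `J₀` makes the later terms at `u` small, and `K₀`
    -- allows a prescribed lower bound for the number of terms.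
    J : ℕ
    J = 2 ℕ.+ (J₀ ℕ.+ K₀)
    B = expSum b k₀
    0≤B : 0ℚ ≤ B
    0≤B = 0≤expSum k₀ b≥0
    -- The uncontrolled part of the convolution has `k₀ + 1` summands, each a late term of size at
    -- most `1/(q + 1)` times a partial sum of absolute value at most `B`; `q` is chosen so that
    -- together they cost at most one half.
    small : ι (suc k₀) * (1/suc q * B) ≤ ½
    small = begin
      ι (suc k₀) * (1/suc q * B)                ≡⟨ identity (ι (suc k₀)) (1/suc q) B ⟩
      ½ * (1/suc q * (ι 2 * (ι (suc k₀) * B)))
        ≤⟨ *-monoˡ (ℚ.nonNegative⁻¹ ½) (*-monoˡ (ℚ.<⇒≤ (0<1/suc q)) (ℚ.≤-trans Q≤q (ι-mono (ℕ.n≤1+n q)))) ⟩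
      ½ * (1/suc q * ι (suc q))
        ≡⟨ cong (½ *_) (trans (ℚ.*-comm (1/suc q) (ι (suc q))) (suc*1/suc q)) ⟩
      ½                                         ∎
      where
      identity : ∀ k r b → k * (r * b) ≡ ½ * (r * (ι 2 * (k * b)))
      identity = solve-∀ ℚ-ring
    step : ∀ n → 1ℚ ≤ x n × ∣ y n ∣ ≤ b × (∀ k → k ℕ.≤ J ℕ.+ k₀ → k₀ ℕ.≤ k → x n ≤ expSum (y n) k + ½) →
      ∀ z → y n ≤ z → z - y n ≤ U → (x n - ½) * (1ℚ + (z - y n)) ≤ expSum z (J ℕ.+ k₀) + ½
    step n (1≤xn , ∣yn∣≤b , close) z yn≤z u≤U = begin
      v * (1ℚ + u)
        ≡⟨ cong (v *_) (expSum-2 u) ⟨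
      v * expSum u 2
        ≤⟨ *-monoˡ 0≤v (expSum-monoʳ 0≤u (ℕ.m≤m+n 2 (J₀ ℕ.+ K₀))) ⟩
      v * expSum u J
        ≡⟨ identity₁ (v * expSum u J) ½ ⟩
      v * expSum u J + - ½ + ½
        ≤⟨ ℚ.+-monoˡ-≤ ½ (ℚ.+-mono-≤ (ℚ.≤-reflexive (cong (v *_) (expSum-prefix u J)))
             (ℚ.≤-trans (ℚ.neg-antimono-≤ small) (convolution-≥ k₀ {f = term u ∘ (J ℕ.+_)} {g = expSum (y n)}
               (λ i → 0≤term (J ℕ.+ i) 0≤u) late-term 0≤B early))) ⟩
      v * prefix J (term u) + convolution k₀ (term u ∘ (J ℕ.+_)) (expSum (y n)) + ½
        ≤⟨ ℚ.+-monoˡ-≤ ½ (convolution-split J k₀ {g = expSum (y n)} (λ i → 0≤term i 0≤u) (λ i k₀≤i i≤ →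
             ≤-byDiff (identity₂ (expSum (y n) i) (x n) ½) (≤⇒0≤- (close i i≤ k₀≤i)))) ⟩
      convolution (J ℕ.+ k₀) (term u) (expSum (y n)) + ½
        ≡⟨ cong (_+ ½) (trans (sym (expSum-+ (J ℕ.+ k₀) u (y n))) (cong (λ w → expSum w (J ℕ.+ k₀)) (a-b+b z (y n)))) ⟩
      expSum z (J ℕ.+ k₀) + ½ ∎
      where
      u = z - y n
      v = x n - ½
      0≤u : 0ℚ ≤ u
      0≤u = ≤⇒0≤- yn≤z
      0≤v : 0ℚ ≤ v
      0≤v = ≤⇒0≤- (ℚ.≤-trans ½≤1 1≤xn)
        where
        ½≤1 : ½ ≤ 1ℚ
        ½≤1 = ≤-byDiff {c = ½} refl (ℚ.nonNegative⁻¹ ½)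
      late-term : ∀ i → term u (J ℕ.+ i) ≤ 1/suc q
      late-term i = ℚ.≤-trans (term-mono (J ℕ.+ i) 0≤u u≤U) (*-cancelˡ (0<ι q)
        (subst (ι (suc q) * term U (J ℕ.+ i) ≤_) (sym (suc*1/suc q))
          (late (J ℕ.+ i) (ℕ.≤-trans (ℕ.≤-trans (ℕ.m≤m+n J₀ K₀) (ℕ.m≤n+m (J₀ ℕ.+ K₀) 2)) (ℕ.m≤m+n J i)))))
      early : ∀ i → i ℕ.≤ k₀ → - B ≤ expSum (y n) i
      early i i≤k₀ = subst (- B ≤_) (identity₃ (expSum (y n) i)) (ℚ.neg-antimono-≤ (begin
        - expSum (y n) i          ≤⟨ ∣∣-≤ (- expSum (y n) i) ⟩
        ∣ - expSum (y n) i ∣      ≡⟨ ℚ.∣-p∣≡∣p∣ (expSum (y n) i) ⟩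
        ∣ expSum (y n) i ∣        ≤⟨ ∣expSum∣≤ (y n) i ⟩
        expSum ∣ y n ∣ i          ≤⟨ expSum-mono i (ℚ.0≤∣p∣ (y n)) ∣yn∣≤b ⟩
        expSum b i                    ≤⟨ expSum-monoʳ b≥0 i≤k₀ ⟩
        B                             ∎))
        where
        identity₃ : ∀ a → - (- a) ≡ a
        identity₃ = solve-∀ ℚ-ring
      identity₁ : ∀ a h → a ≡ a + - h + h
      identity₁ = solve-∀ ℚ-ring
      identity₂ : ∀ a x h → a - (x - h) ≡ a + h - x
      identity₂ = solve-∀ ℚ-ring

  -- Writing z = u + y with u ≥ 0, the partial sum at z is a convolution in which the partial sums
  -- at y are close to x = exp y except for boundedly many, and those are multiplied by late terms at u.
  -- This also covers negative y, where partial sums are not monotone.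
  exp-gap : ∀ {x y} → x IsExpOf y → Eventually (λ n → 1ℚ ≤ seq x n) → ∀ U → 0ℚ ≤ U → ∀ K₀ →
    ∃ λ K → K₀ ℕ.≤ K × Eventually (λ n → ∀ z → seq y n ≤ z → z - seq y n ≤ U →
      (seq x n - ½) * (1ℚ + (z - seq y n)) ≤ expSum z K + ½)
  exp-gap {x} {y} x≡exp 1≤x U U≥0 K₀ =
    let k₀ , limit = exp-limit {x} {y} x≡exp ½ 0<½
        b , b≥0 , y≤b = cauchy⇒bounded y
        q , Q≤q = archimedean (ι 2 * (ι (suc k₀) * expSum b k₀))
        J₀ , late = term-vanishes U≥0 (suc q)
        open Gap (seq x) (seq y) U U≥0 k₀ b b≥0 q Q≤q J₀ late K₀
    in J ℕ.+ k₀ , ℕ.≤-trans (ℕ.≤-trans (ℕ.m≤n+m K₀ J₀) (ℕ.m≤n+m (J₀ ℕ.+ K₀) 2)) (ℕ.m≤m+n J k₀) ,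
       eventually-map step (1≤x & y≤b & eventually-≤ {P = λ k n → k₀ ℕ.≤ k → seq x n ≤ expSum (seq y n) k + ½}
         (J ℕ.+ k₀) (window k₀ limit))
    where
    window : ∀ k₀ → (∀ k → k₀ ℕ.≤ k → Eventually (λ n →
      expSum (seq y n) k ≤ seq x n + ½ × seq x n ≤ expSum (seq y n) k + ½)) →
      ∀ k → Eventually (λ n → k₀ ℕ.≤ k → seq x n ≤ expSum (seq y n) k + ½)
    window k₀ limit k with k₀ ℕ.≤? k
    ... | yes k₀≤k = eventually-map (λ n (_ , h) _ → h) (limit k k₀≤k)
    ... | no  k₀≰k = always (λ _ k₀≤k → contradiction k₀≤k k₀≰k)

  difference-bounded : ∀ (x y : ℝ) → ∃ λ U → 0ℚ ≤ U × Eventually (λ n → seq x n - seq y n ≤ U)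
  difference-bounded x y =
    let b , b≥0 , hx = cauchy⇒bounded x
        b′ , b′≥0 , hy = cauchy⇒bounded y
    in b + b′ , 0≤+ b≥0 b′≥0 , eventually-map (λ n (p , q) → begin
      seq x n - seq y n            ≤⟨ ∣∣-≤ (seq x n - seq y n) ⟩
      ∣ seq x n - seq y n ∣        ≤⟨ ℚ.∣p-q∣≤∣p∣+∣q∣ (seq x n) (seq y n) ⟩
      ∣ seq x n ∣ + ∣ seq y n ∣    ≤⟨ ℚ.+-mono-≤ p q ⟩
      b + b′                       ∎) (hx & hy)

  abstract
    -- If `y` were below `b`, then `exp-gap` at `z = b` would bound `x - ½` by a partial sum at `b`
    -- plus one half, hence `x` by `B + 1`. The bound `B` depends on `b` alone, which makes the
    -- final threshold for `N` uniform.
    exp-large⇒large : ∀ b → 0ℚ ≤ b → ∃ λ B → ∀ {x y} → x IsExpOf y →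
      Eventually (λ n → ι B ≤ seq x n) → Eventually (λ n → b ≤ seq y n)
    exp-large⇒large b b≥0 =
      let s , _ , expSum≤s = expSum-bounded b≥0
          B , s≤B = archimedean s
      in 2 ℕ.+ B , λ {x} {y} x≡exp large →
        let U , U≥0 , hU = difference-bounded (fromℚ b) y
            K , _ , gap = exp-gap {x} {y} x≡exp (eventually-map (λ n → ℚ.≤-trans (ι-mono {1} {2 ℕ.+ B} (ℕ.s≤s ℕ.z≤n))) large) U U≥0 0
        in eventually-map (λ n (big , diff , g) → conclude s B expSum≤s s≤B (seq x n) (seq y n) K big diff g) (large & hU & gap)
      where
      conclude : ∀ s B → (∀ k → expSum b k ≤ s) → s ≤ ι B → ∀ x y K {U} → ι (2 ℕ.+ B) ≤ x → b - y ≤ U →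
        (∀ z → y ≤ z → z - y ≤ U → (x - ½) * (1ℚ + (z - y)) ≤ expSum z K + ½) → b ≤ y
      conclude s B expSum≤s s≤B x y K big diff g with b ℚ.≤? y
      ... | yes b≤y = b≤y
      ... | no  b≰y = contradiction (ℚ.<-≤-trans 0<1 (begin
        1ℚ
          ≤⟨ ≤-byDiff (identity (ι B) s) (≤⇒0≤- s≤B) ⟩
        ι (2 ℕ.+ B) - s - 1ℚ
          ≤⟨ ≤-byDiff (identity₂ (ι (2 ℕ.+ B)) x s (expSum b K) (b - y))
               (0≤+ (0≤+ (0≤+ (≤⇒0≤- big) (≤⇒0≤- (g b (ℚ.<⇒≤ y<b) diff))) (≤⇒0≤- (expSum≤s K)))
                 (0≤* (≤⇒0≤- (ℚ.≤-trans ½≤2+B big)) (≤⇒0≤- (ℚ.<⇒≤ y<b)))) ⟩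
        0ℚ ∎)) (ℚ.<-irrefl refl)
        where
        y<b : y < b
        y<b = ℚ.≰⇒> b≰y
        ½≤2+B : ½ ≤ ι (2 ℕ.+ B)
        ½≤2+B = ℚ.≤-trans (≤-byDiff {½} {1ℚ} {½} refl (ℚ.nonNegative⁻¹ ½)) (1≤ι (suc B))
        identity : ∀ B s → 1ℚ + (1ℚ + B) - s - 1ℚ - 1ℚ ≡ B - s
        identity = solve-∀ ℚ-ring
        identity₂ : ∀ B x s e u → 0ℚ - (B - s - 1ℚ) ≡ x - B + (e + ½ - (x - ½) * (1ℚ + u)) + (s - e) + (x - ½) * u
        identity₂ = solve-∀ ℚ-ring

  -- The degree bound and the probability bound each bring a logarithm of `N`; agreement up to 1 is
  -- all that is needed. If `y′` exceeded `y + 1`, then `exp-gap` at `z = y′` would give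
  -- `2(x - ½) ≤ x + 1`, impossible for `x ≥ 3`.
  exp-injective : ∀ {x y y′} → x IsExpOf y → x IsExpOf y′ → Eventually (λ n → ι 3 ≤ seq x n) →
    Eventually (λ n → seq y′ n ≤ seq y n + 1ℚ)
  exp-injective {x} {y} {y′} x≡exp x≡exp′ large =
    let U , U≥0 , hU = difference-bounded y′ y
        K′ , limit = exp-limit {x} {y′} x≡exp′ ½ (0<½)
        K , K′≤K , gap = exp-gap {x} {y} x≡exp (eventually-map (λ n → ℚ.≤-trans (ι-mono {1} {3} (ℕ.s≤s ℕ.z≤n))) large) U U≥0 K′
    in eventually-map (λ n (big , diff , g , upper , _) → conclude (seq x n) (seq y n) (seq y′ n) K big diff g upper)
         (large & hU & gap & limit K K′≤K)
    where
    conclude : ∀ x y y′ K {U} → ι 3 ≤ x → y′ - y ≤ U →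
      (∀ z → y ≤ z → z - y ≤ U → (x - ½) * (1ℚ + (z - y)) ≤ expSum z K + ½) → expSum y′ K ≤ x + ½ → y′ ≤ y + 1ℚ
    conclude x y y′ K big diff g upper with y′ ℚ.≤? y + 1ℚ
    ... | yes h = h
    ... | no  h = contradiction (ℚ.<-≤-trans 0<1 (begin
      1ℚ
        ≤⟨ ≤-byDiff (identity x) (≤⇒0≤- big) ⟩
      x - ι 2
        ≤⟨ ≤-byDiff (identity₂ x (expSum y′ K) y y′) (0≤+ (0≤+ (≤⇒0≤- (g y′ y≤y′ diff)) (≤⇒0≤- upper))
             (0≤* (≤⇒0≤- (ℚ.≤-trans ½≤3 big)) (≤⇒0≤- (ℚ.<⇒≤ y+1<y′)))) ⟩
      0ℚ ∎)) (ℚ.<-irrefl refl)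
      where
      y+1<y′ = ℚ.≰⇒> h
      y≤y′ = ℚ.≤-trans (≤+nonneg 0≤1) (ℚ.<⇒≤ y+1<y′)
      ½≤3 : ½ ≤ ι 3
      ½≤3 = ℚ.≤-trans (≤-byDiff {½} {1ℚ} {½} refl (ℚ.nonNegative⁻¹ ½)) (1≤ι 2)
      identity : ∀ x → x - ι 2 - 1ℚ ≡ x - ι 3
      identity = solve-∀ ℚ-ring
      identity₂ : ∀ x e y y′ → 0ℚ - (x - ι 2) ≡ e + ½ - (x - ½) * (1ℚ + (y′ - y)) + (x + ½ - e) + (x - ½) * (y′ - (y + 1ℚ))
      identity₂ = solve-∀ ℚ-ring

-- The hypotheses of the theorem, in terms of approximations

≤-closed : ∀ {a b} → (∀ η → 0ℚ < η → a ≤ b + η) → a ≤ b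
≤-closed {a} {b} h = ℚ.≮⇒≥ λ b<a →
  let 0<δ = 0<½* (ℚ.≤-<-trans (ℚ.≤-reflexive (sym (ℚ.+-inverseʳ b))) (ℚ.+-monoˡ-< (- b) b<a))
  in ℚ.<-irrefl refl (ℚ.<-≤-trans 0<δ (≤-byDiff (identity a b) (≤⇒0≤- (h (½ * (a - b)) 0<δ))))
  where
  identity : ∀ a b → 0ℚ - ½ * (a - b) ≡ b + ½ * (a - b) - a
  identity = solve-∀ ℚ-ring

recip-inverse : ∀ x (x>0 : 0ᵣ <ᵣ x) → Eventually (λ n → seq (recip x x>0) n * seq x n ≡ 1ℚ)
recip-inverse x x>0@(κ , κ>0 , M , h) = M , λ n M≤n →
  let t≢0 = ℚ.pos⇒nonZero (κ ⊔ seq x n) {{positive (ℚ.<-≤-trans κ>0 (ℚ.p≤p⊔q κ (seq x n)))}}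
      κ≤x = ℚ.<⇒≤ (subst (_< seq x n) (ℚ.+-identityˡ κ) (h n M≤n))
  in trans (cong (seq (recip x x>0) n *_) (sym (ℚ.p≤q⇒p⊔q≡q κ≤x))) (ℚ.*-inverseˡ (κ ⊔ seq x n) {{t≢0}})

module _ where
  open ℚ.≤-Reasoning

  -- The slack provided by `γ ≥ g` absorbs the errors of approximation: as `r ≥ 1`, the bound on `d`
  -- gives `r ≥ d + g/2`, so `r²` exceeds `d²` by at least `g`, the error allowed for the square
  -- root. In the application `z` is `2 log log N` and `i` its reciprocal.
  degree-arithmetic : ∀ {g γ r d y i z} → 0ℚ < g → g ≤ γ → γ ≤ 1ℚ → ι 2 ≤ d →
    d ≤ (1ℚ - γ) * r + ½ * g → r * (r * 1ℚ) ≤ y * i + g → 0ℚ ≤ z → i * z ≡ 1ℚ → d * d * z ≤ y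
  degree-arithmetic {g} {γ} {r} {d} {y} {i} {z} 0<g g≤γ γ≤1 2≤d d≤ r²≤ 0≤z iz≡1 = begin
    d * d * z        ≤⟨ *-monoʳ 0≤z d²≤yi ⟩
    y * i * z        ≡⟨ ℚ.*-assoc y i z ⟩
    y * (i * z)      ≡⟨ cong (y *_) iz≡1 ⟩
    y * 1ℚ           ≡⟨ ℚ.*-identityʳ y ⟩
    y                ∎
    where
    0≤g = ℚ.<⇒≤ 0<g
    g≤1 = ℚ.≤-trans g≤γ γ≤1
    0≤d : 0ℚ ≤ d
    0≤d = ℚ.≤-trans (0≤ι 2) 2≤d
    0≤½g : 0ℚ ≤ ½ * g
    0≤½g = ℚ.<⇒≤ (0<½* 0<g)
    0≤r : 0ℚ ≤ r
    0≤r = ℚ.≮⇒≥ λ r<0 → ℚ.<-irrefl refl (ℚ.<-≤-trans 0<1 (≤-byDiff (identity d γ r g)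
      (0≤+ (0≤+ (0≤+ (≤⇒0≤- d≤) (≤⇒0≤- 2≤d)) (0≤* (≤⇒0≤- γ≤1) (≤⇒0≤- (ℚ.<⇒≤ r<0)))) (0≤+ (0≤* (ℚ.<⇒≤ 0<½) (≤⇒0≤- g≤1)) (ℚ.<⇒≤ 0<½)))))
      where
      identity : ∀ d γ r g → 0ℚ - 1ℚ ≡ (1ℚ - γ) * r + ½ * g - d + (d - ι 2) + (1ℚ - γ) * (0ℚ - r) + (½ * (1ℚ - g) + ½)
      identity = solve-∀ ℚ-ring
    0≤γ = ℚ.≤-trans 0≤g g≤γ
    1≤r : 1ℚ ≤ r
    1≤r = ≤-byDiff (identity d γ r g)
      (0≤+ (0≤+ (0≤+ (≤⇒0≤- d≤) (≤⇒0≤- 2≤d)) (0≤* 0≤γ 0≤r)) (0≤+ (0≤* (ℚ.<⇒≤ 0<½) (≤⇒0≤- g≤1)) (ℚ.<⇒≤ 0<½)))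
      where
      identity : ∀ d γ r g → r - 1ℚ ≡ (1ℚ - γ) * r + ½ * g - d + (d - ι 2) + γ * r + (½ * (1ℚ - g) + ½)
      identity = solve-∀ ℚ-ring
    r≥ : d + ½ * g ≤ r
    r≥ = ≤-byDiff (identity d γ r g) (0≤+ (0≤+ (≤⇒0≤- d≤) (0≤* 0≤r (≤⇒0≤- g≤γ))) (0≤* 0≤g (≤⇒0≤- 1≤r)))
      where
      identity : ∀ d γ r g → r - (d + ½ * g) ≡ (1ℚ - γ) * r + ½ * g - d + r * (γ - g) + g * (r - 1ℚ)
      identity = solve-∀ ℚ-ring
    d²≤yi : d * d ≤ y * i
    d²≤yi = ≤-byDiff (identity d g r (y * i)) (0≤+ (0≤+ (0≤+ (≤⇒0≤- r²≤)
        (≤⇒0≤- (*-mono 0≤r (0≤+ 0≤d 0≤½g) r≥ r≥))) (0≤* 0≤g (≤⇒0≤- (ℚ.≤-trans (1≤ι 1) 2≤d)))) (0≤x² (½ * g)))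
      where
      identity : ∀ d g r w → w - d * d ≡
        w + g - r * (r * 1ℚ) + (r * r - (d + ½ * g) * (d + ½ * g)) + g * (d - 1ℚ) + (½ * g) * (½ * g)
      identity = solve-∀ ℚ-ring

  module _ {γ : ℝ} {N : ℕ} {D : ℝ} (bound : IsDegreeBound γ N D) where
    open IsDegreeBound bound

    degree-bound : 0ᵣ <ᵣ γ → γ <ᵣ 1ᵣ → ∀ d → 2 ℕ.≤ d → fromℕ d ≤ᵣ D →
      Eventually (λ n → ι (2 ℕ.* (d ℕ.* d)) * seq loglogN n ≤ seq logN n)
    degree-bound (g , 0<g , M , hγ) γ<1 d 2≤d d≤D = eventually-map
      (λ n (g<γ , γ≤1 , d<D , D≈ , r² , κ<z , iz) →
        subst (_≤ seq logN n) (trans (sym (ℚ.*-assoc (ι d * ι d) (ι 2) (seq loglogN n)))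
            (cong (_* seq loglogN n) (trans (ℚ.*-comm (ι d * ι d) (ι 2)) (sym (trans (ι-* 2 (d ℕ.* d)) (cong (ι 2 *_) (ι-* d d)))))))
          (degree-arithmetic {g} {seq γ n} {seq root n} {ι d} {seq logN n} {seq (recip (fromℕ 2 *ᵣ loglogN) 2loglogN>0) n} {ι 2 * seq loglogN n}
            0<g (ℚ.<⇒≤ (subst (_< seq γ n) (ℚ.+-identityˡ g) g<γ)) γ≤1 (ι-mono 2≤d)
            (combine {ι d} {seq D n} {(1ℚ - seq γ n) * seq root n} (ℚ.≤-trans (ℚ.≤-reflexive (sym (/1≡ι d))) (ℚ.<⇒≤ d<D))
              (∣-∣-≤ {seq D n} {(1ℚ - seq γ n) * seq root n} D≈))
            (∣-∣-≤ r²) κ<z iz))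
      ((M , hγ) & <ᵣ⇒≤ {γ} {1ᵣ} γ<1 & d≤D (½ * (½ * g)) (0<½* (0<½* 0<g)) & ≃ᵣ⇒≋ {D} {(1ᵣ -ᵣ γ) *ᵣ root} isBound (½ * (½ * g)) (0<½* (0<½* 0<g))
        & ≃ᵣ⇒≋ {root ^ᵣ 2} {logN ÷ᵣ (fromℕ 2 *ᵣ loglogN) [ 2loglogN>0 ]} (proj₂ isRoot) g 0<g
        & <ᵣ⇒≤ {0ᵣ} {fromℕ 2 *ᵣ loglogN} 2loglogN>0 & recip-inverse (fromℕ 2 *ᵣ loglogN) 2loglogN>0)
      where
      combine : ∀ {d D w} → d ≤ D + ½ * (½ * g) → D ≤ w + ½ * (½ * g) → d ≤ w + ½ * g
      combine {d} {D} {w} h₁ h₂ = ≤-byDiff (identity d D w g) (0≤+ (≤⇒0≤- h₁) (≤⇒0≤- h₂))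
        where
        identity : ∀ d D w g → w + ½ * g - d ≡ D + ½ * (½ * g) - d + (w + ½ * (½ * g) - D)
        identity = solve-∀ ℚ-ring

  -- Moves an approximation of `p` to where the rational estimate applies exactly. The outer maximum
  -- is needed because an approximation of the nonnegative root `P` may itself be negative.
  clamp : ℚ → ℚ → ℚ
  clamp p P = 0ℚ ⊔ (p ⊓ (1ℚ ⊓ P))

  0≤clamp : ∀ p P → 0ℚ ≤ clamp p P
  0≤clamp p P = ℚ.p≤p⊔q 0ℚ (p ⊓ (1ℚ ⊓ P))

  clamp≤1 : ∀ p P → clamp p P ≤ 1ℚ
  clamp≤1 p P = ℚ.⊔-lub 0≤1 (ℚ.≤-trans (ℚ.p⊓q≤q p (1ℚ ⊓ P)) (ℚ.p⊓q≤p 1ℚ P))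

  clamp≤ : ∀ p P → clamp p P ≤ 0ℚ ⊔ P
  clamp≤ p P = ℚ.⊔-lub (ℚ.p≤p⊔q 0ℚ P)
    (ℚ.≤-trans (ℚ.p⊓q≤q p (1ℚ ⊓ P)) (ℚ.≤-trans (ℚ.p⊓q≤q 1ℚ P) (ℚ.p≤q⊔p 0ℚ P)))

  clamp-close : ∀ {p P η} → 0ℚ ≤ η → 0ℚ ≤ p + η → p ≤ 1ℚ + η → p ≤ P + η → ∣ p - clamp p P ∣ ≤ η
  clamp-close {p} {P} {η} 0≤η lower upper below = ∣-∣-bound
    (shift p (clamp p P) (ℚ.≤-trans (ℚ.⊓-glb (-nonneg≤ {p} 0≤η) (ℚ.⊓-glb (unshift p 1ℚ upper) (unshift p P below)))
      (ℚ.p≤q⊔p 0ℚ (p ⊓ (1ℚ ⊓ P)))))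
    (ℚ.⊔-lub lower (ℚ.≤-trans (ℚ.p⊓q≤p p (1ℚ ⊓ P)) (≤+nonneg {p} 0≤η)))
    where
    shift : ∀ a b → a - η ≤ b → a ≤ b + η
    shift a b h = ≤-byDiff (identity a b η) (≤⇒0≤- h)
      where
      identity : ∀ a b η → b + η - a ≡ b - (a - η)
      identity = solve-∀ ℚ-ring
    unshift : ∀ a b → a ≤ b + η → a - η ≤ b
    unshift a b h = ≤-byDiff (identity a b η) (≤⇒0≤- h)
      where
      identity : ∀ a b η → b - (a - η) ≡ b + η - a
      identity = solve-∀ ℚ-ring

  positive-part-close : ∀ {P η} → 0ℚ ≤ η → 0ℚ ≤ P + η → ∣ P - (0ℚ ⊔ P) ∣ ≤ η
  positive-part-close {P} {η} 0≤η lower = ∣-∣-bound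
    (ℚ.≤-trans (ℚ.p≤q⊔p 0ℚ P) (≤+nonneg {0ℚ ⊔ P} 0≤η)) (ℚ.⊔-lub lower (≤+nonneg {P} 0≤η))

  -- The error allowed for the root is `i j`, the reciprocal of `2^d N^(d-1)`, so that it
  -- contributes only `e + 1` after clearing denominators. Since `ε ≥ 2/(e + 1)`, the factor `1 - ε`
  -- is at most `(e - 1)/(e + 1)`; `slots-step` spends the difference to `e/(e + 1)`.
  probability-arithmetic : ∀ {e} {a b f x ε i j y q} → 0ℚ ≤ a → 0ℚ ≤ b → 0ℚ ≤ f → 0ℚ ≤ y → ι 2 ≤ ι (suc e) * ε →
    a * i ≡ 1ℚ → b * j ≡ 1ℚ → x ≤ q + i * j → q ≡ f * (1ℚ - ε) * i * (y * j) →
    ι (suc e) * (a * x * b) ≤ f * ((ι e - 1ℚ) * y) + ι (suc e)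
  probability-arithmetic {e} {a} {b} {f} {x} {ε} {i} {j} {y} {q} 0≤a 0≤b 0≤f 0≤y 2≤ ai bj x≤ refl = begin
    s * (a * x * b)
      ≤⟨ *-monoˡ (0≤ι (suc e)) (*-monoʳ 0≤b (*-monoˡ 0≤a x≤)) ⟩
    s * (a * (f * (1ℚ - ε) * i * (y * j) + i * j) * b)
      ≡⟨ identity s a f ε i y j b ⟩
    s * (f * (1ℚ - ε) * y * (a * i) * (b * j) + (a * i) * (b * j))
      ≡⟨ cong₂ (λ u v → s * (f * (1ℚ - ε) * y * u * v + u * v)) ai bj ⟩
    s * (f * (1ℚ - ε) * y * 1ℚ * 1ℚ + 1ℚ * 1ℚ)
      ≤⟨ ≤-byDiff (identity₂ (ι e) f ε y) (0≤* (0≤* 0≤f 0≤y) (≤⇒0≤- 2≤)) ⟩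
    f * ((ι e - 1ℚ) * y) + ι (suc e) ∎
    where
    s = ι (suc e)
    identity : ∀ s a f ε i y j b → s * (a * (f * (1ℚ - ε) * i * (y * j) + i * j) * b) ≡
      s * (f * (1ℚ - ε) * y * (a * i) * (b * j) + (a * i) * (b * j))
    identity = solve-∀ ℚ-ring
    identity₂ : ∀ e f ε y →
      f * ((e - 1ℚ) * y) + (1ℚ + e) - (1ℚ + e) * (f * (1ℚ - ε) * y * 1ℚ * 1ℚ + 1ℚ * 1ℚ) ≡ f * y * ((1ℚ + e) * ε - ι 2)
    identity₂ = solve-∀ ℚ-ring

  module _ {ε : ℝ} {N : ℕ} .{{_ : ℕ.NonZero N}} {d′ : ℕ} {P : ℝ} (bound : IsProbabilityBound ε N (suc d′) P) where
    open IsProbabilityBound bound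

    private
      d = suc d′
      i j : ℚ
      i = (ℤ.+ 1 / (2 ℕ.^ d)) {{ℕ.m^n≢0 2 d}}
      j = (ℤ.+ 1 / (N ℕ.^ d′)) {{ℕ.m^n≢0 N d′}}
      ai : ι 2 ^ d * i ≡ 1ℚ
      ai = trans (cong (_* i) (sym (ι-^ 2 d))) (ι*1/ (2 ℕ.^ d) {{ℕ.m^n≢0 2 d}})
      bj : ι N ^ d′ * j ≡ 1ℚ
      bj = trans (cong (_* j) (sym (ι-^ N d′))) (ι*1/ (N ℕ.^ d′) {{ℕ.m^n≢0 N d′}})
      inverse>0 : ∀ {a b} → 0ℚ ≤ a → a * b ≡ 1ℚ → 0ℚ < b
      inverse>0 {a} {b} a≥0 ab = ℚ.≰⇒> λ b≤0 → ℚ.<-irrefl refl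
        (ℚ.<-≤-trans 0<1 (subst₂ _≤_ ab (ℚ.*-zeroʳ a) (*-monoˡ a≥0 b≤0)))
      0≤a : 0ℚ ≤ ι 2 ^ d
      0≤a = 0≤^ d (0≤ι 2)
      0≤b : 0ℚ ≤ ι N ^ d′
      0≤b = 0≤^ d′ (0≤ι N)
      root-power : (λ n → (0ℚ ⊔ seq P n) ^ d) ≋ (λ n → ((ℤ.+ (d !) / 1) * (1ℚ - seq ε n)) * i * (seq logN n * j))
      root-power = ≋-trans {λ n → (0ℚ ⊔ seq P n) ^ d} {λ n → seq P n ^ d}
        (≋-sym {λ n → seq P n ^ d} (proj₂ (close-^ d (cauchy⇒bounded P , nonnegative))))
        (λ η η>0 → eventually-map (λ n → subst (λ z → ∣ z - ((ℤ.+ (d !) / 1) * (1ℚ - seq ε n)) * i * (seq logN n * j) ∣ ≤ η) (seq-^ P d n))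
          (≃ᵣ⇒≋ {P ^ᵣ d} {(fromℕ (d !) *ᵣ (1ᵣ -ᵣ ε)) *ᵣ fromℚ i *ᵣ (logN *ᵣ fromℚ j)} (proj₂ isRoot) η η>0))
        where
        nonnegative : seq P ≋ (λ n → 0ℚ ⊔ seq P n)
        nonnegative η η>0 = eventually-map (λ n h → positive-part-close {seq P n} (ℚ.<⇒≤ η>0) (ℚ.<⇒≤ h)) (proj₁ isRoot η η>0)

    probability-bound : ∀ e (p : ℝ) → Eventually (λ n → ι 2 ≤ ι (suc e) * seq ε n) → Eventually (λ n → 0ℚ ≤ seq logN n) →
      Eventually (λ n → ι (suc e) * ((ι 2 * clamp (seq p n) (seq P n)) ^ d * ι N ^ d′) ≤
        ι (d !) * ((ι e - 1ℚ) * seq logN n) + ι (suc e))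
    probability-bound e p large logN≥0 = eventually-map
      (λ n (2≤ , 0≤y , close) → let p′ = clamp (seq p n) (seq P n) in
        subst (λ z → ι (suc e) * (z * ι N ^ d′) ≤ ι (d !) * ((ι e - 1ℚ) * seq logN n) + ι (suc e))
          (sym (^-distrib-* (ι 2) p′ d))
          (probability-arithmetic {e} {ι 2 ^ d} {ι N ^ d′} {ι (d !)} {p′ ^ d} {seq ε n} {i} {j} {seq logN n}
            0≤a 0≤b (0≤ι (d !)) 0≤y 2≤ ai bj
            (ℚ.≤-trans (^-mono d (0≤clamp (seq p n) (seq P n)) (clamp≤ (seq p n) (seq P n))) (∣-∣-≤ close))
            (cong (λ z → z * (1ℚ - seq ε n) * i * (seq logN n * j)) (/1≡ι (d !)))))
      (large & logN≥0 & root-power (i * j) (0<* (inverse>0 0≤a ai) (inverse>0 0≤b bj)))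

    probability-clamp : ∀ (p : ℝ) → 0ᵣ ≤ᵣ p → p ≤ᵣ 1ᵣ → p ≤ᵣ P → seq p ≋ (λ n → clamp (seq p n) (seq P n))
    probability-clamp p 0≤p p≤1 p≤P η η>0 = eventually-map
      (λ n (a , b , c) → clamp-close {seq p n} {seq P n} (ℚ.<⇒≤ η>0) (ℚ.<⇒≤ a) (ℚ.<⇒≤ b) (ℚ.<⇒≤ c))
      (0≤p η η>0 & p≤1 η η>0 & p≤P η η>0)

-- The threshold contains a factorial, which must not be evaluated.
abstract
  rational-bound : ∀ (a ℓ : Level) (e C : ℕ) → ∃ λ threshold →
    ∀ {N} (G : AbelianGroupOfOrder a ℓ N) d′ → 1 ℕ.≤ d′ → ∀ L p → 0ℚ ≤ p → p ≤ 1ℚ → 1 ℕ.≤ N →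
    ι threshold ≤ L → ι 5 * ι (suc d′) ≤ L → (∀ k → expSum L k ≤ ι N) →
    L ^ (2 ℕ.* (suc d′ ℕ.* suc d′)) ≤ ι N →
    ι (suc e) * ((ι 2 * p) ^ suc d′ * ι N ^ d′) ≤ ι e * (ι (suc d′ !) * L) →
    ι C * expectation p (λ S → 𝟙 (Cayley.diameterAtMost? G (suc d′) S)) ≤ 1ℚ
  rational-bound a ℓ e C = Core.threshold e C , λ G d′ 1≤d′ L p 0≤p p≤1 1≤N h₁ h₂ h₃ h₄ h₅ →
    subst (λ z → ι C * z ≤ 1ℚ) (sym (expectation≡E p 0≤p p≤1 (λ S → 𝟙 (Cayley.diameterAtMost? G (suc d′) S))))
      (Core.core e C G d′ 1≤d′ L p 0≤p p≤1 1≤N h₁ h₂ h₃ h₄ h₅)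

-- Arithmetic linking approximate logarithms to the rational hypotheses

module _ where
  open ℚ.≤-Reasoning

  -- In terms of limits: `(log N)^m = exp (m log log N) ≤ exp (log N) =
  -- N`. Here `l` and `y` approximate `log N` and `log log N`, and powers of partial sums are
  -- bounded by partial sums.
  power-step : ∀ L l y b m K → 0ℚ ≤ L → L + 1ℚ ≤ l → l ≤ expSum y K + 1ℚ → 1ℚ ≤ y → ι m * y ≤ l →
    (∀ z → 0ℚ ≤ z → z ≤ l → expSum z (suc (m ℕ.* K)) ≤ b) → L ^ m ≤ b
  power-step L l y b m K 0≤L L<l l≤ 1≤y my≤l h = begin
    L ^ m                                ≤⟨ ^-mono m 0≤L (≤-byDiff (identity L l (expSum y K)) (0≤+ (≤⇒0≤- L<l) (≤⇒0≤- l≤))) ⟩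
    expSum y K ^ m                       ≤⟨ expSum-^≤ m K 0≤y ⟩
    expSum (ι m * y) (suc (m ℕ.* K))     ≤⟨ h (ι m * y) (0≤* (0≤ι m) 0≤y) my≤l ⟩
    b                                    ∎
    where
    0≤y = ℚ.≤-trans 0≤1 1≤y
    identity : ∀ L l s → s - L ≡ l - (L + 1ℚ) + (s + 1ℚ - l)
    identity = solve-∀ ℚ-ring

  -- Once `log log N ≥ 1`, the degree bound gives `2d² ≤ log N`. This is the source of `5d ≤ L`,
  -- through `5d ≤ d²` when `d ≥ 5`.
  square-step : ∀ L l y d → ι 25 ≤ L → l ≤ L + ι 3 → 1ℚ ≤ y → ι (2 ℕ.* (d ℕ.* d)) * y ≤ l → ι d * ι d ≤ L
  square-step L l y d 25≤L l≤ 1≤y h = *-cancelˡ (0<ι 1) (begin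
    ι 2 * (ι d * ι d)             ≡⟨ trans (ι-* 2 (d ℕ.* d)) (cong (ι 2 *_) (ι-* d d)) ⟨
    ι (2 ℕ.* (d ℕ.* d))           ≤⟨ ≤*1≤ (0≤ι (2 ℕ.* (d ℕ.* d))) 1≤y ⟩
    ι (2 ℕ.* (d ℕ.* d)) * y       ≤⟨ h ⟩
    l                             ≤⟨ l≤ ⟩
    L + ι 3                       ≤⟨ ℚ.+-monoʳ-≤ L (ℚ.≤-trans (ι-mono (ℕ.m≤m+n 3 22)) 25≤L) ⟩
    L + L                         ≡⟨ identity L ⟩
    ι 2 * L                       ∎)
    where
    identity : ∀ L → L + L ≡ ι 2 * L
    identity = solve-∀ ℚ-ring

  near-step : ∀ L l l′ → 0ℚ ≤ L → L + 1ℚ ≤ l → l ≤ L + ι 3 → l′ ≤ l + 1ℚ → l ≤ l′ + 1ℚ → 0ℚ ≤ l′ × l′ ≤ L + ι 4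
  near-step L l l′ 0≤L lower upper agree₁ agree₂ =
    ≤-byDiff (identity₁ L l l′) (0≤+ (0≤+ (≤⇒0≤- lower) (≤⇒0≤- agree₂)) 0≤L) ,
    ≤-byDiff (identity₂ L l l′) (0≤+ (≤⇒0≤- upper) (≤⇒0≤- agree₁))
    where
    identity₁ : ∀ L l l′ → l′ - 0ℚ ≡ l - (L + 1ℚ) + (l′ + 1ℚ - l) + L
    identity₁ = solve-∀ ℚ-ring
    identity₂ : ∀ L l l′ → L + ι 4 - l′ ≡ L + ι 3 - l + (l + 1ℚ - l′)
    identity₂ = solve-∀ ℚ-ring

  -- Replacing `y` by the slightly smaller `L` and dropping the additive error both cost a bounded
  -- amount per `f`; enlarging the factor `e - 1` to `e` provides a whole `f L` to pay for them.
  slots-step : ∀ k f L y → 1ℚ ≤ f → ι 5 * ι (suc (suc k)) ≤ L → y ≤ L + ι 4 →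
    f * ((ι (suc k) - 1ℚ) * y) + ι (suc (suc k)) ≤ ι (suc k) * (f * L)
  slots-step k f L y 1≤f 5k≤L y≤ = ≤-byDiff (identity f (ι k) L y)
    (0≤+ (0≤+ (0≤+ (0≤* 0≤f (0≤* (0≤ι k) (≤⇒0≤- y≤))) (0≤* 0≤f (≤⇒0≤- 5k≤L)))
      (0≤* (≤⇒0≤- 1≤f) (0≤+ (0≤ι k) (0≤ι 10)))) (0≤ι 8))
    where
    0≤f = ℚ.≤-trans 0≤1 1≤f
    identity : ∀ f k L y → (1ℚ + k) * (f * L) - (f * ((1ℚ + k - 1ℚ) * y) + (1ℚ + (1ℚ + k))) ≡
      f * (k * (L + ι 4 - y)) + f * (L - ι 5 * (1ℚ + (1ℚ + k))) + (f - 1ℚ) * (k + ι 10) + ι 8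
    identity = solve-∀ ℚ-ring

  -- Half of `η` is left for the rational estimate; one quarter pays for clamping `p`, the other for
  -- the strict gap that `_<ᵣ_` demands.
  rare-step : ∀ k {x η} → 0ℚ ≤ η → ι 2 ≤ ι (suc k) * η → ι (suc k) * x ≤ 1ℚ → x + ½ * (½ * η) + ½ * (½ * η) ≤ η
  rare-step k {x} {η} 0≤η 2≤ rare = ≤-byDiff (identity x η) (0≤* (ℚ.<⇒≤ 0<½) (≤⇒0≤- (*-cancelˡ (0<ι k) (begin
    ι (suc k) * (ι 2 * x)   ≡⟨ exchange (ι (suc k)) (ι 2) x ⟩
    ι 2 * (ι (suc k) * x)   ≤⟨ *-monoˡ (0≤ι 2) rare ⟩
    ι 2 * 1ℚ                ≡⟨ ℚ.*-identityʳ (ι 2) ⟩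
    ι 2                     ≤⟨ 2≤ ⟩
    ι (suc k) * η           ∎))))
    where
    exchange : ∀ a b c → a * (b * c) ≡ b * (a * c)
    exchange = solve-∀ ℚ-ring
    identity : ∀ x η → η - (x + ½ * (½ * η) + ½ * (½ * η)) ≡ ½ * (η - ι 2 * x)
    identity = solve-∀ ℚ-ring

-- Choice of the thresholds and conclusion for given `ε`, `γ` and `δ`

module _ {c ℓ : Level} (ε γ : ℝ) (0<ε : 0ᵣ <ᵣ ε) (0<γ : 0ᵣ <ᵣ γ) (γ<1 : γ <ᵣ 1ᵣ) (δ : ℝ) (0<δ : 0ᵣ <ᵣ δ) where
  open ℚ.≤-Reasoning

  private
    ηε ηδ : ℚ
    ηε = proj₁ 0<ε
    ηδ = proj₁ 0<δ

    0<ηδ : 0ℚ < ηδ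
    0<ηδ = proj₁ (proj₂ 0<δ)

    kε kδ : ℕ
    kε = proj₁ (archimedean-inverse (proj₁ (proj₂ 0<ε)))
    kδ = proj₁ (archimedean-inverse 0<ηδ)

    -- Both are about twice what the rational lower bounds of `ε` and `δ` require: half of each
    -- bound is reserved for the errors made in passing from reals to rationals.
    e C : ℕ
    e = suc (2 ℕ.* kε)
    C = suc (suc (2 ℕ.* kδ))

    double : ∀ k {η} → 0ℚ ≤ η → 1ℚ ≤ ι k * η → ι 2 ≤ ι (suc (suc (2 ℕ.* k))) * η
    double k {η} 0≤η h = begin
      ι 2                            ≡⟨ ℚ.*-identityʳ (ι 2) ⟨
      ι 2 * 1ℚ                       ≤⟨ *-monoˡ (0≤ι 2) h ⟩
      ι 2 * (ι k * η)                ≡⟨ ℚ.*-assoc (ι 2) (ι k) η ⟨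
      ι 2 * ι k * η                  ≡⟨ cong (_* η) (ι-* 2 k) ⟨
      ι (2 ℕ.* k) * η                ≤⟨ *-monoʳ 0≤η (ι-mono (ℕ.m≤n+m (2 ℕ.* k) 2)) ⟩
      ι (suc (suc (2 ℕ.* k))) * η    ∎

    large-ε : Eventually (λ n → ι 2 ≤ ι (suc e) * seq ε n)
    large-ε = eventually-map
      (λ n h → ℚ.≤-trans (double kε (ℚ.<⇒≤ (proj₁ (proj₂ 0<ε))) (proj₂ (archimedean-inverse (proj₁ (proj₂ 0<ε)))))
        (*-monoˡ (0≤ι (suc e)) (subst (_≤ seq ε n) (ℚ.+-identityˡ ηε) (ℚ.<⇒≤ h))))
      (proj₂ (proj₂ 0<ε))

    -- In `slack`, 25 serves `square-step` and the case `d ≤ 5` of `5d ≤ L`, the next summand serves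
    -- `slots-step`, and the last ensures `log log N ≥ 1`. The 3 in `order-threshold` is what
    -- `exp-injective` asks of `N`.
    threshold loglog-threshold log-threshold slack order-threshold : ℕ
    threshold        = proj₁ (rational-bound c ℓ e C)
    loglog-threshold = proj₁ (exp-large⇒large 1ℚ 0≤1)
    slack            = 25 ℕ.+ (5 ℕ.* suc e ℕ.+ loglog-threshold)
    log-threshold    = threshold ℕ.+ slack
    order-threshold  = proj₁ (exp-large⇒large (ι (2 ℕ.+ log-threshold)) (0≤ι (2 ℕ.+ log-threshold))) ℕ.+ 3

    module _ (N : ℕ) .{{_ : ℕ.NonZero N}} (large-N : order-threshold ℕ.≤ N) (G : AbelianGroupOfOrder c ℓ N)
             (d′ : ℕ) (1≤d′ : 1 ℕ.≤ d′) (dN : ℝ) (degree : IsDegreeBound γ N dN) (d≤dN : fromℕ (suc d′) ≤ᵣ dN)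
             (P : ℝ) (probability : IsProbabilityBound ε N (suc d′) P)
             (p : ℝ) (0≤p : 0ᵣ ≤ᵣ p) (p≤1 : p ≤ᵣ 1ᵣ) (p≤P : p ≤ᵣ P) where

      open IsDegreeBound degree using (logN; loglogN; isLogN; isLogLogN)
      open IsProbabilityBound probability using () renaming (logN to logN′; isLogN to isLogN′)

      d m : ℕ
      d = suc d′
      m = 2 ℕ.* (d ℕ.* d)

      above : ∀ {j} → j ℕ.≤ order-threshold → Eventually (λ n → ι j ≤ seq (fromℕ N) n)
      above h = always (λ _ → ℚ.≤-trans (ι-mono (ℕ.≤-trans h large-N)) (ℚ.≤-reflexive (sym (/1≡ι N))))

      3≤order : 3 ℕ.≤ order-threshold
      3≤order = ℕ.m≤n+m 3 (proj₁ (exp-large⇒large (ι (2 ℕ.+ log-threshold)) (0≤ι (2 ℕ.+ log-threshold))))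

      1≤N : 1 ℕ.≤ N
      1≤N = ℕ.≤-trans (ℕ.s≤s ℕ.z≤n) (ℕ.≤-trans 3≤order large-N)

      log-large : Eventually (λ n → ι (2 ℕ.+ log-threshold) ≤ seq logN n)
      log-large = proj₂ (exp-large⇒large (ι (2 ℕ.+ log-threshold)) (0≤ι (2 ℕ.+ log-threshold))) {fromℕ N} {logN} isLogN
        (above (ℕ.m≤m+n (proj₁ (exp-large⇒large (ι (2 ℕ.+ log-threshold)) (0≤ι (2 ℕ.+ log-threshold)))) 3))

      loglog-large : Eventually (λ n → 1ℚ ≤ seq loglogN n)
      loglog-large = proj₂ (exp-large⇒large 1ℚ 0≤1) {logN} {loglogN} isLogLogN (eventually-map
        (λ n → ℚ.≤-trans (ι-mono (ℕ.≤-trans (ℕ.m≤n+m loglog-threshold (5 ℕ.* suc e)) (ℕ.≤-trans (ℕ.m≤n+m (5 ℕ.* suc e ℕ.+ loglog-threshold) 25)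
          (ℕ.≤-trans (ℕ.m≤n+m slack threshold) (ℕ.m≤n+m log-threshold 2)))))) log-large)

      logs-agree : Eventually (λ n → seq logN′ n ≤ seq logN n + 1ℚ × seq logN n ≤ seq logN′ n + 1ℚ)
      logs-agree = exp-injective {fromℕ N} {logN} {logN′} isLogN isLogN′ (above 3≤order)
                 & exp-injective {fromℕ N} {logN′} {logN} isLogN′ isLogN (above 3≤order)

      late : ℕ
      late = proj₁ log-large ℕ.⊔ proj₁ (cauchy logN 1ℚ 0<1)

      -- A rational slightly below log N.
      L : ℚ
      L = seq logN late - ι 2

      log-threshold≤L : ι log-threshold ≤ L
      log-threshold≤L = ≤-byDiff (identity (ι log-threshold) (seq logN late))
        (≤⇒0≤- (proj₂ log-large late (ℕ.m≤m⊔n (proj₁ log-large) (proj₁ (cauchy logN 1ℚ 0<1)))))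
        where
        identity : ∀ t l → l - ι 2 - t ≡ l - (1ℚ + (1ℚ + t))
        identity = solve-∀ ℚ-ring

      slack≤L : ι slack ≤ L
      slack≤L = ℚ.≤-trans (ι-mono (ℕ.m≤n+m slack threshold)) log-threshold≤L

      25≤L : ι 25 ≤ L
      25≤L = ℚ.≤-trans (ι-mono (ℕ.m≤m+n 25 (5 ℕ.* suc e ℕ.+ loglog-threshold))) slack≤L

      5e≤L : ι 5 * ι (suc e) ≤ L
      5e≤L = subst (_≤ L) (ι-* 5 (suc e)) (ℚ.≤-trans (ι-mono (ℕ.≤-trans (ℕ.m≤m+n (5 ℕ.* suc e) loglog-threshold)
        (ℕ.m≤n+m (5 ℕ.* suc e ℕ.+ loglog-threshold) 25))) slack≤L)

      0≤L : 0ℚ ≤ L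
      0≤L = ℚ.≤-trans (0≤ι 25) 25≤L

      near : Eventually (λ n → L + 1ℚ ≤ seq logN n × seq logN n ≤ L + ι 3)
      near = proj₁ (cauchy logN 1ℚ 0<1) , λ n M≤n →
        let close = ℚ.<⇒≤ (proj₂ (cauchy logN 1ℚ 0<1) n late M≤n (ℕ.m≤n⊔m (proj₁ log-large) (proj₁ (cauchy logN 1ℚ 0<1))))
        in ≤-byDiff (identity₁ (seq logN late) (seq logN n))
             (≤⇒0≤- (∣-∣-≤ {seq logN late} {seq logN n} (subst (_≤ 1ℚ) (∣-∣-sym (seq logN n) (seq logN late)) close))) ,
           ≤-byDiff (identity₂ (seq logN late) (seq logN n)) (≤⇒0≤- (∣-∣-≤ {seq logN n} {seq logN late} close))
        where
        identity₁ : ∀ a b → b - (a - ι 2 + 1ℚ) ≡ b + 1ℚ - a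
        identity₁ = solve-∀ ℚ-ring
        identity₂ : ∀ a b → a - ι 2 + ι 3 - b ≡ a + 1ℚ - b
        identity₂ = solve-∀ ℚ-ring

      expSum≤N : ∀ k η → 0ℚ < η → Eventually (λ n → ∀ z → 0ℚ ≤ z → z ≤ seq logN n → expSum z k ≤ ι N + η)
      expSum≤N k η 0<η = eventually-map
        {λ n → ∀ z → 0ℚ ≤ z → z ≤ seq logN n → expSum z k ≤ (ℤ.+ N / 1) + η}
        (λ n h z 0≤z z≤ → subst (λ b → expSum z k ≤ b + η) (/1≡ι N) (h z 0≤z z≤))
        (expSum≤ {fromℕ N} {logN} isLogN k η 0<η)

      exp≤N : ∀ k → expSum L k ≤ ι N
      exp≤N k = ≤-closed {expSum L k} {ι N} λ η 0<η → proj₂ (witness {λ _ → expSum L k ≤ ι N + η} (eventually-map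
        {λ n → (L + 1ℚ ≤ seq logN n × seq logN n ≤ L + ι 3) × (∀ z → 0ℚ ≤ z → z ≤ seq logN n → expSum z k ≤ ι N + η)}
        (λ n ((L<log , _) , h) → h L 0≤L (ℚ.≤-trans (≤+nonneg {L} 0≤1) L<log))
        (near & expSum≤N k η 0<η)))

      degrees : Eventually (λ n → ι m * seq loglogN n ≤ seq logN n)
      degrees = degree-bound degree 0<γ γ<1 d (ℕ.s≤s 1≤d′) d≤dN

      power≤N : L ^ m ≤ ι N
      power≤N = ≤-closed {L ^ m} {ι N} λ η 0<η →
        let K , limit = exp-limit {logN} {loglogN} isLogLogN 1ℚ 0<1
        in proj₂ (witness {λ _ → L ^ m ≤ ι N + η} (eventually-map
          {λ n → (L + 1ℚ ≤ seq logN n × seq logN n ≤ L + ι 3) ×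
                 (expSum (seq loglogN n) K ≤ seq logN n + 1ℚ × seq logN n ≤ expSum (seq loglogN n) K + 1ℚ) ×
                 1ℚ ≤ seq loglogN n × ι m * seq loglogN n ≤ seq logN n ×
                 (∀ z → 0ℚ ≤ z → z ≤ seq logN n → expSum z (suc (m ℕ.* K)) ≤ ι N + η)}
          (λ n ((L<log , _) , (_ , log≤) , 1≤loglog , degree≤ , h) →
            power-step L (seq logN n) (seq loglogN n) (ι N + η) m K 0≤L L<log log≤ 1≤loglog degree≤ h)
          (near & limit K ℕ.≤-refl & loglog-large & degrees & expSum≤N (suc (m ℕ.* K)) η 0<η)))

      d²≤L : ι d * ι d ≤ L
      d²≤L = proj₂ (witness {λ _ → ι d * ι d ≤ L} (eventually-map
        {λ n → (L + 1ℚ ≤ seq logN n × seq logN n ≤ L + ι 3) × 1ℚ ≤ seq loglogN n × ι m * seq loglogN n ≤ seq logN n}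
        (λ n ((_ , log≤) , 1≤loglog , degree≤) → square-step L (seq logN n) (seq loglogN n) d 25≤L log≤ 1≤loglog degree≤)
        (near & loglog-large & degrees)))

      5d≤L : ι 5 * ι d ≤ L
      5d≤L = [ (λ d≤5 → ℚ.≤-trans (*-monoˡ (0≤ι 5) (ι-mono d≤5)) 25≤L)
             , (λ 5≤d → ℚ.≤-trans (*-monoʳ (0≤ι d) (ι-mono 5≤d)) d²≤L) ]′ (ℕ.≤-total d 5)

      near′ : Eventually (λ n → 0ℚ ≤ seq logN′ n × seq logN′ n ≤ L + ι 4)
      near′ = eventually-map
        {λ n → (L + 1ℚ ≤ seq logN n × seq logN n ≤ L + ι 3) × (seq logN′ n ≤ seq logN n + 1ℚ × seq logN n ≤ seq logN′ n + 1ℚ)}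
        (λ n ((lower , upper) , agree₁ , agree₂) → near-step L (seq logN n) (seq logN′ n) 0≤L lower upper agree₁ agree₂)
        (near & logs-agree)

      p′ : ℕ → ℚ
      p′ n = clamp (seq p n) (seq P n)

      p-bound : Eventually (λ n → ι (suc e) * ((ι 2 * p′ n) ^ d * ι N ^ d′) ≤ ι e * (ι (d !) * L))
      p-bound = eventually-map
        {λ n → ι (suc e) * ((ι 2 * p′ n) ^ d * ι N ^ d′) ≤ ι (d !) * ((ι e - 1ℚ) * seq logN′ n) + ι (suc e) ×
               (0ℚ ≤ seq logN′ n × seq logN′ n ≤ L + ι 4)}
        (λ n (bound , _ , log≤) → ℚ.≤-trans bound (slots-step (2 ℕ.* kε) (ι (d !)) L (seq logN′ n)
          (ι-mono (ℕ.>-nonZero⁻¹ (d !) {{d ℕ.!≢0}})) 5e≤L log≤))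
        (probability-bound probability e p large-ε (eventually-map (λ _ → proj₁) near′) & near′)

      D : Subset N → ℚ
      D S = 𝟙 (Cayley.diameterAtMost? G d S)

      diameter-rare : Pr[diam≤ d ] G p <ᵣ δ
      diameter-rare = ½ * (½ * ηδ) , 0<½* (0<½* 0<ηδ) , eventually-map step
        (p-bound & proj₂ (close-expectation D (cauchy⇒bounded p , probability-clamp probability p 0≤p p≤1 p≤P))
                     (½ * (½ * ηδ)) (0<½* (0<½* 0<ηδ)) & proj₂ (proj₂ 0<δ))
        where
        step : ∀ n → (ι (suc e) * ((ι 2 * p′ n) ^ d * ι N ^ d′) ≤ ι e * (ι (d !) * L)) ×
          (∣ expectation (seq p n) D - expectation (p′ n) D ∣ ≤ ½ * (½ * ηδ)) × (0ℚ + ηδ < seq δ n) →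
          seq (Pr[diam≤ d ] G p) n + ½ * (½ * ηδ) < seq δ n
        step n (bound , close , δ-large) = begin-strict
          seq (Pr[diam≤ d ] G p) n + ½ * (½ * ηδ)
            ≡⟨ cong (_+ ½ * (½ * ηδ)) (seq-Pr p n (Cayley.diameterAtMost? G d)) ⟩
          expectation (seq p n) D + ½ * (½ * ηδ)
            ≤⟨ ℚ.+-monoˡ-≤ (½ * (½ * ηδ)) (∣-∣-≤ {expectation (seq p n) D} {expectation (p′ n) D} close) ⟩
          expectation (p′ n) D + ½ * (½ * ηδ) + ½ * (½ * ηδ)
            ≤⟨ rare-step (suc (2 ℕ.* kδ)) (ℚ.<⇒≤ 0<ηδ) (double kδ (ℚ.<⇒≤ 0<ηδ) (proj₂ (archimedean-inverse 0<ηδ))) rare ⟩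
          ηδ
            <⟨ subst (_< seq δ n) (ℚ.+-identityˡ ηδ) δ-large ⟩
          seq δ n ∎
          where
          rare : ι C * expectation (p′ n) D ≤ 1ℚ
          rare = proj₂ (rational-bound c ℓ e C) G d′ 1≤d′ L (p′ n) (0≤clamp (seq p n) (seq P n)) (clamp≤1 (seq p n) (seq P n)) 1≤N
            (ℚ.≤-trans (ι-mono (ℕ.m≤m+n threshold slack)) log-threshold≤L) 5d≤L exp≤N power≤N bound

  diameter-bound : ∃ λ (N₀ : ℕ) → ∀ (N : ℕ) .{{_ : ℕ.NonZero N}} → N₀ ℕ.≤ N → ∀ (G : AbelianGroupOfOrder c ℓ N) →
    ∀ (d : ℕ) → 2 ℕ.≤ d → ∀ (dN : ℝ) → IsDegreeBound γ N dN → fromℕ d ≤ᵣ dN →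
    ∀ (pN : ℝ) → IsProbabilityBound ε N d pN → ∀ (p : ℝ) → 0ᵣ ≤ᵣ p → p ≤ᵣ 1ᵣ → p ≤ᵣ pN → Pr[diam≤ d ] G p <ᵣ δ
  diameter-bound = order-threshold , λ { N large-N G (suc d′) (ℕ.s≤s 1≤d′) dN degree d≤dN P probability p 0≤p p≤1 p≤P →
    diameter-rare N large-N G d′ 1≤d′ dN degree d≤dN P probability p 0≤p p≤1 p≤P }
theorem3 : ∀ {c ℓ : Level} (ε γ : ℝ) → 0ᵣ <ᵣ ε → 0ᵣ <ᵣ γ → γ <ᵣ 1ᵣ →
    ∀ (δ : ℝ) → 0ᵣ <ᵣ δ →
    ∃ λ (N₀ : ℕ) →
    ∀ (N : ℕ) .{{_ : ℕ.NonZero N}} → N₀ ℕ.≤ N →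
    ∀ (G : AbelianGroupOfOrder c ℓ N) →
    ∀ (d : ℕ) → 2 ℕ.≤ d →
    ∀ (dN : ℝ) → IsDegreeBound γ N dN → fromℕ d ≤ᵣ dN →
    ∀ (pN : ℝ) → IsProbabilityBound ε N d pN →
    ∀ (p : ℝ) → 0ᵣ ≤ᵣ p → p ≤ᵣ 1ᵣ → p ≤ᵣ pN →
    Pr[diam≤ d ] G p <ᵣ δ
theorem3 = diameter-bound
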